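{- For any $\epsilon > 0$, the sequential hiring problem can be approximated within factor $1-\epsilon$ of optimal in quasi-polynomial time. That is, there is an algorithm that, given $\epsilon>0$ and an instance $I=(n,V,P,k,T)$ of the sequential hiring problem, computes a hiring policy whose expected total reward is at least $(1-\epsilon)\cdot\max_{\mathcal H}\mathcal{R}(\mathcal{H})$, where the maximum is over all adaptive hiring policies $\mathcal{H}$. The running time of this algorithm is $O\big(n^{O(1)}\cdot T^{O_{\epsilon}(\log T)}\big)$.
   Context: **Sequential hiring problem.** An instance $I=(n,V,P,k,T)$ consists of $n$ applicants $1,\dots,n$, values $V=(v_1,\dots,v_n)$ with $v_i\ge 0$, acceptance probabilities $P=(p_1,\dots,p_n)\in[0,1]^n$, a number $k\ge1$ of identical positions, and a number $T\ge1$ of stages. Applicants' decisions are mutually independent Bernoulli variables $X_1,\dots,X_n$ with $\Pr[X_i=1]=p_i$ ($X_i=1$ means that $i$ accepts an offer if one is made). A state is a triple $(t,k_t,\mathcal{A}_t)$: the current stage, the number of open positions, and the set of applicants not yet offered a position. The process starts at $(1,k,[n])$ and terminates at states with $t=T+1$, or $k_t=0$, or $\mathcal{A}_t=\emptyset$. An adaptive hiring policy is a function $\mathcal{H}$ that maps each non-terminal state $(t,k_t,\mathcal{A}_t)$ to an applicant $i=\mathcal{H}(t,k_t,\mathcal{A}_t)\in\mathcal{A}_t$, who receives an offer. The reward $X_i v_i$ is collected and the next state is $(t+1,\,k_t-X_i,\,\mathcal{A}_t\setminus\{i\})$. The total expected reward of $\mathcal{H}$ is $\mathcal{R}(\mathcal{H})=\mathcal{R}_{\mathcal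 H}(1,k,[n])$, where $\mathcal{R}_{\mathcal H}$ is $0$ at terminal states and otherwise, with $i=\mathcal{H}(t,k_t,\mathcal{A}_t)$, $$\mathcal{R}_{\mathcal H}(t,k_t,\mathcal{A}_t)=p_i\big(v_i+\mathcal{R}_{\mathcal H}(t+1,k_t-1,\mathcal{A}_t\setminus\{i\})\big)+(1-p_i)\,\mathcal{R}_{\mathcal H}(t+1,k_t,\mathcal{A}_t\setminus\{i\}).$$ **Conventions.** $O_{\epsilon}(f(n,T))$ stands for $O\big((\tfrac1\epsilon)^{O(1)}\cdot f(n,T)\big)$. "Computes a hiring policy" means that the algorithm outputs an explicit description, of size within the running time bound, of the policy's choices at all states it can reach from $(1,k,[n])$. Running times count elementary operations, including arithmetic on the input numbers. -}

module Defs where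

open import Algebra.Bundles.Raw using (RawSemiring)
import Algebra.Definitions.RawSemiring as RawSemiringDefs
open import Algebra.Structures using (IsCommutativeRing)
open import Data.Bool.Base using (Bool; true; false)
open import Data.Fin.Base using (Fin; toℕ)
open import Data.Fin.Subset using (Subset; ⊤; Nonempty) renaming (_∈_ to _∈ˢ_; _-_ to _∖_)
open import Data.Fin.Subset.Properties using (nonempty?)
open import Data.List.Base using (List; []; _∷_)
open import Data.List.Membership.Propositional using (_∈_)
open import Data.List.Relation.Unary.All as All using (All; []; _∷_)
open import Data.Nat as ℕ using (ℕ; zero; suc)
open import Data.Product.Base using (_×_; _,_; proj₁; proj₂; Σ-syntax)
open import Data.Vec.Base using (Vec; lookup; toList)
open import Function.Bundles using (_⇔_)
open import Level using (0ℓ)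
open import Relation.Binary.Core using (Rel)
import Relation.Binary.Construct.NonStrictToStrict as ToStrict
open import Relation.Binary.PropositionalEquality.Core using (_≡_; _≢_)
open import Relation.Binary.Structures using (IsDecTotalOrder)
open import Relation.Nullary.Decidable using (Dec; yes; no; does; _×-dec_)

-- The real numbers enter only as an Archimedean ordered field with decidable
-- order. Classically ℝ is one; ℚ is one constructively.

record ArchimedeanField : Set₁ where
  infix  8 _⁻¹
  infix  8 -_
  infixl 7 _*_
  infixl 6 _+_ _-_
  infix  4 _≤_
  field
    Carrier           : Set
    _≤_               : Rel Carrier 0ℓ
    _+_ _*_           : Carrier → Carrier → Carrier
    -_ _⁻¹            : Carrier → Carrier
    0# 1#             : Carrier
    isCommutativeRing : IsCommutativeRing _≡_ _+_ _*_ -_ 0# 1#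
    0≢1               : 0# ≢ 1#
    *-inverseʳ        : ∀ x → x ≢ 0# → x * x ⁻¹ ≡ 1#
    0⁻¹≡0             : 0# ⁻¹ ≡ 0#
    isDecTotalOrder   : IsDecTotalOrder _≡_ _≤_
    +-monoˡ-≤         : ∀ z {x y} → x ≤ y → x + z ≤ y + z
    *-nonNegative     : ∀ {x y} → 0# ≤ x → 0# ≤ y → 0# ≤ x * y

  rawSemiring : RawSemiring 0ℓ 0ℓ
  rawSemiring = record
    { Carrier = Carrier ; _≈_ = _≡_ ; _+_ = _+_ ; _*_ = _*_ ; 0# = 0# ; 1# = 1# }

  open RawSemiringDefs rawSemiring public using (_^_) renaming (_×_ to _·_)
  open IsDecTotalOrder isDecTotalOrder public using (_≤?_)
  open ToStrict {A = Carrier} _≡_ _≤_ public using (_<_)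

  _-_ : Carrier → Carrier → Carrier
  x - y = x + (- y)

  fromℕ : ℕ → Carrier
  fromℕ m = m · 1#

  field
    archimedean : ∀ x → Σ[ m ∈ ℕ ] x ≤ fromℕ m

------------------------------------------------------------------------
-- Model of computation: a first-order, call-by-value functional language
-- with general (mutual) recursion over Booleans, natural numbers, field
-- elements, pairs and lists. Its abstract syntax does not mention the field.

infixr 6 _⊗_
data Ty : Set where
  bool nat num : Ty
  _⊗_          : Ty → Ty → Ty
  list         : Ty → Ty

-- Unit-cost natural-number arithmetic is limited to + and ∸, so that indices
-- grow by at most one bit per step; there is no rounding from `num` to `nat`.
data Op : Ty → Ty → Set where
  addℕ subℕ                : Op (nat ⊗ nat) nat
  leqℕ                     : Op (nat ⊗ nat) bool
  addF subF mulF divF      : Op (num ⊗ num) num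
  leqF                     : Op (num ⊗ num) bool
  cast                     : Op nat num
  fst                      : ∀ {A B} → Op (A ⊗ B) A
  snd                      : ∀ {A B} → Op (A ⊗ B) B
  cons                     : ∀ {A} → Op (A ⊗ list A) (list A)

-- A signature lists the argument and result types of the functions that may
-- be called.
Signature : Set
Signature = List (Ty × Ty)

data Tm (Φ : Signature) (Γ : List Ty) : Ty → Set where
  var      : ∀ {A} → A ∈ Γ → Tm Φ Γ A
  bool     : Bool → Tm Φ Γ bool
  nat      : ℕ → Tm Φ Γ nat
  nil      : ∀ {A} → Tm Φ Γ (list A)
  pair     : ∀ {A B} → Tm Φ Γ A → Tm Φ Γ B → Tm Φ Γ (A ⊗ B)
  op       : ∀ {A B} → Op A B → Tm Φ Γ A → Tm Φ Γ B
  bind     : ∀ {A B} → Tm Φ Γ A → Tm Φ (A ∷ Γ) B → Tm Φ Γ B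
  cond     : ∀ {A} → Tm Φ Γ bool → Tm Φ Γ A → Tm Φ Γ A → Tm Φ Γ A
  caseList : ∀ {A B} → Tm Φ Γ (list A) → Tm Φ Γ B → Tm Φ (A ∷ list A ∷ Γ) B → Tm Φ Γ B
  call     : ∀ {A B} → (A , B) ∈ Φ → Tm Φ Γ A → Tm Φ Γ B

Body : Signature → Ty × Ty → Set
Body Φ F = Tm Φ (proj₁ F ∷ []) (proj₂ F)

record Algorithm (A B : Ty) : Set where
  field
    signature : Signature
    bodies    : All (Body signature) signature
    main      : Body signature (A , B)

module Execution (𝔽 : ArchimedeanField) where
  open ArchimedeanField 𝔽

  ⟦_⟧ : Ty → Set
  ⟦ bool ⟧   = Bool
  ⟦ nat ⟧    = ℕ
  ⟦ num ⟧    = Carrier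
  ⟦ A ⊗ B ⟧  = ⟦ A ⟧ × ⟦ B ⟧
  ⟦ list A ⟧ = List ⟦ A ⟧

  size : ∀ A → ⟦ A ⟧ → ℕ
  size bool     _        = 1
  size nat      _        = 1
  size num      _        = 1
  size (A ⊗ B)  (x , y)  = suc (size A x ℕ.+ size B y)
  size (list A) []       = 1
  size (list A) (x ∷ xs) = suc (size A x ℕ.+ size (list A) xs)

  ⟦_⟧ᵒ : ∀ {A B} → Op A B → ⟦ A ⟧ → ⟦ B ⟧
  ⟦ addℕ ⟧ᵒ (m , n)  = m ℕ.+ n
  ⟦ subℕ ⟧ᵒ (m , n)  = m ℕ.∸ n
  ⟦ leqℕ ⟧ᵒ (m , n)  = does (m ℕ.≤? n)
  ⟦ addF ⟧ᵒ (x , y)  = x + y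
  ⟦ subF ⟧ᵒ (x , y)  = x - y
  ⟦ mulF ⟧ᵒ (x , y)  = x * y
  ⟦ divF ⟧ᵒ (x , y)  = x * y ⁻¹
  ⟦ leqF ⟧ᵒ (x , y)  = does (x ≤? y)
  ⟦ cast ⟧ᵒ m        = fromℕ m
  ⟦ fst  ⟧ᵒ (x , y)  = x
  ⟦ snd  ⟧ᵒ (x , y)  = y
  ⟦ cons ⟧ᵒ (x , xs) = x ∷ xs

  -- P , ρ ⊢ e ⇓ v ⟨ c ⟩: in environment ρ, e evaluates to v in c steps, one
  -- step being charged for every node of the evaluation.
  infix 3 _,_⊢_⇓_⟨_⟩
  data _,_⊢_⇓_⟨_⟩ {Φ : Signature} (P : All (Body Φ) Φ) {Γ : List Ty} (ρ : All ⟦_⟧ Γ)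
       : ∀ {A} → Tm Φ Γ A → ⟦ A ⟧ → ℕ → Set where
    ⇓var    : ∀ {A} {x : A ∈ Γ} → P , ρ ⊢ var x ⇓ All.lookup ρ x ⟨ 1 ⟩
    ⇓bool   : ∀ {b} → P , ρ ⊢ bool b ⇓ b ⟨ 1 ⟩
    ⇓nat    : ∀ {m} → P , ρ ⊢ nat m ⇓ m ⟨ 1 ⟩
    ⇓nil    : ∀ {A} → P , ρ ⊢ nil {A = A} ⇓ [] ⟨ 1 ⟩
    ⇓pair   : ∀ {A B} {e : Tm Φ Γ A} {f : Tm Φ Γ B} {u v c d} →
              P , ρ ⊢ e ⇓ u ⟨ c ⟩ → P , ρ ⊢ f ⇓ v ⟨ d ⟩ →
              P , ρ ⊢ pair e f ⇓ (u , v) ⟨ suc (c ℕ.+ d) ⟩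
    ⇓op     : ∀ {A B} {o : Op A B} {e u c} →
              P , ρ ⊢ e ⇓ u ⟨ c ⟩ →
              P , ρ ⊢ op o e ⇓ ⟦ o ⟧ᵒ u ⟨ suc c ⟩
    ⇓bind   : ∀ {A B} {e : Tm Φ Γ A} {f : Tm Φ (A ∷ Γ) B} {u v c d} →
              P , ρ ⊢ e ⇓ u ⟨ c ⟩ → P , (u ∷ ρ) ⊢ f ⇓ v ⟨ d ⟩ →
              P , ρ ⊢ bind e f ⇓ v ⟨ suc (c ℕ.+ d) ⟩
    ⇓true   : ∀ {A} {b} {e f : Tm Φ Γ A} {v c d} →
              P , ρ ⊢ b ⇓ true ⟨ c ⟩ → P , ρ ⊢ e ⇓ v ⟨ d ⟩ →
              P , ρ ⊢ cond b e f ⇓ v ⟨ suc (c ℕ.+ d) ⟩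
    ⇓false  : ∀ {A} {b} {e f : Tm Φ Γ A} {v c d} →
              P , ρ ⊢ b ⇓ false ⟨ c ⟩ → P , ρ ⊢ f ⇓ v ⟨ d ⟩ →
              P , ρ ⊢ cond b e f ⇓ v ⟨ suc (c ℕ.+ d) ⟩
    ⇓empty  : ∀ {A B} {l : Tm Φ Γ (list A)} {e : Tm Φ Γ B} {f v c d} →
              P , ρ ⊢ l ⇓ [] ⟨ c ⟩ → P , ρ ⊢ e ⇓ v ⟨ d ⟩ →
              P , ρ ⊢ caseList l e f ⇓ v ⟨ suc (c ℕ.+ d) ⟩
    ⇓uncons : ∀ {A B} {l : Tm Φ Γ (list A)} {e : Tm Φ Γ B} {f x xs v c d} →
              P , ρ ⊢ l ⇓ (x ∷ xs) ⟨ c ⟩ → P , (x ∷ xs ∷ ρ) ⊢ f ⇓ v ⟨ d ⟩ →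
              P , ρ ⊢ caseList l e f ⇓ v ⟨ suc (c ℕ.+ d) ⟩
    ⇓call   : ∀ {A B} {g : (A , B) ∈ Φ} {e u v c d} →
              P , ρ ⊢ e ⇓ u ⟨ c ⟩ → P , (u ∷ []) ⊢ All.lookup P g ⇓ v ⟨ d ⟩ →
              P , ρ ⊢ call g e ⇓ v ⟨ suc (c ℕ.+ d) ⟩

  _on_outputs_inSteps_ : ∀ {A B} → Algorithm A B → ⟦ A ⟧ → ⟦ B ⟧ → ℕ → Set
  𝒜 on x outputs y inSteps c = bodies , (x ∷ []) ⊢ main ⇓ y ⟨ c ⟩
    where open Algorithm 𝒜

------------------------------------------------------------------------
-- Sequential hiring

module Hiring (𝔽 : ArchimedeanField) where
  open ArchimedeanField 𝔽
  open Execution 𝔽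

  record Instance : Set where
    field
      n   : ℕ
      V P : Vec Carrier n
      k T : ℕ
      V≥0 : ∀ i → 0# ≤ lookup V i
      P≥0 : ∀ i → 0# ≤ lookup P i
      P≤1 : ∀ i → lookup P i ≤ 1#
      k≥1 : 1 ℕ.≤ k
      T≥1 : 1 ℕ.≤ T

  record State (n : ℕ) : Set where
    constructor ⟨_,_,_⟩
    field
      stage     : ℕ
      positions : ℕ
      available : Subset n

  accepted rejected : ∀ {n} → Fin n → State n → State n
  accepted i ⟨ t , k , A ⟩ = ⟨ suc t , k ℕ.∸ 1 , A ∖ i ⟩
  rejected i ⟨ t , k , A ⟩ = ⟨ suc t , k , A ∖ i ⟩

  module _ (I : Instance) where
    open Instance I
    open State

    initial : State n
    initial = ⟨ 1 , k , ⊤ ⟩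

    NonTerminal : State n → Set
    NonTerminal s = stage s ℕ.≤ T × 1 ℕ.≤ positions s × Nonempty (available s)

    nonTerminal? : ∀ s → Dec (NonTerminal s)
    nonTerminal? s =
      (stage s ℕ.≤? T) ×-dec ((1 ℕ.≤? positions s) ×-dec nonempty? (available s))

    -- Irrelevance makes the choice a function of the state alone.
    Policy : Set
    Policy = (s : State n) → .(NonTerminal s) → Σ[ i ∈ Fin n ] i ∈ˢ available s

    module _ (ℋ : Policy) where

      choice : (s : State n) → .(NonTerminal s) → Fin n
      choice s nt = proj₁ (ℋ s nt)

      -- The first argument is the number T + 1 ∸ stage s of stages left; it
      -- only serves to make the recursion structural.
      rewardFrom : ℕ → State n → Carrier
      rewardFrom zero    s = 0#
      rewardFrom (suc r) s with nonTerminal? s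
      ... | no _   = 0#
      ... | yes nt = let i = choice s nt ; p = lookup P i in
        p * (lookup V i + rewardFrom r (accepted i s)) + (1# - p) * rewardFrom r (rejected i s)

      reward : Carrier
      reward = rewardFrom T initial

      data Reachable : State n → Set where
        start  : Reachable initial
        accept : ∀ {s} → Reachable s → (nt : NonTerminal s) →
                 0# < lookup P (choice s nt) → Reachable (accepted (choice s nt) s)
        reject : ∀ {s} → Reachable s → (nt : NonTerminal s) →
                 lookup P (choice s nt) < 1# → Reachable (rejected (choice s nt) s)

    Optimal : Policy → Set
    Optimal ℋ = ∀ ℋ′ → reward ℋ′ ≤ reward ℋ

  -- A policy is output as a table of its choices; sets of applicants are
  -- given by their indicator lists, and applicants are numbered from 0.

  StateTy InputTy TableTy : Ty
  StateTy = nat ⊗ nat ⊗ list bool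
  InputTy = num ⊗ nat ⊗ list num ⊗ list num ⊗ nat ⊗ nat
  TableTy = list (StateTy ⊗ nat)

  encodeState : ∀ {n} → State n → ⟦ StateTy ⟧
  encodeState ⟨ t , k , A ⟩ = t , k , toList A

  encodeInput : Carrier → Instance → ⟦ InputTy ⟧
  encodeInput ε I = ε , n , toList V , toList P , k , T
    where open Instance I

  Describes : (I : Instance) → ⟦ TableTy ⟧ → Policy I → Set
  Describes I D ℋ =
    ∀ {s} → Reachable I ℋ s → (nt : NonTerminal I s) →
    ∀ j → (encodeState s , j) ∈ D ⇔ j ≡ toℕ (choice I ℋ s nt)

-- Group the applicants by acceptance probability: thresholds s, s², …, sᵐ cut [0,1] into m classes of
-- nearly equal probabilities and one class of negligible ones. If the probabilities within each class
-- were equal, an exchange argument shows that nothing is lost by making every offer to the best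
-- remaining applicant of some class. Rounding all but the negligible probabilities down to a threshold
-- costs a factor s in total, since a policy can treat some rejections as acceptances; rounding the
-- negligible ones up to sᵐ costs at most sᵐ per later stage. With 1 − s ≤ ε/2 and T sᵐ ≤ ε/2, which
-- allows m = O(ε⁻² log T), some policy restricted in this way is therefore near-optimal for the rounded
-- data; the best restricted policy for the true data is at least as good, because raising the
-- probability of an offer that is worth making only helps. Restricted policies meet at most (T + 1)ᵐ⁺¹
-- sets of remaining applicants, one for each vector of numbers of offers per class, so dynamic
-- programming finds the best one. When T = 1 or ε ≥ 1, the single class m = 0 is enough.
-- The running time is at most the number of calls times the size of the largest function body.

module Submission where

open import Defs
open import Data.Nat using (ℕ; _⊔_) renaming (_≤_ to _≤ℕ_; _*_ to _*ℕ_; _^_ to _^ℕ_)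
open import Data.Nat.Logarithm using (⌊log₂_⌋)
open import Data.Product using (Σ-syntax; ∃-syntax; _×_)
open import Algebra.Bundles using (CommutativeRing)
open import Algebra.Bundles.Raw using (RawRing)
import Algebra.Properties.CommutativeSemiring.Exp as CommutativeExp
import Algebra.Properties.Ring as RingProperties
import Algebra.Properties.Semiring.Exp as SemiringExp
import Algebra.Properties.Semiring.Mult as SemiringMult
import Algebra.Solver.Ring as RingSolver
open import Algebra.Solver.Ring.AlmostCommutativeRing using (_-Raw-AlmostCommutative⟶_; fromCommutativeRing)
open import Data.Bool.Base using (Bool; true; false; if_then_else_; _∧_) renaming (T to True)
open import Data.Bool.Properties using (∧-conicalˡ; ∧-conicalʳ)
open import Data.Empty using (⊥; ⊥-elim; ⊥-elim-irr)
open import Data.Fin.Base using (Fin; zero; suc; toℕ)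
import Data.Fin.Properties as Fin
open import Data.Fin.Subset using (Subset; Nonempty; _⊆_; inside; outside; ∣_∣; ⁅_⁆) renaming (_∈_ to _∈ˢ_; _-_ to _∖_; ⊤ to ⊤ˢ)
open import Data.Fin.Subset.Properties using (∣⊤∣≡n; p─⊥≡p; p─q⊆p; p─x─y≡p─y─x; x∈p∧x≢y⇒x∈p-y; x∈p⇒∣p-x∣<∣p∣)
open import Data.List.Base using (List; []; _∷_; length)
open import Data.List.Membership.Propositional using (_∈_)
open import Data.List.Relation.Unary.All as All using (All; []; _∷_)
open import Data.List.Relation.Unary.Any using (here; there)
open import Data.Maybe.Base as Maybe using (Maybe; just; nothing)
open import Data.Nat.Base as ℕ using (zero; suc; z≤n; s≤s)
open import Data.Nat.Logarithm using (⌊log₂⌋-mono-≤; ⌊log₂[2^n]⌋≡n)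
import Data.Nat.Properties as ℕ
open import Data.Nat.Tactic.RingSolver using (solve-∀)
open import Data.Product as Prod using (_,_; proj₁; proj₂)
open import Data.Sum.Base as Sum using (_⊎_; inj₁; inj₂)
open import Data.Unit.Base using (⊤; tt)
open import Data.Vec.Base as Vec using (Vec; []; _∷_; lookup; toList; here; there)
open import Data.Vec.Properties using (lookup-zipWith; length-toList)
open import Function.Bundles using (mk⇔)
open import Level using (0ℓ)
open import Relation.Binary.PropositionalEquality
  using (_≡_; _≢_; refl; sym; trans; cong; cong₂; subst; subst₂; ≢-sym; module ≡-Reasoning)
open import Relation.Binary.Structures using (IsDecTotalOrder)
open import Relation.Nullary.Decidable using (does; yes; no)
open import Relation.Nullary.Negation using (contradiction)

-- The admissible exponent of T is a constant times ε⁻² log T, which vanishes at T = 1 and becomes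
-- arbitrarily small for large ε. There the number m of thresholds must be exactly 0, so the only
-- rounded probability is s⁰ = 1; this is harmless for T = 1 because the last stage is never
-- charged. For the same reason one of the m + 1 factors in the count of sets has to be paid by n
-- instead of T. That works because at most n offers can be made, so everything is computed for
-- min(T, n) stages. The number k is bounded by neither n nor T, so states are listed by the number
-- of acceptances so far. The rounded data exist only in the analysis. The program needs no more
-- than the order of rounded values inside a class: by v among regular applicants, and by p v among
-- negligible ones, since rounding up preserves p v. Since a field element cannot be rounded to a
-- natural number, 1/ε is approximated by counting upwards to some N, and the ratio of the
-- thresholds is M / (M + 1) with M = 2N.

-- Arithmetic in an ordered field.

module OrderedField (𝔽 : ArchimedeanField) where
  open ArchimedeanField 𝔽 public
  open IsDecTotalOrder isDecTotalOrder public
    using () renaming (refl to ≤-refl; reflexive to ≤-reflexive; trans to ≤-trans; antisym to ≤-antisym; total to ≤-total)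

  commutativeRing : CommutativeRing 0ℓ 0ℓ
  commutativeRing = record { isCommutativeRing = isCommutativeRing }

  open CommutativeRing commutativeRing public
    using (+-assoc; +-comm; +-identityˡ; +-identityʳ; *-assoc; *-comm; *-identityˡ; *-identityʳ;
           zeroˡ; zeroʳ; distribˡ; distribʳ; -‿inverseʳ; ring; semiring)
  open SemiringMult semiring public using (×-homo-+; ×1-homo-*)
  open SemiringExp semiring public using (^-congˡ; ^-assocʳ)

  -- Integer coefficients for the ring solver, as formal differences of naturals.
  module RSolver where
    open RingProperties ring using (-‿distribˡ-*; -‿distribʳ-*; -‿+-comm; -‿involutive; -0#≈0#)
    -- The extra clause makes the solver's `one` denote `1#` itself rather than a difference of sums
    -- that equals it.
    ⟦_⟧ᵈ : ℕ × ℕ → Carrier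
    ⟦ 1 , 0 ⟧ᵈ = 1#
    ⟦ a , b ⟧ᵈ = fromℕ a - fromℕ b

    ⟦⟧ᵈ-spec : ∀ x → ⟦ x ⟧ᵈ ≡ fromℕ (proj₁ x) - fromℕ (proj₂ x)
    ⟦⟧ᵈ-spec (0 , b)             = refl
    ⟦⟧ᵈ-spec (1 , 0)             = sym (trans (cong₂ _+_ (+-identityʳ 1#) -0#≈0#) (+-identityʳ 1#))
    ⟦⟧ᵈ-spec (1 , suc b)         = refl
    ⟦⟧ᵈ-spec (suc (suc a) , b)   = refl

    -- Cancelling the common part gives each integer a single representation, so `coefficient≟` can
    -- compare pairs componentwise.
    reduce : ℕ × ℕ → ℕ × ℕ
    reduce (suc a , suc b) = reduce (a , b)
    reduce x               = x

    differences : RawRing 0ℓ 0ℓ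
    differences = record
      { Carrier = ℕ × ℕ
      ; _≈_ = _≡_
      ; _+_ = λ (a , b) (c , d) → reduce (a ℕ.+ c , b ℕ.+ d)
      ; _*_ = λ (a , b) (c , d) → reduce (a ℕ.* c ℕ.+ b ℕ.* d , a ℕ.* d ℕ.+ b ℕ.* c)
      ; -_ = λ (a , b) → b , a
      ; 0# = 0 , 0
      ; 1# = 1 , 0
      }

    open ≡-Reasoning

    interchange : ∀ a b c d → (a + b) + (c + d) ≡ (a + c) + (b + d)
    interchange a b c d = begin
      (a + b) + (c + d) ≡⟨ +-assoc a b (c + d) ⟩
      a + (b + (c + d)) ≡⟨ cong (a +_) (sym (+-assoc b c d)) ⟩
      a + ((b + c) + d) ≡⟨ cong (λ z → a + (z + d)) (+-comm b c) ⟩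
      a + ((c + b) + d) ≡⟨ cong (a +_) (+-assoc c b d) ⟩
      a + (c + (b + d)) ≡⟨ sym (+-assoc a c (b + d)) ⟩
      (a + c) + (b + d) ∎

    +-homo : ∀ a b c d → (a + c) - (b + d) ≡ (a - b) + (c - d)
    +-homo a b c d = trans (cong (a + c +_) (sym (-‿+-comm b d))) (interchange a c (- b) (- d))

    reduce-spec : ∀ x → ⟦ reduce x ⟧ᵈ ≡ fromℕ (proj₁ x) - fromℕ (proj₂ x)
    reduce-spec (suc a , suc b) = trans (reduce-spec (a , b)) (sym (begin
      fromℕ (suc a) - fromℕ (suc b)         ≡⟨ +-homo 1# 1# (fromℕ a) (fromℕ b) ⟩
      (1# - 1#) + (fromℕ a - fromℕ b)       ≡⟨ cong (_+ (fromℕ a - fromℕ b)) (-‿inverseʳ 1#) ⟩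
      0# + (fromℕ a - fromℕ b)              ≡⟨ +-identityˡ _ ⟩
      fromℕ a - fromℕ b                     ∎))
    reduce-spec (zero , b)      = ⟦⟧ᵈ-spec (zero , b)
    reduce-spec (suc a , zero)  = ⟦⟧ᵈ-spec (suc a , zero)

    *-homo : ∀ a b c d → (a * c + b * d) - (a * d + b * c) ≡ (a - b) * (c - d)
    *-homo a b c d = begin
      (a * c + b * d) - (a * d + b * c)            ≡⟨ +-homo (a * c) (a * d) (b * d) (b * c) ⟩
      (a * c - a * d) + (b * d - b * c)            ≡⟨ cong₂ _+_ (left a) right ⟩
      a * (c - d) + - b * (c - d)                  ≡⟨ sym (distribʳ (c - d) a (- b)) ⟩
      (a - b) * (c - d)                            ∎
      where
      left : ∀ x → x * c - x * d ≡ x * (c - d)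
      left x = trans (cong (x * c +_) (-‿distribʳ-* x d)) (sym (distribˡ x c (- d)))
      right : b * d - b * c ≡ - b * (c - d)
      right = begin
        b * d - b * c           ≡⟨ +-comm (b * d) _ ⟩
        - (b * c) + b * d       ≡⟨ cong₂ _+_ (-‿distribˡ-* b c) (trans (sym (-‿involutive (b * d)))
                                     (trans (cong -_ (-‿distribʳ-* b d)) (-‿distribˡ-* b (- d)))) ⟩
        - b * c + - b * - d     ≡⟨ sym (distribˡ (- b) c (- d)) ⟩
        - b * (c - d)           ∎

    morphism : differences -Raw-AlmostCommutative⟶ fromCommutativeRing commutativeRing
    morphism = record
      { ⟦_⟧ = ⟦_⟧ᵈ
      ; +-homo = λ x@(a , b) y@(c , d) → trans (reduce-spec (a ℕ.+ c , b ℕ.+ d)) (trans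
          (cong₂ _-_ (×-homo-+ 1# a c) (×-homo-+ 1# b d))
          (trans (+-homo (fromℕ a) (fromℕ b) (fromℕ c) (fromℕ d))
            (sym (cong₂ _+_ (⟦⟧ᵈ-spec x) (⟦⟧ᵈ-spec y)))))
      ; *-homo = λ x@(a , b) y@(c , d) → trans (reduce-spec (a ℕ.* c ℕ.+ b ℕ.* d , a ℕ.* d ℕ.+ b ℕ.* c)) (trans
          (cong₂ _-_
            (trans (×-homo-+ 1# (a ℕ.* c) (b ℕ.* d)) (cong₂ _+_ (×1-homo-* a c) (×1-homo-* b d)))
            (trans (×-homo-+ 1# (a ℕ.* d) (b ℕ.* c)) (cong₂ _+_ (×1-homo-* a d) (×1-homo-* b c))))
          (trans (*-homo (fromℕ a) (fromℕ b) (fromℕ c) (fromℕ d))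
            (sym (cong₂ _*_ (⟦⟧ᵈ-spec x) (⟦⟧ᵈ-spec y)))))
      ; -‿homo = λ x@(a , b) → trans (⟦⟧ᵈ-spec (b , a)) (trans (+-comm (fromℕ b) _)
          (trans (cong (- fromℕ a +_) (sym (-‿involutive (fromℕ b))))
            (trans (-‿+-comm (fromℕ a) (- fromℕ b)) (cong -_ (sym (⟦⟧ᵈ-spec x))))))
      ; 0-homo = -‿inverseʳ 0#
      ; 1-homo = refl
      }

    coefficient≟ : ∀ x y → Maybe (⟦ x ⟧ᵈ ≡ ⟦ y ⟧ᵈ)
    coefficient≟ (a , b) (c , d) with a ℕ.≟ c | b ℕ.≟ d
    ... | yes refl | yes refl = just refl
    ... | _        | _        = nothing

    open RingSolver differences (fromCommutativeRing commutativeRing) morphism coefficient≟ public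
      using (solve; _:=_; _:+_; _:*_; _:-_; :-_; con; Polynomial)

    one : ∀ {m} → Polynomial m
    one = con (1 , 0)

  open RSolver public using (solve; _:=_; _:+_; _:*_; _:-_; :-_; one)

  ≤-by : ∀ {x y} d → 0# ≤ d → x + d ≡ y → x ≤ y
  ≤-by {x} {y} d 0≤d x+d≡y = subst₂ _≤_ (+-identityˡ x) (trans (+-comm d x) x+d≡y) (+-monoˡ-≤ x 0≤d)

  0≤y-x : ∀ {x y} → x ≤ y → 0# ≤ y - x
  0≤y-x {x} {y} x≤y = subst (_≤ y - x) (-‿inverseʳ x) (+-monoˡ-≤ (- x) x≤y)

  +-mono-≤ : ∀ {x y u v} → x ≤ y → u ≤ v → x + u ≤ y + v
  +-mono-≤ {x} {y} {u} {v} x≤y u≤v = ≤-trans (+-monoˡ-≤ u x≤y)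
    (subst₂ _≤_ (+-comm u y) (+-comm v y) (+-monoˡ-≤ y u≤v))

  +-nonNegative : ∀ {x y} → 0# ≤ x → 0# ≤ y → 0# ≤ x + y
  +-nonNegative 0≤x 0≤y = subst (_≤ _) (+-identityʳ 0#) (+-mono-≤ 0≤x 0≤y)

  *-monoʳ-≤ : ∀ {x y} z → 0# ≤ z → x ≤ y → z * x ≤ z * y
  *-monoʳ-≤ {x} {y} z 0≤z x≤y = ≤-by (z * (y - x)) (*-nonNegative 0≤z (0≤y-x x≤y))
    (solve 3 (λ x y z → z :* x :+ z :* (y :- x) := z :* y) refl x y z)

  *-monoˡ-≤ : ∀ {x y} z → 0# ≤ z → x ≤ y → x * z ≤ y * z
  *-monoˡ-≤ {x} {y} z 0≤z x≤y = subst₂ _≤_ (*-comm z x) (*-comm z y) (*-monoʳ-≤ z 0≤z x≤y)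

  *-mono-≤ : ∀ {x y u v} → 0# ≤ u → 0# ≤ y → x ≤ y → u ≤ v → x * u ≤ y * v
  *-mono-≤ {x} {y} {u} {v} 0≤u 0≤y x≤y u≤v = ≤-trans (*-monoˡ-≤ u 0≤u x≤y) (*-monoʳ-≤ y 0≤y u≤v)

  ≰⇒≥ : ∀ {x y} → (x ≤ y → ⊥) → y ≤ x
  ≰⇒≥ {x} {y} x≰y with ≤-total x y
  ... | inj₁ x≤y = contradiction x≤y x≰y
  ... | inj₂ y≤x = y≤x

  0≤1 : 0# ≤ 1#
  0≤1 with ≤-total 0# 1#
  ... | inj₁ 0≤1 = 0≤1
  ... | inj₂ 1≤0 = subst (0# ≤_) (solve 0 ((:- one) :* (:- one) := one) refl) (*-nonNegative 0≤-1 0≤-1)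
    where
    0≤-1 : 0# ≤ - 1#
    0≤-1 = subst (0# ≤_) (+-identityˡ (- 1#)) (0≤y-x 1≤0)

  <⇒≤ : ∀ {x y} → x < y → x ≤ y
  <⇒≤ = proj₁

  0<⇒≢0 : ∀ {x} → 0# < x → x ≢ 0#
  0<⇒≢0 (_ , 0≢x) x≡0 = 0≢x (sym x≡0)

  0≤x⁻¹ : ∀ {x} → 0# < x → 0# ≤ x ⁻¹
  0≤x⁻¹ {x} 0<x with ≤-total 0# (x ⁻¹)
  ... | inj₁ 0≤x⁻¹ = 0≤x⁻¹
  ... | inj₂ x⁻¹≤0 = contradiction (≤-antisym 0≤1 1≤0) 0≢1
    where
    1≤0 : 1# ≤ 0#
    1≤0 = subst₂ _≤_ (*-inverseʳ x (0<⇒≢0 0<x)) (zeroʳ x) (*-monoʳ-≤ x (<⇒≤ 0<x) x⁻¹≤0)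

  *-cancel-≤0 : ∀ {x y} → 0# < x → 0# ≤ x * y → 0# ≤ y
  *-cancel-≤0 {x} {y} 0<x 0≤xy = subst (0# ≤_)
    (trans (solve 3 (λ x x⁻¹ y → x⁻¹ :* (x :* y) := (x :* x⁻¹) :* y) refl x (x ⁻¹) y)
      (trans (cong (_* y) (*-inverseʳ x (0<⇒≢0 0<x))) (*-identityˡ y)))
    (*-nonNegative (0≤x⁻¹ 0<x) 0≤xy)

  0≤fromℕ : ∀ m → 0# ≤ fromℕ m
  0≤fromℕ zero    = ≤-refl
  0≤fromℕ (suc m) = +-nonNegative 0≤1 (0≤fromℕ m)

  fromℕ-1 : fromℕ 1 ≡ 1#
  fromℕ-1 = +-identityʳ 1#

  fromℕ-mono : ∀ {m n} → m ℕ.≤ n → fromℕ m ≤ fromℕ n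
  fromℕ-mono {n = n} z≤n   = 0≤fromℕ n
  fromℕ-mono (s≤s m≤n) = +-mono-≤ ≤-refl (fromℕ-mono m≤n)

  0<-≤-trans : ∀ {x y} → 0# < x → x ≤ y → 0# < y
  0<-≤-trans (0≤x , 0≢x) x≤y = ≤-trans 0≤x x≤y , λ { refl → 0≢x (≤-antisym 0≤x x≤y) }

  0<1 : 0# < 1#
  0<1 = 0≤1 , 0≢1

  0<fromℕ : ∀ m → 0# < fromℕ (suc m)
  0<fromℕ m = 0<-≤-trans 0<1 (subst (_≤ fromℕ (suc m)) fromℕ-1 (fromℕ-mono {1} {suc m} (s≤s z≤n)))

  -- If the product were zero, `x * - y` would be nonnegative too, and cancelling `x` would make `y`
  -- nonpositive.
  *-positive : ∀ {x y} → 0# < x → 0# < y → 0# < x * y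
  *-positive {x} {y} 0<x 0<y = *-nonNegative (<⇒≤ 0<x) (<⇒≤ 0<y) , λ 0≡xy → proj₂ 0<y
    (≤-antisym (<⇒≤ 0<y) (neg⇒ (*-cancel-≤0 0<x (subst (0# ≤_) (trans 0≡xy′ (neg 0≡xy)) ≤-refl))))
    where
    0≡xy′ : 0# ≡ - 0#
    0≡xy′ = sym (trans (sym (+-identityˡ (- 0#))) (-‿inverseʳ 0#))
    neg : 0# ≡ x * y → - 0# ≡ x * - y
    neg 0≡xy = trans (cong -_ 0≡xy) (solve 2 (λ x y → :- (x :* y) := x :* (:- y)) refl x y)
    neg⇒ : 0# ≤ - y → y ≤ 0#
    neg⇒ 0≤-y = ≤-by (- y) 0≤-y (-‿inverseʳ y)

  ^-positive : ∀ {x} → 0# < x → ∀ m → 0# < x ^ m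
  ^-positive 0<x zero    = 0<1
  ^-positive 0<x (suc m) = *-positive 0<x (^-positive 0<x m)

  ^-≤1 : ∀ {x} → 0# ≤ x → x ≤ 1# → ∀ m → x ^ m ≤ 1#
  ^-≤1 0≤x x≤1 zero    = ≤-refl
  ^-≤1 {x} 0≤x x≤1 (suc m) = subst (x * x ^ m ≤_) (*-identityʳ 1#)
    (≤-trans (*-monoʳ-≤ x 0≤x (^-≤1 0≤x x≤1 m)) (*-monoˡ-≤ 1# 0≤1 x≤1))

  bernoulli : ∀ {h} → 0# ≤ h → ∀ m → 1# + fromℕ m * h ≤ (1# + h) ^ m
  bernoulli {h} 0≤h zero    = ≤-reflexive (trans (cong (1# +_) (zeroˡ h)) (+-identityʳ 1#))
  bernoulli {h} 0≤h (suc m) = ≤-trans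
    (≤-by (h * (fromℕ m * h)) (*-nonNegative 0≤h (*-nonNegative (0≤fromℕ m) 0≤h))
      (solve 2 (λ h k → one :+ (one :+ k) :* h :+ h :* (k :* h) := (one :+ h) :* (one :+ k :* h)) refl h (fromℕ m)))
    (*-monoʳ-≤ (1# + h) (+-nonNegative 0≤1 0≤h) (bernoulli 0≤h m))

-- Removing an element from a subset.

∈∖⇒∈ : ∀ {n} {A : Subset n} {i b} → i ∈ˢ A ∖ b → i ∈ˢ A
∈∖⇒∈ {A = A} {b = b} = p─q⊆p A ⁅ b ⁆

∉∖ : ∀ {n} (A : Subset n) i → i ∈ˢ A ∖ i → ⊥
∉∖ (inside  ∷ A) zero    ()
∉∖ (outside ∷ A) zero    ()
∉∖ (_ ∷ A)       (suc i) (there i∈) = ∉∖ A i i∈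

∖-monotone : ∀ {n} {A B : Subset n} i → A ⊆ B → A ∖ i ⊆ B ∖ i
∖-monotone {A = A} i A⊆B {j} j∈ with i Fin.≟ j
... | yes refl = contradiction j∈ (∉∖ A i)
... | no  i≢j  = x∈p∧x≢y⇒x∈p-y (A⊆B (∈∖⇒∈ j∈)) (≢-sym i≢j)

-- Optimal values and the exchange argument.

module Optimum (𝔽 : ArchimedeanField) where
  open OrderedField 𝔽

  argmax? : ∀ {n} (A : Subset n) (f : Fin n → Carrier) →
            (∀ i → i ∈ˢ A → ⊥) ⊎ (Σ[ i ∈ Fin n ] (i ∈ˢ A × (∀ l → l ∈ˢ A → f l ≤ f i)))
  argmax? []            f = inj₁ λ ()
  argmax? (outside ∷ A) f with argmax? A (λ i → f (suc i))
  ... | inj₁ empty         = inj₁ λ { (suc i) (there i∈A) → empty i i∈A }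
  ... | inj₂ (i , i∈A , max) = inj₂ (suc i , there i∈A , λ { (suc l) (there l∈A) → max l l∈A })
  argmax? (inside ∷ A)  f with argmax? A (λ i → f (suc i))
  ... | inj₁ empty         = inj₂ (zero , here , λ
        { zero _ → ≤-refl ; (suc l) (there l∈A) → ⊥-elim (empty l l∈A) })
  ... | inj₂ (i , i∈A , max) with ≤-total (f (suc i)) (f zero)
  ...   | inj₁ fi≤f0 = inj₂ (zero , here , λ
          { zero _ → ≤-refl ; (suc l) (there l∈A) → ≤-trans (max l l∈A) fi≤f0 })
  ...   | inj₂ f0≤fi = inj₂ (suc i , there i∈A , λ
          { zero _ → f0≤fi ; (suc l) (there l∈A) → max l l∈A })

  record Market (n : ℕ) : Set where
    field
      prob value : Fin n → Carrier
      0≤prob     : ∀ i → 0# ≤ prob i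
      prob≤1     : ∀ i → prob i ≤ 1#
      0≤value    : ∀ i → 0# ≤ value i

  -- `x` and `y` are the values of continuing after an acceptance and after a rejection. Leaving
  -- them free lets the same estimates serve rewards, optima and restricted values.
  gain : Carrier → Carrier → Carrier → Carrier → Carrier
  gain p v x y = p * (v + x) + (1# - p) * y

  gain-mono : ∀ {p} v {x x′ y y′} → 0# ≤ p → p ≤ 1# → x ≤ x′ → y ≤ y′ → gain p v x y ≤ gain p v x′ y′
  gain-mono {p} v 0≤p p≤1 x≤x′ y≤y′ =
    +-mono-≤ (*-monoʳ-≤ p 0≤p (+-mono-≤ ≤-refl x≤x′)) (*-monoʳ-≤ (1# - p) (0≤y-x p≤1) y≤y′)

  0≤gain : ∀ {p v x y} → 0# ≤ p → p ≤ 1# → 0# ≤ v → 0# ≤ x → 0# ≤ y → 0# ≤ gain p v x y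
  0≤gain 0≤p p≤1 0≤v 0≤x 0≤y =
    +-nonNegative (*-nonNegative 0≤p (+-nonNegative 0≤v 0≤x)) (*-nonNegative (0≤y-x p≤1) 0≤y)

  module _ {n : ℕ} (M : Market n) where
    open Market M

    mutual
      optimum : ℕ → ℕ → Subset n → Carrier
      optimum zero    k       A = 0#
      optimum (suc r) zero    A = 0#
      optimum (suc r) (suc k) A with argmax? A (offer r k A)
      ... | inj₁ _       = 0#
      ... | inj₂ (i , _) = offer r k A i

      offer : ℕ → ℕ → Subset n → Fin n → Carrier
      offer r k A i = gain (prob i) (value i) (optimum r k (A ∖ i)) (optimum r (suc k) (A ∖ i))

    0≤optimum : ∀ r k A → 0# ≤ optimum r k A
    0≤offer   : ∀ r k A i → 0# ≤ offer r k A i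
    0≤optimum zero    k       A = ≤-refl
    0≤optimum (suc r) zero    A = ≤-refl
    0≤optimum (suc r) (suc k) A with argmax? A (offer r k A)
    ... | inj₁ _       = ≤-refl
    ... | inj₂ (i , _) = 0≤offer r k A i
    0≤offer r k A i = 0≤gain (0≤prob i) (prob≤1 i) (0≤value i)
      (0≤optimum r k (A ∖ i)) (0≤optimum r (suc k) (A ∖ i))

    offer≤optimum : ∀ r k A {i} → i ∈ˢ A → offer r k A i ≤ optimum (suc r) (suc k) A
    offer≤optimum r k A {i} i∈A with argmax? A (offer r k A)
    ... | inj₁ empty         = ⊥-elim (empty i i∈A)
    ... | inj₂ (_ , _ , max) = max i i∈A

    optimum-attained : ∀ r k A → optimum (suc r) (suc k) A ≡ 0# × (∀ i → i ∈ˢ A → ⊥) ⊎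
      (Σ[ i ∈ Fin n ] (i ∈ˢ A × optimum (suc r) (suc k) A ≡ offer r k A i))
    optimum-attained r k A with argmax? A (offer r k A)
    ... | inj₁ empty         = inj₁ (refl , empty)
    ... | inj₂ (i , i∈A , _) = inj₂ (i , i∈A , refl)

    optimum-least : ∀ r k A {x} → 0# ≤ x → (∀ i → i ∈ˢ A → offer r k A i ≤ x) → optimum (suc r) (suc k) A ≤ x
    optimum-least r k A 0≤x offer≤x with argmax? A (offer r k A)
    ... | inj₁ _             = 0≤x
    ... | inj₂ (i , i∈A , _) = offer≤x i i∈A

    optimum-empty : ∀ r k A → (∀ i → i ∈ˢ A → ⊥) → optimum r k A ≤ 0#
    optimum-empty zero    k       A empty = ≤-refl
    optimum-empty (suc r) zero    A empty = ≤-refl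
    optimum-empty (suc r) (suc k) A empty = optimum-least r k A ≤-refl (λ i i∈A → ⊥-elim (empty i i∈A))

    -- The second alternative says that stages beyond the number of applicants are worth nothing:
    -- every offer lowers both `∣ A ∣` and the stages left. It justifies cutting T down to min(T,
    -- n).
    optimum-mono : ∀ {r r′ k k′ A A′} → r ℕ.≤ r′ ⊎ ∣ A ∣ ℕ.≤ r′ → k ℕ.≤ k′ → A ⊆ A′ →
                   optimum r k A ≤ optimum r′ k′ A′
    optimum-mono {zero}  {r′} {k} {k′} {A} {A′} _ _ _ = 0≤optimum r′ k′ A′
    optimum-mono {suc r} {r′} {zero} {k′} {A} {A′} _ _ _ = 0≤optimum r′ k′ A′
    optimum-mono {suc r} {zero} {suc k} {A = A} (inj₂ |A|≤0) _ _ =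
      optimum-empty (suc r) (suc k) A λ i i∈A → ℕ.n≮0 (ℕ.≤-trans (x∈p⇒∣p-x∣<∣p∣ i∈A) |A|≤0)
    optimum-mono {suc r} {suc r′} {suc k} {suc k′} {A} {A′} r≤r′ (s≤s k≤k′) A⊆A′ =
      optimum-least r k A (0≤optimum (suc r′) (suc k′) A′) λ i i∈A → ≤-trans
        (gain-mono (value i) (0≤prob i) (prob≤1 i)
          (optimum-mono (shrink i∈A r≤r′) k≤k′ (∖-monotone i A⊆A′))
          (optimum-mono (shrink i∈A r≤r′) (s≤s k≤k′) (∖-monotone i A⊆A′)))
        (offer≤optimum r′ k′ A′ (A⊆A′ i∈A))
      where
      shrink : ∀ {i} → i ∈ˢ A → suc r ℕ.≤ suc r′ ⊎ ∣ A ∣ ℕ.≤ suc r′ → r ℕ.≤ r′ ⊎ ∣ A ∖ i ∣ ℕ.≤ r′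
      shrink i∈A (inj₁ (s≤s r≤r′)) = inj₁ r≤r′
      shrink i∈A (inj₂ |A|≤)       = inj₂ (ℕ.s≤s⁻¹ (ℕ.≤-trans (x∈p⇒∣p-x∣<∣p∣ i∈A) |A|≤))

    -- Keeping a rather than b: a policy that never offers to a loses nothing, and one that does
    -- can offer to b in its place, losing at most the difference of the immediate rewards.
    exchange : ∀ r k A {a b} → a ∈ˢ A → b ∈ˢ A → prob a ≡ prob b → value b ≤ value a →
               optimum r k (A ∖ b) ≤ optimum r k (A ∖ a) + prob a * (value a - value b)
    exchange r k A {a} {b} a∈A b∈A pa≡pb vb≤va = go r k A a∈A b∈A
      where
      Δ : Carrier
      Δ = prob a * (value a - value b)
      0≤Δ : 0# ≤ Δ
      0≤Δ = *-nonNegative (0≤prob a) (0≤y-x vb≤va)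
      go : ∀ r k A → a ∈ˢ A → b ∈ˢ A → optimum r k (A ∖ b) ≤ optimum r k (A ∖ a) + Δ
      go zero    k       A a∈A b∈A = +-nonNegative ≤-refl 0≤Δ
      go (suc r) zero    A a∈A b∈A = +-nonNegative ≤-refl 0≤Δ
      go (suc r) (suc k) A a∈A b∈A = optimum-least r k (A ∖ b)
        (+-nonNegative (0≤optimum (suc r) (suc k) (A ∖ a)) 0≤Δ) bound
        where
        bound : ∀ i → i ∈ˢ A ∖ b → offer r k (A ∖ b) i ≤ optimum (suc r) (suc k) (A ∖ a) + Δ
        bound i i∈A∖b with i Fin.≟ a | i Fin.≟ b
        ... | _        | yes refl = ⊥-elim (∉∖ A b i∈A∖b)
        ... | yes refl | no a≢b   = ≤-trans
          (≤-reflexive (begin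
            offer r k (A ∖ b) a
              ≡⟨ cong₂ (gain (prob a) (value a)) (cong (optimum r k) (p─x─y≡p─y─x A b a))
                   (cong (optimum r (suc k)) (p─x─y≡p─y─x A b a)) ⟩
            gain (prob a) (value a) (optimum r k (A ∖ a ∖ b)) (optimum r (suc k) (A ∖ a ∖ b))
              ≡⟨ solve 5 (λ p va vb x y → p :* (va :+ x) :+ (one :- p) :* y :=
                   (p :* (vb :+ x) :+ (one :- p) :* y) :+ p :* (va :- vb)) refl
                   (prob a) (value a) (value b) (optimum r k (A ∖ a ∖ b)) (optimum r (suc k) (A ∖ a ∖ b)) ⟩
            gain (prob a) (value b) (optimum r k (A ∖ a ∖ b)) (optimum r (suc k) (A ∖ a ∖ b)) + Δ
              ≡⟨ cong (λ p → gain p (value b) (optimum r k (A ∖ a ∖ b)) (optimum r (suc k) (A ∖ a ∖ b)) + Δ) pa≡pb ⟩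
            offer r k (A ∖ a) b + Δ ∎))
          (+-monoˡ-≤ Δ (offer≤optimum r k (A ∖ a) (x∈p∧x≢y⇒x∈p-y b∈A (≢-sym a≢b))))
          where open ≡-Reasoning
        -- An offer to a third applicant is copied. The loss `Δ` then appears in both continuations,
        -- with weights p and 1 - p, and so is passed on unchanged.
        ... | no i≢a   | no i≢b   = ≤-trans
          (≤-trans
            (gain-mono (value i) (0≤prob i) (prob≤1 i) (step k) (step (suc k)))
            (≤-reflexive (solve 5 (λ p v x y d → p :* (v :+ (x :+ d)) :+ (one :- p) :* (y :+ d) :=
               p :* (v :+ x) :+ (one :- p) :* y :+ d) refl
               (prob i) (value i) (optimum r k (A ∖ a ∖ i)) (optimum r (suc k) (A ∖ a ∖ i)) Δ)))
          (+-monoˡ-≤ Δ (offer≤optimum r k (A ∖ a) (x∈p∧x≢y⇒x∈p-y (∈∖⇒∈ i∈A∖b) i≢a)))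
          where
          step : ∀ k → optimum r k (A ∖ b ∖ i) ≤ optimum r k (A ∖ a ∖ i) + Δ
          step k = subst₂ (λ B C → optimum r k B ≤ optimum r k C + Δ)
            (p─x─y≡p─y─x A i b) (p─x─y≡p─y─x A i a)
            (go r k (A ∖ i) (x∈p∧x≢y⇒x∈p-y a∈A (≢-sym i≢a)) (x∈p∧x≢y⇒x∈p-y b∈A (≢-sym i≢b)))

    -- By `exchange` either continuation after offering to `b` is ahead by at most p (va - vb),
    -- which is exactly what offering to `a` gains in immediate reward.
    offer-exchange : ∀ r k A {a b} → a ∈ˢ A → b ∈ˢ A → prob a ≡ prob b → value b ≤ value a →
                     offer r k A b ≤ offer r k A a
    offer-exchange r k A {a} {b} a∈A b∈A pa≡pb vb≤va = ≤-trans
      (≤-trans (≤-reflexive (cong (λ p → gain p (value b) (optimum r k (A ∖ b)) (optimum r (suc k) (A ∖ b))) (sym pa≡pb)))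
        (gain-mono (value b) (0≤prob a) (prob≤1 a)
          (exchange r k A a∈A b∈A pa≡pb vb≤va) (exchange r (suc k) A a∈A b∈A pa≡pb vb≤va)))
      (≤-reflexive (solve 5 (λ p va vb x y →
          p :* (vb :+ (x :+ p :* (va :- vb))) :+ (one :- p) :* (y :+ p :* (va :- vb)) :=
          p :* (va :+ x) :+ (one :- p) :* y) refl
          (prob a) (value a) (value b) (optimum r k (A ∖ a)) (optimum r (suc k) (A ∖ a))))

  -- Rounding the acceptance probabilities.

  -- Rounding up keeps the expected immediate reward, so its only harm is that a position is filled
  -- more often. In `down`, positivity of `p′` is what later allows dividing by it.
  data Rounded (δ τ p v p′ v′ : Carrier) : Set where
    down : 0# < p′ → p′ ≤ p → (1# - δ) * p ≤ p′ → v′ ≡ v → Rounded δ τ p v p′ v′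
    up   : p ≤ τ → p′ ≡ τ → p′ * v′ ≡ p * v → Rounded δ τ p v p′ v′

  record Rounding {n} (M M′ : Market n) (δ τ : Carrier) : Set where
    field
      0≤δ     : 0# ≤ δ
      0≤τ     : 0# ≤ τ
      τ≤1     : τ ≤ 1#
      rounded : ∀ i → Rounded δ τ (Market.prob M i) (Market.value M i) (Market.prob M′ i) (Market.value M′ i)

  -- Only r - 1 of r stages are charged. With one stage this leaves 1 - δ for every τ, even for τ =
  -- 1, the value when there are no thresholds.
  guarantee : Carrier → Carrier → ℕ → Carrier
  guarantee δ τ zero    = 1# - δ
  guarantee δ τ (suc r) = 1# - δ - fromℕ r * τ

  module _ {n} {M M′ : Market n} {δ τ} (R : Rounding M M′ δ τ) where
    open Rounding R
    open Market M
    open Market M′ using () renaming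
      (prob to prob′; value to value′; 0≤prob to 0≤prob′; prob≤1 to prob′≤1; 0≤value to 0≤value′)

    guarantee≤1-δ : ∀ r → guarantee δ τ r ≤ 1# - δ
    guarantee≤1-δ zero    = ≤-refl
    guarantee≤1-δ (suc r) = ≤-by (fromℕ r * τ) (*-nonNegative (0≤fromℕ r) 0≤τ)
      (solve 3 (λ d r t → one :- d :- r :* t :+ r :* t := one :- d) refl δ (fromℕ r) τ)

    guarantee≤1 : ∀ r → guarantee δ τ r ≤ 1#
    guarantee≤1 r = ≤-trans (guarantee≤1-δ r)
      (≤-by δ 0≤δ (solve 1 (λ d → one :- d :+ d := one) refl δ))

    guarantee-step : ∀ r → guarantee δ τ (suc (suc r)) ≡ guarantee δ τ (suc r) - τ
    guarantee-step r = solve 3 (λ d r t → one :- d :- (one :+ r) :* t := one :- d :- r :* t :- t)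
      refl δ (fromℕ r) τ

    guarantee-antitone : ∀ r → guarantee δ τ (suc r) ≤ guarantee δ τ r
    guarantee-antitone zero    = guarantee≤1-δ 1
    guarantee-antitone (suc r) = ≤-by τ 0≤τ (trans (cong (_+ τ) (guarantee-step r))
      (solve 2 (λ g t → g :- t :+ t := g) refl (guarantee δ τ (suc r)) τ))

    -- The factor `γ` is known for the future and `g` is wanted now. Rounding down harms only the
    -- immediate reward, since moving probability from `x′` to `y′` helps; thus 1 - δ is lost once
    -- and not per stage. Rounding up keeps the immediate reward and retains at least 1 - τ of the
    -- expected future. The last hypothesis includes that future as a factor, because for the
    -- factors alone it would fail when no stage remains.
    gain-rounded : ∀ g γ {p v p′ v′ x y x′ y′} → Rounded δ τ p v p′ v′ → 0# ≤ p → p ≤ 1# → 0# ≤ v →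
      g ≤ γ → g ≤ 1# - δ → g ≤ 1# → 0# ≤ x → 0# ≤ y → 0# ≤ x′ → x′ ≤ y′ → γ * x ≤ x′ → γ * y ≤ y′ →
      g * (p * x + (1# - p) * y) ≤ (1# - τ) * (γ * (p * x + (1# - p) * y)) →
      g * gain p v x y ≤ gain p′ v′ x′ y′
    gain-rounded g γ {p} {v} {p′} {v′} {x} {y} {x′} {y′} (down _ p′≤p 1-δp≤p′ refl)
      0≤p p≤1 0≤v g≤γ g≤1-δ g≤1 0≤x 0≤y 0≤x′ x′≤y′ γx≤x′ γy≤y′ _ = ≤-by
        (p * (x′ - g * x) + (1# - p) * (y′ - g * y) + (p′ - g * p) * v + (p - p′) * (y′ - x′))
        (+-nonNegative (+-nonNegative (+-nonNegative
            (*-nonNegative 0≤p (0≤y-x (≤-trans (*-monoˡ-≤ x 0≤x g≤γ) γx≤x′)))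
            (*-nonNegative (0≤y-x p≤1) (0≤y-x (≤-trans (*-monoˡ-≤ y 0≤y g≤γ) γy≤y′))))
            (*-nonNegative (0≤y-x (≤-trans (*-monoˡ-≤ p 0≤p g≤1-δ) 1-δp≤p′)) 0≤v))
            (*-nonNegative (0≤y-x p′≤p) (0≤y-x x′≤y′)))
        (solve 8 (λ g p v p′ x y x′ y′ →
           g :* (p :* (v :+ x) :+ (one :- p) :* y) :+
           (p :* (x′ :- g :* x) :+ (one :- p) :* (y′ :- g :* y) :+ (p′ :- g :* p) :* v :+ (p :- p′) :* (y′ :- x′))
           := p′ :* (v :+ x′) :+ (one :- p′) :* y′) refl g p v p′ x y x′ y′)
    gain-rounded g γ {p} {v} {p′} {v′} {x} {y} {x′} {y′} (up p≤τ refl p′v′≡pv)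
      0≤p p≤1 0≤v g≤γ g≤1-δ g≤1 0≤x 0≤y 0≤x′ x′≤y′ γx≤x′ γy≤y′ tail = ≤-trans
        (≤-trans
          (≤-by ((1# - g) * (p * v) + ((1# - τ) * (γ * z) - g * z))
            (+-nonNegative (*-nonNegative (0≤y-x g≤1) (*-nonNegative 0≤p 0≤v)) (0≤y-x tail))
            (solve 7 (λ g γ t p v x y →
               g :* (p :* (v :+ x) :+ (one :- p) :* y) :+
               ((one :- g) :* (p :* v) :+ ((one :- t) :* (γ :* (p :* x :+ (one :- p) :* y)) :- g :* (p :* x :+ (one :- p) :* y)))
               := p :* v :+ (one :- t) :* (γ :* (p :* x :+ (one :- p) :* y))) refl g γ τ p v x y))
          (≤-by ((1# - τ) * (p * (x′ - γ * x) + (1# - p) * (y′ - γ * y)) + (τ * x′ + (1# - τ) * (p * (y′ - x′))))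
            (+-nonNegative
              (*-nonNegative 0≤1-τ (+-nonNegative (*-nonNegative 0≤p (0≤y-x γx≤x′)) (*-nonNegative (0≤y-x p≤1) (0≤y-x γy≤y′))))
              (+-nonNegative (*-nonNegative 0≤τ 0≤x′) (*-nonNegative 0≤1-τ (*-nonNegative 0≤p (0≤y-x x′≤y′)))))
            (solve 8 (λ γ t p v x y x′ y′ →
               (p :* v :+ (one :- t) :* (γ :* (p :* x :+ (one :- p) :* y))) :+
               ((one :- t) :* (p :* (x′ :- γ :* x) :+ (one :- p) :* (y′ :- γ :* y)) :+ (t :* x′ :+ (one :- t) :* (p :* (y′ :- x′))))
               := p :* v :+ (t :* x′ :+ (one :- t) :* y′)) refl γ τ p v x y x′ y′)))
        (≤-reflexive (trans (cong (_+ (τ * x′ + (1# - τ) * y′)) (sym p′v′≡pv))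
          (solve 4 (λ t v′ x′ y′ → t :* v′ :+ (t :* x′ :+ (one :- t) :* y′) := t :* (v′ :+ x′) :+ (one :- t) :* y′)
            refl τ v′ x′ y′)))
      where
      z : Carrier
      z = p * x + (1# - p) * y
      0≤1-τ : 0# ≤ 1# - τ
      0≤1-τ = 0≤y-x τ≤1

    optimum-rounded : ∀ r k A → guarantee δ τ r * optimum M r k A ≤ optimum M′ r k A
    optimum-rounded zero    k       A = ≤-reflexive (zeroʳ _)
    optimum-rounded (suc r) zero    A = ≤-reflexive (zeroʳ _)
    optimum-rounded (suc r) (suc k) A with optimum-attained M r k A
    ... | inj₁ (W≡0 , _)        = ≤-trans (≤-reflexive (trans (cong (guarantee δ τ (suc r) *_) W≡0) (zeroʳ _)))
                                    (0≤optimum M′ (suc r) (suc k) A)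
    ... | inj₂ (i , i∈A , W≡) = subst (λ w → guarantee δ τ (suc r) * w ≤ optimum M′ (suc r) (suc k) A) (sym W≡)
      (≤-trans
        (gain-rounded (guarantee δ τ (suc r)) (guarantee δ τ r) (rounded i) (0≤prob i) (prob≤1 i) (0≤value i)
          (guarantee-antitone r) (guarantee≤1-δ (suc r)) (guarantee≤1 (suc r))
          (0≤optimum M r k (A ∖ i)) (0≤optimum M r (suc k) (A ∖ i)) (0≤optimum M′ r k (A ∖ i))
          (optimum-mono M′ {r} {r} {A = A ∖ i} (inj₁ ℕ.≤-refl) (ℕ.n≤1+n k) (λ i∈ → i∈))
          (optimum-rounded r k (A ∖ i)) (optimum-rounded r (suc k) (A ∖ i)) (tail r))
        (offer≤optimum M′ r k A i∈A))
      where
      -- With one stage left the future is worth nothing, so the last stage is not charged.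
      tail : ∀ r → let z = prob i * optimum M r k (A ∖ i) + (1# - prob i) * optimum M r (suc k) (A ∖ i) in
             guarantee δ τ (suc r) * z ≤ (1# - τ) * (guarantee δ τ r * z)
      tail zero = ≤-reflexive (trans (vanish (guarantee δ τ 1)) (sym (trans (cong ((1# - τ) *_) (vanish (guarantee δ τ 0))) (zeroʳ _))))
        where
        vanish : ∀ g → g * (prob i * 0# + (1# - prob i) * 0#) ≡ 0#
        vanish g = trans (cong (g *_) (trans (cong₂ _+_ (zeroʳ _) (zeroʳ _)) (+-identityʳ 0#))) (zeroʳ g)
      -- As the guarantee γ is at most 1, (1 - τ) γ is at least γ - τ: the losses of successive
      -- stages add up.
      tail (suc r) = ≤-by (τ * ((1# - guarantee δ τ (suc r)) * z))
        (*-nonNegative 0≤τ (*-nonNegative (0≤y-x (guarantee≤1 (suc r))) 0≤z))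
        (trans (cong (λ g → g * z + τ * ((1# - guarantee δ τ (suc r)) * z)) (guarantee-step r))
          (solve 3 (λ g t z → (g :- t) :* z :+ t :* ((one :- g) :* z) := (one :- t) :* (g :* z)) refl (guarantee δ τ (suc r)) τ z))
        where
        z : Carrier
        z = prob i * optimum M (suc r) k (A ∖ i) + (1# - prob i) * optimum M (suc r) (suc k) (A ∖ i)
        0≤z : 0# ≤ z
        0≤z = +-nonNegative (*-nonNegative (0≤prob i) (0≤optimum M (suc r) k (A ∖ i)))
                (*-nonNegative (0≤y-x (prob≤1 i)) (0≤optimum M (suc r) (suc k) (A ∖ i)))

  -- Offers restricted to the best applicant of each class.

  -- The analysis sees the classes only through this interface. `pick` is a function and not a mere
  -- existence claim, so that the policy can be built from the very choices of the program, ties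
  -- included.
  record Selection (n : ℕ) : Set where
    field
      classes      : ℕ
      class        : Fin n → ℕ
      key          : Fin n → Carrier
      pick         : ℕ → Subset n → Maybe (Fin n)
      class<       : ∀ i → class i ℕ.< classes
      pick-just    : ∀ j A {b} → pick j A ≡ just b →
                     b ∈ˢ A × class b ≡ j × (∀ i → i ∈ˢ A → class i ≡ j → key i ≤ key b)
      pick-nothing : ∀ j A → pick j A ≡ nothing → ∀ i → i ∈ˢ A → class i ≡ j → ⊥

  -- Ties go to the later class, as in the program's `option`.
  better : {X : Set} → Maybe (X × Carrier) → Maybe (X × Carrier) → Maybe (X × Carrier)
  better rest           nothing        = rest
  better nothing        (just c)       = just c
  better (just (i , x)) (just (b , y)) with x ≤? y
  ... | yes _ = just (b , y)
  ... | no  _ = just (i , x)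

  worth : {X : Set} → Maybe (X × Carrier) → Carrier
  worth nothing        = 0#
  worth (just (_ , x)) = x

  module _ {n} (M : Market n) (𝒮 : Selection n) where
    open Market M
    open Selection 𝒮

    choose : (Fin n → Carrier) → Subset n → ℕ → Maybe (Fin n × Carrier)
    choose q A zero    = nothing
    choose q A (suc j) = better (choose q A j) (Maybe.map (λ b → b , q b) (pick j A))

    restricted : ℕ → ℕ → Subset n → Carrier
    restricted zero    k       A = 0#
    restricted (suc r) zero    A = 0#
    restricted (suc r) (suc k) A = worth (choose
      (λ b → gain (prob b) (value b) (restricted r k (A ∖ b)) (restricted r (suc k) (A ∖ b))) A classes)

    proposal : ℕ → ℕ → Subset n → Fin n → Carrier
    proposal r k A b = gain (prob b) (value b) (restricted r k (A ∖ b)) (restricted r (suc k) (A ∖ b))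

    choice? : ℕ → ℕ → Subset n → Maybe (Fin n × Carrier)
    choice? r k A = choose (proposal r k A) A classes

    choose-sound : ∀ q A J {b x} → choose q A J ≡ just (b , x) → b ∈ˢ A × class b ℕ.< J × pick (class b) A ≡ just b × x ≡ q b
    choose-sound q A (suc j) eq with choose q A j in eqC | pick j A in eqP
    ... | c | nothing with b∈A , <j , pk , x≡ ← choose-sound q A j (trans eqC eq) = b∈A , ℕ.m<n⇒m<1+n <j , pk , x≡
    choose-sound q A (suc j) refl | nothing | just b with b∈A , refl , _ ← pick-just j A eqP = b∈A , ℕ.≤-refl , eqP , refl
    choose-sound q A (suc j) eq | just (i , x) | just b with x ≤? q b
    choose-sound q A (suc j) refl | just (i , x) | just b | yes _
      with b∈A , refl , _ ← pick-just j A eqP = b∈A , ℕ.≤-refl , eqP , refl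
    choose-sound q A (suc j) refl | just (i , x) | just b | no _
      with b∈A , <j , pk , x≡ ← choose-sound q A j eqC = b∈A , ℕ.m<n⇒m<1+n <j , pk , x≡

    choose-max : ∀ q A J {j b} → j ℕ.< J → pick j A ≡ just b →
                 Σ[ c ∈ Fin n × Carrier ] (choose q A J ≡ just c × q b ≤ proj₂ c)
    choose-max q A (suc J) {j} {b} (s≤s j≤J) pk with j ℕ.≟ J
    choose-max q A (suc J) {j} {b} (s≤s j≤J) pk | yes refl with choose q A J | pick J A
    choose-max q A (suc J) {j} {b} (s≤s j≤J) refl | yes refl | nothing      | just _ = (b , q b) , refl , ≤-refl
    choose-max q A (suc J) {j} {b} (s≤s j≤J) refl | yes refl | just (i , x) | just _ with x ≤? q b
    ... | yes _    = (b , q b) , refl , ≤-refl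
    ... | no  x≰q = (i , x) , refl , ≰⇒≥ x≰q
    choose-max q A (suc J) {j} {b} (s≤s j≤J) pk | no j≢J
      with choose q A J | pick J A | choose-max q A J (ℕ.≤∧≢⇒< j≤J j≢J) pk
    ... | _ | nothing | best                     = best
    ... | _ | just b′ | (i , x) , refl , qb≤x with x ≤? q b′
    ...   | yes x≤q = (b′ , q b′) , refl , ≤-trans qb≤x x≤q
    ...   | no  _   = (i , x) , refl , qb≤x

    choice-exists : ∀ r k A {i} → i ∈ˢ A →
      Σ[ b ∈ Fin n ] (b ∈ˢ A × class b ≡ class i × key i ≤ key b ×
        Σ[ c ∈ Fin n × Carrier ] (choice? r k A ≡ just c × proposal r k A b ≤ proj₂ c))
    choice-exists r k A {i} i∈A with pick (class i) A in eq
    ... | nothing = ⊥-elim (pick-nothing (class i) A eq i i∈A refl)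
    ... | just b with b∈A , cb≡ci , max ← pick-just (class i) A eq =
      b , b∈A , cb≡ci , max i i∈A refl , choose-max (proposal r k A) A classes (class< i) eq

    0≤restricted : ∀ r k A → 0# ≤ restricted r k A
    0≤restricted zero    k       A = ≤-refl
    0≤restricted (suc r) zero    A = ≤-refl
    0≤restricted (suc r) (suc k) A with choice? r k A in eq
    ... | nothing      = ≤-refl
    ... | just (b , x) with _ , _ , _ , refl ← choose-sound (proposal r k A) A classes eq =
      0≤gain (0≤prob b) (prob≤1 b) (0≤value b) (0≤restricted r k (A ∖ b)) (0≤restricted r (suc k) (A ∖ b))

  record Compatible {n} (M′ : Market n) (𝒮 : Selection n) : Set where
    open Market M′
    open Selection 𝒮
    field
      prob-class : ∀ {i b} → class b ≡ class i → prob b ≡ prob i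
      value-key  : ∀ {i b} → class b ≡ class i → key i ≤ key b → value i ≤ value b

  module _ {n} {M M′ : Market n} {δ τ} (R : Rounding M M′ δ τ) (𝒮 : Selection n) (C : Compatible M′ 𝒮) where
    open Rounding R
    open Compatible C
    open Market M
    open Market M′ using () renaming
      (prob to prob′; value to value′; 0≤prob to 0≤prob′; prob≤1 to prob′≤1; 0≤value to 0≤value′)

    -- Raising an acceptance probability only helps for an offer that is at least as good as
    -- skipping the applicant, which is the case for an optimal offer.
    unrounded-gain : ∀ {p v p′ v′ x y} → Rounded δ τ p v p′ v′ → x ≤ y → y ≤ gain p′ v′ x y →
                     gain p′ v′ x y ≤ gain p v x y
    unrounded-gain {p} {v} {p′} {v′} {x} {y} (down 0<p′ p′≤p _ refl) x≤y y≤gain =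
      ≤-by ((p - p′) * (v + x - y))
        (*-nonNegative (0≤y-x p′≤p) (*-cancel-≤0 0<p′ (subst (0# ≤_)
          (solve 4 (λ p v x y → p :* (v :+ x) :+ (one :- p) :* y :- y := p :* (v :+ x :- y)) refl p′ v x y)
          (0≤y-x y≤gain))))
        (solve 5 (λ p p′ v x y → p′ :* (v :+ x) :+ (one :- p′) :* y :+ (p :- p′) :* (v :+ x :- y) :=
           p :* (v :+ x) :+ (one :- p) :* y) refl p p′ v x y)
    -- With p v fixed, going back from τ to p only moves weight from `x` to `y`, which is no
    -- smaller.
    unrounded-gain {p} {v} {p′} {v′} {x} {y} (up p≤τ refl p′v′≡pv) x≤y y≤gain =
      ≤-by ((τ - p) * (y - x)) (*-nonNegative (0≤y-x p≤τ) (0≤y-x x≤y))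
        (trans (solve 5 (λ t p v′ x y → t :* (v′ :+ x) :+ (one :- t) :* y :+ (t :- p) :* (y :- x) :=
                  t :* v′ :+ (p :* x :+ (one :- p) :* y)) refl τ p v′ x y)
        (trans (cong (_+ (p * x + (1# - p) * y)) p′v′≡pv)
          (solve 4 (λ p v x y → p :* v :+ (p :* x :+ (one :- p) :* y) := p :* (v :+ x) :+ (one :- p) :* y)
            refl p v x y)))

    -- The two markets are compared stage by stage without loss. Exchange turns the optimal rounded
    -- offer into one to the best of its class, undoing the rounding of this single offer does not
    -- lower its value, and the induction undoes the rest.
    optimum≤restricted : ∀ r k A → optimum M′ r k A ≤ restricted M 𝒮 r k A
    optimum≤restricted zero    k       A = ≤-refl
    optimum≤restricted (suc r) zero    A = ≤-refl
    optimum≤restricted (suc r) (suc k) A with optimum-attained M′ r k A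
    ... | inj₁ (W≡0 , _)      = subst (_≤ restricted M 𝒮 (suc r) (suc k) A) (sym W≡0) (0≤restricted M 𝒮 (suc r) (suc k) A)
    ... | inj₂ (i , i∈A , W≡) with choice-exists M 𝒮 r k A i∈A
    ...   | b , b∈A , cb≡ci , ki≤kb , (c , x) , eq , prop≤x =
      ≤-trans W≤offer (≤-trans
        (unrounded-gain (rounded b) (optimum-mono M′ {r} {r} {A = A ∖ b} (inj₁ ℕ.≤-refl) (ℕ.n≤1+n k) (λ i∈ → i∈))
          -- Skipping `b` leaves fewer stages and fewer applicants, hence at most the optimum, which
          -- the offer to `b` attains. So this offer is worth making.
          (≤-trans (optimum-mono M′ {r} {suc r} {suc k} {A = A ∖ b} (inj₁ (ℕ.n≤1+n r)) ℕ.≤-refl ∈∖⇒∈) W≤offer))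
        (≤-trans (gain-mono (value b) (0≤prob b) (prob≤1 b)
            (optimum≤restricted r k (A ∖ b)) (optimum≤restricted r (suc k) (A ∖ b)))
          (≤-trans prop≤x (≤-reflexive (sym (cong worth eq))))))
      where
      W≤offer : optimum M′ (suc r) (suc k) A ≤ offer M′ r k A b
      W≤offer = ≤-trans (≤-reflexive W≡)
        (offer-exchange M′ r k A b∈A i∈A (prob-class cb≡ci) (value-key cb≡ci ki≤kb))

-- Optimal and restricted policies as functions of the state.

module Policies (𝔽 : ArchimedeanField) (I : Hiring.Instance 𝔽) where
  open OrderedField 𝔽
  open Optimum 𝔽
  open Hiring 𝔽
  open Instance I
  open State

  market : Market n
  market = record { prob = lookup P ; value = lookup V ; 0≤prob = P≥0 ; prob≤1 = P≤1 ; 0≤value = V≥0 }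

  -- Nonemptiness is given irrelevantly, so a witness has to be recomputed; with a constant function
  -- `argmax?` is a plain search.
  element : (A : Subset n) → .(Nonempty A) → Σ[ i ∈ Fin n ] i ∈ˢ A
  element A ne with argmax? A (λ _ → 0#)
  ... | inj₁ empty         = ⊥-elim-irr (empty (proj₁ ne) (proj₂ ne))
  ... | inj₂ (i , i∈A , _) = i , i∈A

  0≤reward : ∀ ℋ r s → 0# ≤ rewardFrom I ℋ r s
  0≤reward ℋ zero    s = ≤-refl
  0≤reward ℋ (suc r) s with nonTerminal? I s
  ... | no _   = ≤-refl
  ... | yes nt = 0≤gain (P≥0 i) (P≤1 i) (V≥0 i) (0≤reward ℋ r (accepted i s)) (0≤reward ℋ r (rejected i s))
    where
    i : Fin n
    i = choice I ℋ s nt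

  reward≤optimum : ∀ ℋ r s → rewardFrom I ℋ r s ≤ optimum market r (positions s) (available s)
  reward≤optimum ℋ zero    s = ≤-refl
  reward≤optimum ℋ (suc r) s@(⟨ t , k , A ⟩) with nonTerminal? I s
  ... | no _                        = 0≤optimum market (suc r) k A
  reward≤optimum ℋ (suc r) s@(⟨ t , suc k , A ⟩) | yes nt = ≤-trans
    (gain-mono (lookup V i) (P≥0 i) (P≤1 i) (reward≤optimum ℋ r (accepted i s)) (reward≤optimum ℋ r (rejected i s)))
    (offer≤optimum market r k A (proj₂ (ℋ s nt)))
    where
    i : Fin n
    i = choice I ℋ s nt

  optimalPolicy : Policy I
  -- `offer` takes the stages left after the offer and the positions left after an acceptance.
  optimalPolicy ⟨ t , k , A ⟩ nt with argmax? A (offer market (T ℕ.∸ t) (k ℕ.∸ 1) A)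
  ... | inj₁ empty         = ⊥-elim-irr (empty (proj₁ (proj₂ (proj₂ nt))) (proj₂ (proj₂ (proj₂ nt))))
  ... | inj₂ (i , i∈A , _) = i , i∈A

  optimalPolicy-max : ∀ s nt {l} → l ∈ˢ available s →
    let q = offer market (T ℕ.∸ stage s) (positions s ℕ.∸ 1) (available s) in q l ≤ q (choice I optimalPolicy s nt)
  optimalPolicy-max ⟨ t , k , A ⟩ nt {l} l∈A with argmax? A (offer market (T ℕ.∸ t) (k ℕ.∸ 1) A)
  ... | inj₁ empty         = ⊥-elim (empty l l∈A)
  ... | inj₂ (_ , _ , max) = max l l∈A

  optimum≤reward : ∀ r s → stage s ℕ.+ r ≡ suc T → optimum market r (positions s) (available s) ≤ rewardFrom I optimalPolicy r s
  optimum≤reward zero    s                       _  = ≤-refl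
  optimum≤reward (suc r) s@(⟨ t , zero , A ⟩)    eq = 0≤reward optimalPolicy (suc r) s
  optimum≤reward (suc r) s@(⟨ t , suc k , A ⟩)   eq with nonTerminal? I s
  ... | no ¬nt = optimum-empty market (suc r) (suc k) A λ i i∈A → ¬nt (ℕ.m+n≤o⇒m≤o t (ℕ.≤-reflexive t+r≡T) , s≤s z≤n , i , i∈A)
    where
    t+r≡T : t ℕ.+ r ≡ T
    t+r≡T = ℕ.suc-injective (trans (sym (ℕ.+-suc t r)) eq)
  ... | yes nt = optimum-least market r k A
          (0≤gain (P≥0 i) (P≤1 i) (V≥0 i) (0≤reward optimalPolicy r (accepted i s)) (0≤reward optimalPolicy r (rejected i s)))
          (λ l l∈A → ≤-trans
            (subst (λ r → offer market r k A l ≤ offer market r k A i) T∸t≡r (optimalPolicy-max s nt l∈A))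
            (gain-mono (lookup V i) (P≥0 i) (P≤1 i)
              (optimum≤reward r (accepted i s) (trans (sym (ℕ.+-suc t r)) eq))
              (optimum≤reward r (rejected i s) (trans (sym (ℕ.+-suc t r)) eq))))
    where
    i : Fin n
    i = choice I optimalPolicy s nt
    T∸t≡r : T ℕ.∸ t ≡ r
    T∸t≡r = trans (cong (ℕ._∸ t) (ℕ.suc-injective (trans (sym eq) (ℕ.+-suc t r)))) (ℕ.m+n∸m≡n t r)

  optimalPolicy-optimal : Optimal I optimalPolicy
  optimalPolicy-optimal ℋ = ≤-trans (reward≤optimum ℋ T (initial I)) (optimum≤reward T (initial I) refl)

  -- After n offers nobody is left. Bounding the stages by n as well allows one factor in the number
  -- of states to be charged to n.
  horizon : ℕ
  horizon = T ℕ.⊓ n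

  module _ (𝒮 : Selection n) where
    open Selection 𝒮

    decision : State n → Maybe (Fin n × Carrier)
    decision ⟨ t , k , A ⟩ = choice? market 𝒮 (horizon ℕ.∸ t) (k ℕ.∸ 1) A

    -- At a nonterminal state `decision` always yields a choice, by `decision-exists`; the default
    -- makes the policy total without using this.
    follow : ∀ A (m : Maybe (Fin n × Carrier)) → (∀ {b x} → m ≡ just (b , x) → b ∈ˢ A) →
             .(Nonempty A) → Σ[ i ∈ Fin n ] i ∈ˢ A
    follow A nothing        _     ne = element A ne
    follow A (just (b , _)) sound _  = b , sound refl

    restrictedPolicy : Policy I
    restrictedPolicy s nt = follow (available s) (decision s)
      (λ eq → proj₁ (choose-sound market 𝒮 _ (available s) classes eq)) (proj₂ (proj₂ nt))

    restrictedPolicy-decision : ∀ s nt {b x} → decision s ≡ just (b , x) → choice I restrictedPolicy s nt ≡ b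
    restrictedPolicy-decision s nt = go (decision s) _
      where
      go : ∀ m (sound : ∀ {b x} → m ≡ just (b , x) → b ∈ˢ available s) {b x} → m ≡ just (b , x) →
           proj₁ (follow (available s) m sound (proj₂ (proj₂ nt))) ≡ b
      go _ _ refl = refl

    decision-exists : ∀ s → Nonempty (available s) → Σ[ c ∈ Fin n × Carrier ] decision s ≡ just c
    decision-exists ⟨ t , k , A ⟩ (i , i∈A) with _ , _ , _ , _ , c , eq , _ ←
      choice-exists market 𝒮 (horizon ℕ.∸ t) (k ℕ.∸ 1) A i∈A = c , eq

    restricted-empty : ∀ r k A → (∀ i → i ∈ˢ A → ⊥) → restricted market 𝒮 r k A ≡ 0#
    restricted-empty zero    k       A empty = refl
    restricted-empty (suc r) zero    A empty = refl
    restricted-empty (suc r) (suc k) A empty with choice? market 𝒮 r k A in eq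
    ... | nothing      = refl
    ... | just (b , _) = ⊥-elim (empty b (proj₁ (choose-sound market 𝒮 _ A classes eq)))

    -- Two clocks run: `r` counts the stages up to the horizon and `r′` those up to T. What the
    -- policy does after the horizon can only add to the reward.
    restricted≤reward : ∀ r r′ s → stage s ℕ.+ r ≡ suc horizon → stage s ℕ.+ r′ ≡ suc T →
      restricted market 𝒮 r (positions s) (available s) ≤ rewardFrom I restrictedPolicy r′ s
    restricted≤reward zero    r′ s _ _ = 0≤reward restrictedPolicy r′ s
    restricted≤reward (suc r) r′ s@(⟨ t , zero , A ⟩) _ _ = 0≤reward restrictedPolicy r′ s
    -- Stages left before the horizon but none before T: impossible, since the horizon is at most T.
    restricted≤reward (suc r) zero s@(⟨ t , suc k , A ⟩) eq eq′ = contradiction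
      (ℕ.≤-trans (s≤s (ℕ.m≤m+n t r)) (ℕ.≤-trans (ℕ.≤-reflexive (trans (sym (ℕ.+-suc t r)) eq)) (s≤s (ℕ.m⊓n≤m T n))))
      (λ t<sT → ℕ.<-irrefl (sym (trans (sym eq′) (ℕ.+-identityʳ t))) t<sT)
    restricted≤reward (suc r) (suc r′) s@(⟨ t , suc k , A ⟩) eq eq′ with nonTerminal? I s
    ... | no ¬nt = ≤-reflexive (restricted-empty (suc r) (suc k) A
            λ i i∈A → ¬nt (ℕ.m+n≤o⇒m≤o t (ℕ.≤-reflexive t+r′≡T) , s≤s z≤n , i , i∈A))
      where
      t+r′≡T : t ℕ.+ r′ ≡ T
      t+r′≡T = ℕ.suc-injective (trans (sym (ℕ.+-suc t r′)) eq′)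
    ... | yes nt with decision-exists s (proj₂ (proj₂ nt))
    ...   | (b , x) , dec≡ = subst₂ _≤_ (sym value≡) (cong rewardOf (sym (restrictedPolicy-decision s nt dec≡)))
            (gain-mono (lookup V b) (P≥0 b) (P≤1 b)
              (restricted≤reward r r′ (accepted b s) (trans (sym (ℕ.+-suc t r)) eq) (trans (sym (ℕ.+-suc t r′)) eq′))
              (restricted≤reward r r′ (rejected b s) (trans (sym (ℕ.+-suc t r)) eq) (trans (sym (ℕ.+-suc t r′)) eq′)))
      where
      rewardOf : Fin n → Carrier
      rewardOf i = gain (lookup P i) (lookup V i)
        (rewardFrom I restrictedPolicy r′ (accepted i s)) (rewardFrom I restrictedPolicy r′ (rejected i s))
      h∸t≡r : horizon ℕ.∸ t ≡ r
      h∸t≡r = trans (cong (ℕ._∸ t) (ℕ.suc-injective (trans (sym eq) (ℕ.+-suc t r)))) (ℕ.m+n∸m≡n t r)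
      choice≡ : choice? market 𝒮 r k A ≡ just (b , x)
      choice≡ = subst (λ r → choice? market 𝒮 r k A ≡ just (b , x)) h∸t≡r dec≡
      value≡ : restricted market 𝒮 (suc r) (suc k) A ≡ proposal market 𝒮 r k A b
      value≡ = trans (cong worth choice≡) (proj₂ (proj₂ (proj₂ (choose-sound market 𝒮 _ A classes choice≡))))

    -- Follows the pick of every class, whichever the policy prefers, and both outcomes. Dynamic
    -- programming needs this larger set, as it evaluates the successors of all candidate offers
    -- before choosing one.
    data Explored : State n → Set where
      start   : Explored (initial I)
      offered : ∀ {t k A j b k′} → Explored ⟨ t , k , A ⟩ → j ℕ.< classes → pick j A ≡ just b →
                k′ ≡ k ℕ.∸ 1 ⊎ k′ ≡ k → Explored ⟨ suc t , k′ , A ∖ b ⟩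

    Reachable⇒Explored : ∀ {s} → Reachable I restrictedPolicy s → Explored s
    Reachable⇒Explored start = start
    Reachable⇒Explored (accept {s} reach nt _)
      with (b , _) , dec≡ ← decision-exists s (proj₂ (proj₂ nt))
      rewrite restrictedPolicy-decision s nt dec≡
      with _ , <classes , picked , _ ← choose-sound market 𝒮 _ (available s) classes dec≡
      = offered (Reachable⇒Explored reach) <classes picked (inj₁ refl)
    Reachable⇒Explored (reject {s} reach nt _)
      with (b , _) , dec≡ ← decision-exists s (proj₂ (proj₂ nt))
      rewrite restrictedPolicy-decision s nt dec≡
      with _ , <classes , picked , _ ← choose-sound market 𝒮 _ (available s) classes dec≡
      = offered (Reachable⇒Explored reach) <classes picked (inj₂ refl)

    Explored⇒stage+∣available∣ : ∀ {s} → Explored s → stage s ℕ.+ ∣ available s ∣ ℕ.≤ suc n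
    Explored⇒stage+∣available∣ start = s≤s (ℕ.≤-reflexive (∣⊤∣≡n n))
    Explored⇒stage+∣available∣ (offered {t} {j = j} e _ picked _) = ℕ.≤-trans (ℕ.≤-reflexive (sym (ℕ.+-suc t _)))
      (ℕ.≤-trans (ℕ.+-monoʳ-≤ t (x∈p⇒∣p-x∣<∣p∣ (proj₁ (pick-just j _ picked)))) (Explored⇒stage+∣available∣ e))

    Explored⇒1≤stage : ∀ {s} → Explored s → 1 ℕ.≤ stage s
    Explored⇒1≤stage start             = s≤s z≤n
    Explored⇒1≤stage (offered _ _ _ _) = s≤s z≤n

    -- Each offer uses up an applicant and a nonterminal state still has one, so its stage is at
    -- most n.
    Explored⇒stage≤horizon : ∀ {s} → Explored s → NonTerminal I s → stage s ℕ.≤ horizon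
    Explored⇒stage≤horizon {s} e (t≤T , _ , i , i∈A) = ℕ.⊓-glb t≤T (ℕ.s≤s⁻¹ (ℕ.≤-trans
      (ℕ.≤-trans (ℕ.≤-reflexive (ℕ.+-comm 1 (stage s))) (ℕ.+-monoʳ-≤ (stage s) (ℕ.≤-trans (s≤s z≤n) (x∈p⇒∣p-x∣<∣p∣ i∈A))))
      (Explored⇒stage+∣available∣ e)))

    describes : (D : _) →
      (∀ {s b x} → Explored s → NonTerminal I s → decision s ≡ just (b , x) → (encodeState s , toℕ b) ∈ D) →
      (∀ {s j} → Explored s → NonTerminal I s → (encodeState s , j) ∈ D → Σ[ c ∈ Fin n × Carrier ] (decision s ≡ just c × j ≡ toℕ (proj₁ c))) →
      Describes I D restrictedPolicy
    describes D complete sound {s} reach nt j = mk⇔ to from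
      where
      to : (encodeState s , j) ∈ D → j ≡ toℕ (choice I restrictedPolicy s nt)
      to j∈D with c , dec≡ , j≡ ← sound (Reachable⇒Explored reach) nt j∈D
        = trans j≡ (cong toℕ (sym (restrictedPolicy-decision s nt dec≡)))
      from : j ≡ toℕ (choice I restrictedPolicy s nt) → (encodeState s , j) ∈ D
      from refl with c , dec≡ ← decision-exists s (proj₂ (proj₂ nt))
        = subst (λ b → (encodeState s , toℕ b) ∈ D) (sym (restrictedPolicy-decision s nt dec≡)) (complete (Reachable⇒Explored reach) nt dec≡)

    restrictedPolicy-near-optimal : ∀ {M′ δ τ} ε → Rounding market M′ δ τ → Compatible M′ 𝒮 →
      1# - ε ≤ guarantee δ τ horizon → (1# - ε) * reward I optimalPolicy ≤ reward I restrictedPolicy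
    restrictedPolicy-near-optimal {M′} {δ} {τ} ε R C 1-ε≤g = subst (λ w → (1# - ε) * w ≤ reward I restrictedPolicy) (sym reward≡W)
      (≤-trans (*-monoˡ-≤ W (0≤optimum market horizon k ⊤ˢ) 1-ε≤g)
      (≤-trans (optimum-rounded R horizon k ⊤ˢ)
      (≤-trans (optimum≤restricted R 𝒮 C horizon k ⊤ˢ)
        (restricted≤reward horizon T (initial I) refl refl))))
      where
      W : Carrier
      W = optimum market horizon k ⊤ˢ
      fits : T ℕ.≤ horizon ⊎ ∣ ⊤ˢ {n} ∣ ℕ.≤ horizon
      fits with ℕ.≤-total T n
      ... | inj₁ T≤n = inj₁ (ℕ.⊓-glb ℕ.≤-refl T≤n)
      ... | inj₂ n≤T = inj₂ (ℕ.≤-trans (ℕ.≤-reflexive (∣⊤∣≡n n)) (ℕ.⊓-glb n≤T ℕ.≤-refl))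
      reward≡W : reward I optimalPolicy ≡ W
      reward≡W = ≤-antisym
        (≤-trans (reward≤optimum optimalPolicy T (initial I)) (optimum-mono market {T} {horizon} {k} {A = ⊤ˢ} fits ℕ.≤-refl (λ i∈ → i∈)))
        (≤-trans (optimum-mono market {horizon} {T} {k} {A = ⊤ˢ} (inj₁ (ℕ.m⊓n≤m T n)) ℕ.≤-refl (λ i∈ → i∈)) (optimum≤reward T (initial I) refl))

-- Evaluation with a bound on the number of steps.

-- Both branches of a case distinction are counted, so that the number depends on the term alone.
-- Apart from the steps inside callees, an evaluation visits every node at most once.
nodes : ∀ {Φ Γ A} → Tm Φ Γ A → ℕ
nodes (var x)          = 1
nodes (bool b)         = 1
nodes (nat m)          = 1
nodes nil              = 1
nodes (pair e f)       = suc (nodes e ℕ.+ nodes f)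
nodes (op o e)         = suc (nodes e)
nodes (bind e f)       = suc (nodes e ℕ.+ nodes f)
nodes (cond b e f)     = suc (nodes b ℕ.+ (nodes e ℕ.+ nodes f))
nodes (caseList l e f) = suc (nodes l ℕ.+ (nodes e ℕ.+ nodes f))
nodes (call g e)       = suc (nodes e)

-- For a term without calls all obligations about calls follow from one computed Boolean, without
-- going through its branches.
callFree : ∀ {Φ Γ A} → Tm Φ Γ A → Bool
callFree (var x)          = true
callFree (bool b)         = true
callFree (nat m)          = true
callFree nil              = true
callFree (pair e f)       = callFree e ∧ callFree f
callFree (op o e)         = callFree e
callFree (bind e f)       = callFree e ∧ callFree f
callFree (cond b e f)     = callFree b ∧ (callFree e ∧ callFree f)
callFree (caseList l e f) = callFree l ∧ (callFree e ∧ callFree f)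
callFree (call g e)       = false

module Evaluation (𝔽 : ArchimedeanField) where
  open import Data.Nat.Base using (_+_; _*_; _≤_)
  open Execution 𝔽

  Function Bound : Ty × Ty → Set
  Function (A , B) = ⟦ A ⟧ → ⟦ B ⟧
  Bound    (A , B) = ⟦ A ⟧ → ℕ

  uncons : ∀ {a b} {X : Set a} {Y : Set b} → List X → Y → (X → List X → Y) → Y
  uncons []       y f = y
  uncons (x ∷ xs) y f = f x xs

  -- The functions fs and the numbers of calls ns are the intended semantics of the bodies.
  module Semantics {Φ : Signature} (bodies : All (Body Φ) Φ) (fs : All Function Φ) (ns : All Bound Φ) (S : ℕ) where

    value : ∀ {Γ A} → Tm Φ Γ A → All ⟦_⟧ Γ → ⟦ A ⟧
    value (var x)          ρ = All.lookup ρ x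
    value (bool b)         ρ = b
    value (nat m)          ρ = m
    value nil              ρ = []
    value (pair e f)       ρ = value e ρ , value f ρ
    value (op o e)         ρ = ⟦ o ⟧ᵒ (value e ρ)
    value (bind e f)       ρ = value f (value e ρ ∷ ρ)
    value (cond b e f)     ρ = if value b ρ then value e ρ else value f ρ
    value (caseList l e f) ρ = uncons (value l ρ) (value e ρ) (λ x xs → value f (x ∷ xs ∷ ρ))
    value (call g e)       ρ = All.lookup fs g (value e ρ)

    -- A record rather than a Σ-type, so that its occurrences in types are not unfolded.
    record Evaluates {A B} (g : (A , B) ∈ Φ) (u : ⟦ A ⟧) : Set where
      constructor evaluation
      field
        {steps}    : ℕ
        derivation : bodies , (u ∷ []) ⊢ All.lookup bodies g ⇓ All.lookup fs g u ⟨ steps ⟩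
        steps≤     : steps ≤ S * All.lookup ns g u

    -- In continuation-passing style, so that for a concrete term only the calls are listed.
    Calls : ∀ {Γ A} → Tm Φ Γ A → All ⟦_⟧ Γ → Set → Set
    Calls (var x)          ρ K = K
    Calls (bool b)         ρ K = K
    Calls (nat m)          ρ K = K
    Calls nil              ρ K = K
    Calls (pair e f)       ρ K = Calls e ρ (Calls f ρ K)
    Calls (op o e)         ρ K = Calls e ρ K
    Calls (bind e f)       ρ K = Calls e ρ (Calls f (value e ρ ∷ ρ) K)
    Calls (cond b e f)     ρ K = Calls b ρ (if value b ρ then Calls e ρ K else Calls f ρ K)
    Calls (caseList l e f) ρ K = Calls l ρ (uncons (value l ρ) (Calls e ρ K) (λ x xs → Calls f (x ∷ xs ∷ ρ) K))
    Calls (call g e)       ρ K = Calls e ρ (Evaluates g (value e ρ) × K)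

    calls : ∀ {Γ A} → Tm Φ Γ A → All ⟦_⟧ Γ → ℕ → ℕ
    calls (var x)          ρ k = k
    calls (bool b)         ρ k = k
    calls (nat m)          ρ k = k
    calls nil              ρ k = k
    calls (pair e f)       ρ k = calls e ρ (calls f ρ k)
    calls (op o e)         ρ k = calls e ρ k
    calls (bind e f)       ρ k = calls e ρ (calls f (value e ρ ∷ ρ) k)
    calls (cond b e f)     ρ k = calls b ρ (if value b ρ then calls e ρ k else calls f ρ k)
    calls (caseList l e f) ρ k = calls l ρ (uncons (value l ρ) (calls e ρ k) (λ x xs → calls f (x ∷ xs ∷ ρ) k))
    calls (call g e)       ρ k = calls e ρ (All.lookup ns g (value e ρ) + k)

    noCalls : ∀ {Γ A} (e : Tm Φ Γ A) → callFree e ≡ true → ∀ ρ {K} → K → Calls e ρ K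
    noCalls (var x)          _  ρ k = k
    noCalls (bool b)         _  ρ k = k
    noCalls (nat m)          _  ρ k = k
    noCalls nil              _  ρ k = k
    noCalls (pair e f)       eq ρ k = noCalls e (∧-conicalˡ _ _ eq) ρ (noCalls f (∧-conicalʳ (callFree e) _ eq) ρ k)
    noCalls (op o e)         eq ρ k = noCalls e eq ρ k
    noCalls (bind e f)       eq ρ k = noCalls e (∧-conicalˡ _ _ eq) ρ (noCalls f (∧-conicalʳ (callFree e) _ eq) (value e ρ ∷ ρ) k)
    noCalls (cond b e f)     eq ρ k with eq′ ← ∧-conicalʳ (callFree b) _ eq = noCalls b (∧-conicalˡ _ _ eq) ρ (go (value b ρ))
      where
      go : ∀ b → if b then Calls e ρ _ else Calls f ρ _
      go true  = noCalls e (∧-conicalˡ _ _ eq′) ρ k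
      go false = noCalls f (∧-conicalʳ (callFree e) _ eq′) ρ k
    noCalls (caseList l e f) eq ρ k with eq′ ← ∧-conicalʳ (callFree l) _ eq = noCalls l (∧-conicalˡ _ _ eq) ρ (go (value l ρ))
      where
      go : ∀ l → uncons l (Calls e ρ _) (λ x xs → Calls f (x ∷ xs ∷ ρ) _)
      go []       = noCalls e (∧-conicalˡ _ _ eq′) ρ k
      go (x ∷ xs) = noCalls f (∧-conicalʳ (callFree e) _ eq′) (x ∷ xs ∷ ρ) k

    noCalls-count : ∀ {Γ A} (e : Tm Φ Γ A) → callFree e ≡ true → ∀ ρ k → calls e ρ k ≡ k
    noCalls-count (var x)          _  ρ k = refl
    noCalls-count (bool b)         _  ρ k = refl
    noCalls-count (nat m)          _  ρ k = refl
    noCalls-count nil              _  ρ k = refl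
    noCalls-count (pair e f)       eq ρ k = trans (noCalls-count e (∧-conicalˡ _ _ eq) ρ _) (noCalls-count f (∧-conicalʳ (callFree e) _ eq) ρ k)
    noCalls-count (op o e)         eq ρ k = noCalls-count e eq ρ k
    noCalls-count (bind e f)       eq ρ k = trans (noCalls-count e (∧-conicalˡ _ _ eq) ρ _) (noCalls-count f (∧-conicalʳ (callFree e) _ eq) _ k)
    noCalls-count (cond b e f)     eq ρ k with eq′ ← ∧-conicalʳ (callFree b) _ eq =
      trans (noCalls-count b (∧-conicalˡ _ _ eq) ρ _) (go (value b ρ))
      where
      go : ∀ b → (if b then calls e ρ k else calls f ρ k) ≡ k
      go true  = noCalls-count e (∧-conicalˡ _ _ eq′) ρ k
      go false = noCalls-count f (∧-conicalʳ (callFree e) _ eq′) ρ k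
    noCalls-count (caseList l e f) eq ρ k with eq′ ← ∧-conicalʳ (callFree l) _ eq =
      trans (noCalls-count l (∧-conicalˡ _ _ eq) ρ _) (go (value l ρ))
      where
      go : ∀ l → uncons l (calls e ρ k) (λ x xs → calls f (x ∷ xs ∷ ρ) k) ≡ k
      go []       = noCalls-count e (∧-conicalˡ _ _ eq′) ρ k
      go (x ∷ xs) = noCalls-count f (∧-conicalʳ (callFree e) _ eq′) (x ∷ xs ∷ ρ) k

    -- As `calls` adds to an accumulator, the bound is stated for every start value `k`. Each
    -- counted call is paid with `S` steps.
    Bounded : ∀ {Γ A} → Tm Φ Γ A → All ⟦_⟧ Γ → Set
    Bounded e ρ = Σ[ c ∈ ℕ ] ((bodies , ρ ⊢ e ⇓ value e ρ ⟨ c ⟩) × (∀ k → c + S * k ≤ nodes e + S * calls e ρ k))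

    private
      -- c steps suffice for a term with a nodes, apart from the calls counted by g.
      Within : ℕ → ℕ → (ℕ → ℕ) → Set
      Within c a g = ∀ k → c + S * k ≤ a + S * g k

      both : ∀ {c d} a b g h → Within c a g → Within d b h → Within (suc (c + d)) (suc (a + b)) (λ k → g (h k))
      both {c} {d} a b g h c≤ d≤ k = s≤s (begin
        c + d + S * k           ≡⟨ ℕ.+-assoc c d (S * k) ⟩
        c + (d + S * k)         ≤⟨ ℕ.+-monoʳ-≤ c (d≤ k) ⟩
        c + (b + S * h k)       ≡⟨ rotate c b (S * h k) ⟩
        c + S * h k + b         ≤⟨ ℕ.+-monoˡ-≤ b (c≤ (h k)) ⟩
        a + S * g (h k) + b     ≡⟨ swap a b (S * g (h k)) ⟩
        a + b + S * g (h k)     ∎)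
        where
        open ℕ.≤-Reasoning
        rotate : ∀ c b x → c + (b + x) ≡ c + x + b
        rotate = solve-∀
        swap : ∀ a b z → a + z + b ≡ a + b + z
        swap = solve-∀

      left : ∀ {c} a b g → Within c a g → Within c (a + b) g
      left a b g c≤ k = ℕ.≤-trans (c≤ k) (ℕ.+-monoˡ-≤ (S * g k) (ℕ.m≤m+n a b))

      right : ∀ {c} a b g → Within c b g → Within c (a + b) g
      right a b g c≤ k = ℕ.≤-trans (c≤ k) (ℕ.+-monoˡ-≤ (S * g k) (ℕ.m≤n+m b a))

    -- The nodes of the term pay for its own steps and `S` times the counted calls for those of the
    -- callees. Returning `K` passes the remaining obligations on to the next subterm.
    evaluate : ∀ {Γ A} (e : Tm Φ Γ A) (ρ : All ⟦_⟧ Γ) {K} → Calls e ρ K → Bounded e ρ × K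
    evaluate (var x)    ρ k = (1 , ⇓var , λ _ → ℕ.≤-refl) , k
    evaluate (bool b)   ρ k = (1 , ⇓bool , λ _ → ℕ.≤-refl) , k
    evaluate (nat m)    ρ k = (1 , ⇓nat , λ _ → ℕ.≤-refl) , k
    evaluate nil        ρ k = (1 , ⇓nil , λ _ → ℕ.≤-refl) , k
    evaluate (pair e f) ρ k with (c , ⇓e , c≤) , k₁ ← evaluate e ρ k with (d , ⇓f , d≤) , k₂ ← evaluate f ρ k₁ =
      (suc (c + d) , ⇓pair ⇓e ⇓f , both (nodes e) (nodes f) (calls e ρ) (calls f ρ) c≤ d≤) , k₂
    evaluate (op o e)   ρ k with (c , ⇓e , c≤) , k₁ ← evaluate e ρ k = (suc c , ⇓op ⇓e , λ k → s≤s (c≤ k)) , k₁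
    evaluate (bind e f) ρ k with (c , ⇓e , c≤) , k₁ ← evaluate e ρ k with (d , ⇓f , d≤) , k₂ ← evaluate f (value e ρ ∷ ρ) k₁ =
      (suc (c + d) , ⇓bind ⇓e ⇓f , both (nodes e) (nodes f) (calls e ρ) (calls f (value e ρ ∷ ρ)) c≤ d≤) , k₂
    evaluate (cond b e f) ρ k with (c , ⇓b , c≤) , k₁ ← evaluate b ρ k with value b ρ
    ... | true  with (d , ⇓e , d≤) , k₂ ← evaluate e ρ k₁ =
      (suc (c + d) , ⇓true ⇓b ⇓e ,
       both (nodes b) (nodes e + nodes f) (calls b ρ) (calls e ρ) c≤ (left (nodes e) (nodes f) (calls e ρ) d≤)) , k₂
    ... | false with (d , ⇓f , d≤) , k₂ ← evaluate f ρ k₁ =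
      (suc (c + d) , ⇓false ⇓b ⇓f ,
       both (nodes b) (nodes e + nodes f) (calls b ρ) (calls f ρ) c≤ (right (nodes e) (nodes f) (calls f ρ) d≤)) , k₂
    evaluate (caseList l e f) ρ k with (c , ⇓l , c≤) , k₁ ← evaluate l ρ k with value l ρ
    ... | []     with (d , ⇓e , d≤) , k₂ ← evaluate e ρ k₁ =
      (suc (c + d) , ⇓empty ⇓l ⇓e ,
       both (nodes l) (nodes e + nodes f) (calls l ρ) (calls e ρ) c≤ (left (nodes e) (nodes f) (calls e ρ) d≤)) , k₂
    ... | x ∷ xs with (d , ⇓f , d≤) , k₂ ← evaluate f (x ∷ xs ∷ ρ) k₁ =
      (suc (c + d) , ⇓uncons ⇓l ⇓f ,
       both (nodes l) (nodes e + nodes f) (calls l ρ) (calls f (x ∷ xs ∷ ρ)) c≤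
         (right (nodes e) (nodes f) (calls f (x ∷ xs ∷ ρ)) d≤)) , k₂
    evaluate (call g e) ρ k with (c , ⇓e , c≤) , (evaluation {d} ⇓g d≤ , k₁) ← evaluate e ρ k =
      (suc (c + d) , ⇓call ⇓e ⇓g , λ k → s≤s (ℕ.≤-trans (ℕ.≤-reflexive (ℕ.+-assoc c d (S * k)))
        (ℕ.≤-trans (ℕ.+-monoʳ-≤ c (ℕ.≤-trans (ℕ.+-monoˡ-≤ (S * k) d≤)
          (ℕ.≤-reflexive (sym (ℕ.*-distribˡ-+ S (All.lookup ns g (value e ρ)) k)))))
          (c≤ (All.lookup ns g (value e ρ) + k))))) , k₁

    -- The number of calls is passed as a separate argument to keep the elaborated proofs small.
    runs : ∀ {Γ A} (e : Tm Φ Γ A) (ρ : All ⟦_⟧ Γ) (v : ⟦ A ⟧) → nodes e ≤ S → Calls e ρ ⊤ → value e ρ ≡ v →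
      ∀ count → calls e ρ 0 ≡ count → Σ[ c ∈ ℕ ] ((bodies , ρ ⊢ e ⇓ v ⟨ c ⟩) × c ≤ S * suc count)
    runs e ρ _ nodes≤S cs refl _ refl with (c , ⇓e , c≤) , _ ← evaluate e ρ cs =
      c , ⇓e , ℕ.≤-trans (ℕ.≤-trans (ℕ.m≤m+n c (S * 0)) (c≤ 0))
        (ℕ.≤-trans (ℕ.+-monoˡ-≤ (S * calls e ρ 0) nodes≤S) (ℕ.≤-reflexive (sym (ℕ.*-suc S _))))

    -- The `suc` in the last hypothesis is the call of `g` itself, which pays for the at most `S`
    -- nodes of its body.
    evaluates : ∀ {A B} (g : (A , B) ∈ Φ) (u : ⟦ A ⟧) → nodes (All.lookup bodies g) ≤ S →
      Calls (All.lookup bodies g) (u ∷ []) ⊤ →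
      value (All.lookup bodies g) (u ∷ []) ≡ All.lookup fs g u →
      ∀ count → calls (All.lookup bodies g) (u ∷ []) 0 ≡ count →
      suc count ≤ All.lookup ns g u → Evaluates g u
    evaluates g u nodes≤S cs value≡ count calls≡ calls<
      with c , ⇓g , c≤ ← runs (All.lookup bodies g) (u ∷ []) (All.lookup fs g u) nodes≤S cs value≡ count calls≡ =
      evaluation ⇓g (ℕ.≤-trans c≤ (ℕ.*-monoʳ-≤ S calls<))

-- The program.

module Program where

  -- This is `StateTy` written out, because that name belongs to a module over a field and the
  -- program does not mention one.
  RawStateTy : Ty
  RawStateTy = nat ⊗ nat ⊗ list bool
  -- class, key, acceptance probability, value
  ApplicantTy MaskTy CandidateTy EntryTy : Ty
  ApplicantTy = nat ⊗ num ⊗ num ⊗ num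
  MaskTy      = list bool
  -- key, index, acceptance probability, value, and the mask without the candidate
  CandidateTy = num ⊗ nat ⊗ num ⊗ num ⊗ MaskTy
  EntryTy     = (RawStateTy ⊗ nat) ⊗ num

  Φ : Signature
  Φ = (num ⊗ nat , nat)
    ∷ (nat ⊗ nat ⊗ nat , nat)
    ∷ (nat ⊗ nat , nat)
    ∷ (num ⊗ nat , nat ⊗ num)
    ∷ (nat ⊗ num ⊗ num , list num)
    ∷ (list num ⊗ nat ⊗ num ⊗ num , ApplicantTy)
    ∷ (list num ⊗ list num ⊗ list num , list ApplicantTy)
    ∷ (nat ⊗ MaskTy ⊗ list ApplicantTy , list CandidateTy)
    ∷ (nat ⊗ nat ⊗ list ApplicantTy ⊗ MaskTy ⊗ list MaskTy , list MaskTy)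
    ∷ (nat ⊗ nat ⊗ list ApplicantTy ⊗ list MaskTy , list MaskTy)
    ∷ (list ApplicantTy , MaskTy)
    ∷ (nat ⊗ nat ⊗ list ApplicantTy , list MaskTy)
    ∷ (list ApplicantTy ⊗ MaskTy ⊗ MaskTy , nat)
    ∷ (list EntryTy ⊗ list ApplicantTy ⊗ RawStateTy , num)
    ∷ (nat ⊗ list EntryTy ⊗ list ApplicantTy ⊗ RawStateTy , list (nat ⊗ num))
    ∷ (nat ⊗ (nat ⊗ list EntryTy ⊗ list ApplicantTy ⊗ RawStateTy) ⊗ list EntryTy , list EntryTy)
    ∷ (list MaskTy ⊗ nat ⊗ nat ⊗ list EntryTy ⊗ list ApplicantTy ⊗ nat ⊗ nat , list EntryTy)
    ∷ (nat ⊗ nat ⊗ list MaskTy ⊗ nat ⊗ nat ⊗ list ApplicantTy ⊗ nat , list EntryTy)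
    ∷ (list EntryTy , list (RawStateTy ⊗ nat))
    ∷ (nat ⊗ nat ⊗ list ApplicantTy ⊗ nat , list (RawStateTy ⊗ nat))
    ∷ ((nat ⊗ num) ⊗ num ⊗ nat ⊗ list num ⊗ list num ⊗ nat ⊗ nat , list (RawStateTy ⊗ nat))
    ∷ []

  pattern #0 = here refl
  pattern #1 = there #0
  pattern #2 = there #1
  pattern #3 = there #2
  pattern #4 = there #3
  pattern #5 = there #4
  pattern #6 = there #5
  pattern #7 = there #6
  pattern #8 = there #7
  pattern #9 = there #8
  pattern #10 = there #9
  pattern #11 = there #10
  pattern #12 = there #11
  pattern #13 = there #12
  pattern #14 = there #13
  pattern #15 = there #14
  pattern #16 = there #15
  pattern #17 = there #16
  pattern #18 = there #17
  pattern #19 = there #18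
  pattern #20 = there #19

  pattern searchᶠ     = #0
  pattern logᶠ        = #1
  pattern timesᶠ      = #2
  pattern gridᶠ       = #3
  pattern powersᶠ     = #4
  pattern classifyᶠ   = #5
  pattern applicantsᶠ = #6
  pattern bestᶠ       = #7
  pattern chainᶠ      = #8
  pattern chainsᶠ     = #9
  pattern fullᶠ       = #10
  pattern masksᶠ      = #11
  pattern distanceᶠ   = #12
  pattern findᶠ       = #13
  pattern optionᶠ     = #14
  pattern rowᶠ        = #15
  pattern rowsᶠ       = #16
  pattern tableᶠ      = #17
  pattern stripᶠ      = #18
  pattern finishᶠ     = #19
  pattern solveᶠ      = #20

  private
    variable
      Γ : List Ty
      A B C D E F G : Ty

  v0 : Tm Φ (A ∷ Γ) A
  v0 = var #0
  v1 : Tm Φ (A ∷ B ∷ Γ) B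
  v1 = var #1
  v2 : Tm Φ (A ∷ B ∷ C ∷ Γ) C
  v2 = var #2
  v3 : Tm Φ (A ∷ B ∷ C ∷ D ∷ Γ) D
  v3 = var #3
  v4 : Tm Φ (A ∷ B ∷ C ∷ D ∷ E ∷ Γ) E
  v4 = var #4
  v5 : Tm Φ (A ∷ B ∷ C ∷ D ∷ E ∷ F ∷ Γ) F
  v5 = var #5
  v6 : Tm Φ (A ∷ B ∷ C ∷ D ∷ E ∷ F ∷ G ∷ Γ) G
  v6 = var #6

  infixr 4 _,ₜ_
  _,ₜ_ : Tm Φ Γ A → Tm Φ Γ B → Tm Φ Γ (A ⊗ B)
  _,ₜ_ = pair

  1st : Tm Φ Γ (A ⊗ B) → Tm Φ Γ A
  1st e = op fst e
  after1 : Tm Φ Γ (A ⊗ B) → Tm Φ Γ B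
  after1 e = op snd e
  2nd : Tm Φ Γ (A ⊗ B ⊗ C) → Tm Φ Γ B
  2nd e = op fst (op snd e)
  after2 : Tm Φ Γ (A ⊗ B ⊗ C) → Tm Φ Γ C
  after2 e = op snd (op snd e)
  3rd : Tm Φ Γ (A ⊗ B ⊗ C ⊗ D) → Tm Φ Γ C
  3rd e = op fst (after2 e)
  after3 : Tm Φ Γ (A ⊗ B ⊗ C ⊗ D) → Tm Φ Γ D
  after3 e = op snd (after2 e)
  4th : Tm Φ Γ (A ⊗ B ⊗ C ⊗ D ⊗ E) → Tm Φ Γ D
  4th e = op fst (after3 e)
  after4 : Tm Φ Γ (A ⊗ B ⊗ C ⊗ D ⊗ E) → Tm Φ Γ E
  after4 e = op snd (after3 e)
  5th : Tm Φ Γ (A ⊗ B ⊗ C ⊗ D ⊗ E ⊗ F) → Tm Φ Γ E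
  5th e = op fst (after4 e)
  after5 : Tm Φ Γ (A ⊗ B ⊗ C ⊗ D ⊗ E ⊗ F) → Tm Φ Γ F
  after5 e = op snd (after4 e)
  6th : Tm Φ Γ (A ⊗ B ⊗ C ⊗ D ⊗ E ⊗ F ⊗ G) → Tm Φ Γ F
  6th e = op fst (after5 e)
  after6 : Tm Φ Γ (A ⊗ B ⊗ C ⊗ D ⊗ E ⊗ F ⊗ G) → Tm Φ Γ G
  after6 e = op snd (after5 e)

  infixl 6 _+ₙ_ _∸ₙ_ _+ₓ_ _-ₓ_
  infixl 7 _*ₓ_ _÷ₓ_
  infix 5 _≤ₙ_ _≤ₓ_
  infixr 5 _∷ₜ_
  _+ₙ_ _∸ₙ_ : Tm Φ Γ nat → Tm Φ Γ nat → Tm Φ Γ nat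
  e +ₙ f = op addℕ (e ,ₜ f)
  e ∸ₙ f = op subℕ (e ,ₜ f)
  _≤ₙ_ : Tm Φ Γ nat → Tm Φ Γ nat → Tm Φ Γ bool
  e ≤ₙ f = op leqℕ (e ,ₜ f)
  _+ₓ_ _-ₓ_ _*ₓ_ _÷ₓ_ : Tm Φ Γ num → Tm Φ Γ num → Tm Φ Γ num
  e +ₓ f = op addF (e ,ₜ f)
  e -ₓ f = op subF (e ,ₜ f)
  e *ₓ f = op mulF (e ,ₜ f)
  e ÷ₓ f = op divF (e ,ₜ f)
  _≤ₓ_ : Tm Φ Γ num → Tm Φ Γ num → Tm Φ Γ bool
  e ≤ₓ f = op leqF (e ,ₜ f)
  _∷ₜ_ : Tm Φ Γ A → Tm Φ Γ (list A) → Tm Φ Γ (list A)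
  e ∷ₜ f = op cons (e ,ₜ f)
  num′ : ℕ → Tm Φ Γ num
  num′ m = op cast (nat m)

  -- (ε , j): the least N ≥ j with 1 ≤ ε N
  searchᵇ : Body Φ (num ⊗ nat , nat)
  searchᵇ = cond (num′ 1 ≤ₓ 1st v0 *ₓ op cast (after1 v0)) (after1 v0)
    (call searchᶠ (1st v0 ,ₜ nat 1 +ₙ after1 v0))

  -- (fuel , d , T): the number of doublings that d admits below T
  logᵇ : Body Φ (nat ⊗ nat ⊗ nat , nat)
  logᵇ = cond (1st v0 ≤ₙ nat 0) (nat 0)
    (cond (2nd v0 +ₙ 2nd v0 ≤ₙ after2 v0)
      (nat 1 +ₙ call logᶠ (1st v0 ∸ₙ nat 1 ,ₜ 2nd v0 +ₙ 2nd v0 ,ₜ after2 v0))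
      (nat 0))

  -- Multiplication of naturals is not a primitive operation, hence repeated addition, whose calls
  -- are part of the cost.
  timesᵇ : Body Φ (nat ⊗ nat , nat)
  timesᵇ = cond (1st v0 ≤ₙ nat 0) (nat 0)
    (after1 v0 +ₙ call timesᶠ (1st v0 ∸ₙ nat 1 ,ₜ after1 v0))

  -- (ε , T): the number of thresholds and their common ratio
  gridᵇ : Body Φ (num ⊗ nat , nat ⊗ num)
  gridᵇ = cond (after1 v0 ≤ₙ nat 1) (nat 0 ,ₜ num′ 1)
    (cond (num′ 1 ≤ₓ 1st v0) (nat 0 ,ₜ num′ 1)
      (bind (call searchᶠ (1st v0 ,ₜ nat 1))
        (bind (v0 +ₙ v0)
          -- Here N ≥ 1/ε and M = 2N, so s = M / (M + 1) has 1 - s ≤ ε/2, and its M-th power is at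
          -- most 1/2. With L the binary logarithm of T, M (L + 2 + N) thresholds bring the last one
          -- to at most ε / (2T).
          (call timesᶠ (v0 ,ₜ (call logᶠ (after1 v2 ,ₜ nat 1 ,ₜ after1 v2) +ₙ (nat 2 +ₙ v1)))
           ,ₜ op cast v0 ÷ₓ op cast (nat 1 +ₙ v0)))))

  -- (m , q , s): the list q s , q s² , … , q sᵐ
  powersᵇ : Body Φ (nat ⊗ num ⊗ num , list num)
  powersᵇ = cond (1st v0 ≤ₙ nat 0) nil
    (bind (2nd v0 *ₓ after2 v0) (v0 ∷ₜ call powersᶠ (1st v1 ∸ₙ nat 1 ,ₜ v0 ,ₜ after2 v1)))

  -- (thresholds , class of the first threshold , p , v)
  classifyᵇ : Body Φ (list num ⊗ nat ⊗ num ⊗ num , ApplicantTy)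
  classifyᵇ = caseList (1st v0) (2nd v0 ,ₜ 3rd v0 *ₓ after3 v0 ,ₜ after2 v0)
    (cond (v0 ≤ₓ 3rd v2) (2nd v2 ,ₜ after3 v2 ,ₜ after2 v2)
      (call classifyᶠ (v1 ,ₜ nat 1 +ₙ 2nd v2 ,ₜ after2 v2)))

  -- (thresholds , V , P)
  applicantsᵇ : Body Φ (list num ⊗ list num ⊗ list num , list ApplicantTy)
  applicantsᵇ = caseList (2nd v0) nil (caseList (after2 v2) nil
    (call classifyᶠ (1st v4 ,ₜ nat 0 ,ₜ v0 ,ₜ v2) ∷ₜ call applicantsᶠ (1st v4 ,ₜ v3 ,ₜ v1)))

  -- The call-free rest of `bestᵇ`, split off so that `callFree` settles its many branches at once;
  -- `optionᵗ` serves `optionᵇ` in the same way.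
  bestᵗ : Tm Φ (list CandidateTy ∷ bool ∷ MaskTy ∷ ApplicantTy ∷ list ApplicantTy ∷ (nat ⊗ MaskTy ⊗ list ApplicantTy) ∷ [])
               (list CandidateTy)
  bestᵗ =
    bind (caseList v0 nil ((1st v0 ,ₜ nat 1 +ₙ 2nd v0 ,ₜ 3rd v0 ,ₜ 4th v0 ,ₜ v3 ∷ₜ after4 v0) ∷ₜ nil))
      (bind ((2nd v4 ,ₜ nat 0 ,ₜ 3rd v4 ,ₜ after3 v4 ,ₜ bool false ∷ₜ v3) ∷ₜ nil)
        (cond v3
          -- Naturals can only be compared by ≤, so equality is tested by the vanishing of both
          -- truncated differences.
          (cond ((1st v5 ∸ₙ 1st (var #7)) +ₙ (1st (var #7) ∸ₙ 1st v5) ≤ₙ nat 0)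
            (caseList v2 v0 (cond (1st v0 ≤ₓ 2nd (var #7)) v2 v3))
            v1)
          v1))

  -- (class , mask , applicants): the available applicant of the class with the greatest key, if any
  bestᵇ : Body Φ (nat ⊗ MaskTy ⊗ list ApplicantTy , list CandidateTy)
  bestᵇ = caseList (after2 v0) nil (caseList (2nd v2) nil (bind (call bestᶠ (1st v4 ,ₜ v1 ,ₜ v3)) bestᵗ))

  -- (c , class , applicants , mask , masks): the masks obtained by removing the best candidate of
  -- the class 0 , … , c times, followed by the given masks
  chainᵇ : Body Φ (nat ⊗ nat ⊗ list ApplicantTy ⊗ MaskTy ⊗ list MaskTy , list MaskTy)
  chainᵇ = 4th v0 ∷ₜ cond (1st v0 ≤ₙ nat 0) (after4 v0)
    (call chainᶠ (1st v0 ∸ₙ nat 1 ,ₜ 2nd v0 ,ₜ 3rd v0 ,ₜ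
      caseList (call bestᶠ (2nd v0 ,ₜ 4th v0 ,ₜ 3rd v0)) (4th v0) (after4 v0) ,ₜ after4 v0))

  chainsᵇ : Body Φ (nat ⊗ nat ⊗ list ApplicantTy ⊗ list MaskTy , list MaskTy)
  chainsᵇ = caseList (after3 v0) nil
    (call chainᶠ (1st v2 ,ₜ 2nd v2 ,ₜ 3rd v2 ,ₜ v0 ,ₜ call chainsᶠ (1st v2 ,ₜ 2nd v2 ,ₜ 3rd v2 ,ₜ v1)))

  fullᵇ : Body Φ (list ApplicantTy , MaskTy)
  fullᵇ = caseList v0 nil (bool true ∷ₜ call fullᶠ v1)

  -- (number of classes , bound on the removals per class , applicants)
  masksᵇ : Body Φ (nat ⊗ nat ⊗ list ApplicantTy , list MaskTy)
  masksᵇ = cond (1st v0 ≤ₙ nat 0) (call fullᶠ (after2 v0) ∷ₜ nil)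
    (call chainsᶠ (2nd v0 ,ₜ 1st v0 ∸ₙ nat 1 ,ₜ after2 v0 ,ₜ call masksᶠ (1st v0 ∸ₙ nat 1 ,ₜ after1 v0)))

  -- The list of applicants only supplies the common length of the masks.
  distanceᵇ : Body Φ (list ApplicantTy ⊗ MaskTy ⊗ MaskTy , nat)
  distanceᵇ = caseList (1st v0) (nat 0) (caseList (2nd v2) (nat 0) (caseList (after2 v4) (nat 0)
    (bind (call distanceᶠ (v5 ,ₜ v3 ,ₜ v1))
      (cond v3 (cond v1 v0 (nat 1)) (cond v1 (nat 1) v0)))))

  -- (table , applicants , state): the value stored for the state, 0 by default
  findᵇ : Body Φ (list EntryTy ⊗ list ApplicantTy ⊗ RawStateTy , num)
  findᵇ = caseList (1st v0) (num′ 0)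
    (bind (1st (1st v0))
      (bind (after2 v3)
        (cond (call distanceᶠ (2nd v4 ,ₜ after2 v1 ,ₜ after2 v0)
                +ₙ ((1st v1 ∸ₙ 1st v0) +ₙ (1st v0 ∸ₙ 1st v1))
                +ₙ ((2nd v1 ∸ₙ 2nd v0) +ₙ (2nd v0 ∸ₙ 2nd v1)) ≤ₙ nat 0)
          (after1 v2)
          (call findᶠ (v3 ,ₜ after1 v4)))))

  optionᵗ : ∀ {A B Γ} → Tm Φ (list (nat ⊗ num) ∷ num ∷ A ∷ B ∷ list (nat ⊗ num) ∷ Γ) (list (nat ⊗ num))
  optionᵗ = caseList v4 v0 (cond (after1 v0 ≤ₓ v3) v2 v6)

  -- (number of classes , table for the next stage , applicants , state)
  optionᵇ : Body Φ (nat ⊗ list EntryTy ⊗ list ApplicantTy ⊗ RawStateTy , list (nat ⊗ num))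
  optionᵇ = cond (1st v0 ≤ₙ nat 0) nil
    (bind (call optionᶠ (1st v0 ∸ₙ nat 1 ,ₜ after1 v0))
      (caseList (call bestᶠ (1st v1 ∸ₙ nat 1 ,ₜ after2 (after3 v1) ,ₜ 3rd v1)) v0
        (bind (3rd v0 *ₓ (4th v0 +ₓ call findᶠ (2nd v3 ,ₜ 3rd v3 ,ₜ
                   nat 1 +ₙ 1st (after3 v3) ,ₜ 2nd (after3 v3) ∸ₙ nat 1 ,ₜ after4 v0))
               +ₓ (num′ 1 -ₓ 3rd v0) *ₓ call findᶠ (2nd v3 ,ₜ 3rd v3 ,ₜ
                   nat 1 +ₙ 1st (after3 v3) ,ₜ 2nd (after3 v3) ,ₜ after4 v0))
          (bind ((2nd v1 ,ₜ v0) ∷ₜ nil) optionᵗ))))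

  -- (a , (number of classes , table for the next stage , applicants , state) , entries): adds the
  -- entries of the states with 0 , … , a positions fewer
  rowᵇ : Body Φ (nat ⊗ (nat ⊗ list EntryTy ⊗ list ApplicantTy ⊗ RawStateTy) ⊗ list EntryTy , list EntryTy)
  rowᵇ = bind (cond (1st v0 ≤ₙ nat 0) (after2 v0) (call rowᶠ (1st v0 ∸ₙ nat 1 ,ₜ after1 v0)))
    (bind (1st (after3 (2nd v1)) ,ₜ 2nd (after3 (2nd v1)) ∸ₙ 1st v1 ,ₜ after2 (after3 (2nd v1)))
      (cond (2nd v0 ≤ₙ nat 0) v1
        (caseList (call optionᶠ (1st (2nd v2) ,ₜ 2nd (2nd v2) ,ₜ 3rd (2nd v2) ,ₜ v0)) v1
          (((v2 ,ₜ 1st v0) ,ₜ after1 v0) ∷ₜ v3))))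

  rowsᵇ : Body Φ (list MaskTy ⊗ nat ⊗ nat ⊗ list EntryTy ⊗ list ApplicantTy ⊗ nat ⊗ nat , list EntryTy)
  rowsᵇ = caseList (1st v0) (4th v0)
    (call rowᶠ (2nd v2 ,ₜ
      (3rd v2 ,ₜ 4th v2 ,ₜ 5th v2 ,ₜ 6th v2 ,ₜ after6 v2 ,ₜ v0) ,ₜ
      call rowsᶠ (v1 ,ₜ after1 v2)))

  -- (remaining stages , stage , masks , bound on the acceptances , number of classes , applicants , k)
  tableᵇ : Body Φ (nat ⊗ nat ⊗ list MaskTy ⊗ nat ⊗ nat ⊗ list ApplicantTy ⊗ nat , list EntryTy)
  tableᵇ = cond (1st v0 ≤ₙ nat 0) nil
    (call rowsᶠ (3rd v0 ,ₜ 4th v0 ,ₜ 5th v0 ,ₜ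
      call tableᶠ (1st v0 ∸ₙ nat 1 ,ₜ nat 1 +ₙ 2nd v0 ,ₜ after2 v0) ,ₜ 6th v0 ,ₜ 2nd v0 ,ₜ after6 v0))

  stripᵇ : Body Φ (list EntryTy , list (RawStateTy ⊗ nat))
  stripᵇ = caseList v0 nil (1st v0 ∷ₜ call stripᶠ v1)

  -- (horizon , number of classes , applicants , k)
  finishᵇ : Body Φ (nat ⊗ nat ⊗ list ApplicantTy ⊗ nat , list (RawStateTy ⊗ nat))
  finishᵇ = call stripᶠ (call tableᶠ (1st v0 ,ₜ nat 1 ,ₜ call masksᶠ (2nd v0 ,ₜ 1st v0 ,ₜ 3rd v0) ,ₜ v0))

  -- ((number of thresholds , common ratio) , ε , n , V , P , k , T)
  solveᵇ : Body Φ ((nat ⊗ num) ⊗ num ⊗ nat ⊗ list num ⊗ list num ⊗ nat ⊗ nat , list (RawStateTy ⊗ nat))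
  solveᵇ = bind (call applicantsᶠ (call powersᶠ (1st (1st v0) ,ₜ num′ 1 ,ₜ after1 (1st v0)) ,ₜ 4th v0 ,ₜ 5th v0))
    (call finishᶠ (cond (after6 v1 ≤ₙ 3rd v1) (after6 v1) (3rd v1) ,ₜ nat 1 +ₙ 1st (1st v1) ,ₜ v0 ,ₜ 6th v1))

  -- (ε , n , V , P , k , T)
  mainᵇ : Body Φ (num ⊗ nat ⊗ list num ⊗ list num ⊗ nat ⊗ nat , list (RawStateTy ⊗ nat))
  mainᵇ = call solveᶠ (call gridᶠ (1st v0 ,ₜ after5 v0) ,ₜ v0)

  bodies : All (Body Φ) Φ
  bodies = searchᵇ ∷ logᵇ ∷ timesᵇ ∷ gridᵇ ∷ powersᵇ ∷ classifyᵇ ∷ applicantsᵇ ∷ bestᵇ ∷ chainᵇ ∷ chainsᵇ ∷ fullᵇ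
    ∷ masksᵇ ∷ distanceᵇ ∷ findᵇ ∷ optionᵇ ∷ rowᵇ ∷ rowsᵇ ∷ tableᵇ ∷ stripᵇ ∷ finishᵇ ∷ solveᵇ ∷ []

open Program

-- The functions computed by the program and their numbers of calls.

module ProgramSemantics (𝔽 : ArchimedeanField) where
  open OrderedField 𝔽
  open Execution 𝔽
  open Evaluation 𝔽

  Mask : Set
  Mask = ⟦ MaskTy ⟧
  Applicant : Set
  Applicant = ⟦ ApplicantTy ⟧
  Candidate : Set
  Candidate = ⟦ CandidateTy ⟧
  Entry : Set
  Entry = ⟦ EntryTy ⟧
  RawState : Set
  RawState = ⟦ RawStateTy ⟧

  search : ℕ → Carrier → ℕ → ℕ
  search zero       ε j = j
  search (suc fuel) ε j = if does (fromℕ 1 ≤? ε * fromℕ j) then j else search fuel ε (suc j)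

  -- For positive ε the test of `search` succeeds beyond an Archimedean bound of `ε ⁻¹`, so this
  -- much fuel never cuts the unbounded recursion of the program short.
  searchFrom : Carrier → ℕ → ℕ
  searchFrom ε j = search (proj₁ (archimedean (ε ⁻¹)) ℕ.∸ j) ε j

  log : ℕ → ℕ → ℕ → ℕ
  log zero       d t = 0
  log (suc fuel) d t = if does (d ℕ.+ d ℕ.≤? t) then suc (log fuel (d ℕ.+ d) t) else 0

  grid : Carrier → ℕ → ℕ × Carrier
  grid ε t = if does (t ℕ.≤? 1) then (0 , fromℕ 1) else (if does (fromℕ 1 ≤? ε) then (0 , fromℕ 1) else
    (let N = searchFrom ε 1 ; M = N ℕ.+ N in
     M ℕ.* (log t 1 t ℕ.+ (2 ℕ.+ N)) , fromℕ M * (fromℕ (suc M)) ⁻¹))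

  powers : ℕ → Carrier → Carrier → List Carrier
  powers zero    q s = []
  powers (suc m) q s = q * s ∷ powers m (q * s) s

  classify : List Carrier → ℕ → Carrier → Carrier → Applicant
  classify []       c p v = c , p * v , p , v
  classify (q ∷ qs) c p v = if does (q ≤? p) then (c , v , p , v) else classify qs (suc c) p v

  applicants : List Carrier → List Carrier → List Carrier → List Applicant
  applicants qs []       _        = []
  applicants qs (v ∷ vs) []       = []
  applicants qs (v ∷ vs) (p ∷ ps) = classify qs 0 p v ∷ applicants qs vs ps

  shift : Bool → List Candidate → List Candidate
  shift a cs = uncons cs [] λ (key , i , p , v , A) _ → (key , suc i , p , v , a ∷ A) ∷ []

  best : ℕ → List Applicant → Mask → List Candidate
  best j []                    A       = []
  best j (x ∷ xs)              []      = []
  best j ((c , y , p , v) ∷ xs) (a ∷ A) =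
    let rest = best j xs A ; own = (y , 0 , p , v , false ∷ A) ∷ [] in
    if a then (if does ((c ℕ.∸ j) ℕ.+ (j ℕ.∸ c) ℕ.≤? 0)
               then uncons rest own (λ b _ → if does (proj₁ b ≤? y) then own else shift a rest)
               else shift a rest)
         else shift a rest

  remove : ℕ → List Applicant → Mask → Mask
  remove j xs A = uncons (best j xs A) A λ c _ → proj₂ (proj₂ (proj₂ (proj₂ c)))

  chain : ℕ → ℕ → List Applicant → Mask → List Mask → List Mask
  chain zero    j xs A As = A ∷ As
  chain (suc c) j xs A As = A ∷ chain c j xs (remove j xs A) As

  chains : ℕ → ℕ → List Applicant → List Mask → List Mask
  chains c j xs []       = []
  chains c j xs (A ∷ As) = chain c j xs A (chains c j xs As)

  full : List Applicant → Mask
  full []       = []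
  full (_ ∷ xs) = true ∷ full xs

  masks : ℕ → ℕ → List Applicant → List Mask
  masks zero    c xs = full xs ∷ []
  masks (suc J) c xs = chains c J xs (masks J c xs)

  distance : List Applicant → Mask → Mask → ℕ
  distance []       A       B       = 0
  distance (_ ∷ xs) []      B       = 0
  distance (_ ∷ xs) (a ∷ A) []      = 0
  distance (_ ∷ xs) (a ∷ A) (b ∷ B) = let d = distance xs A B in
    if a then (if b then d else 1) else (if b then 1 else d)

  mismatch : List Applicant → RawState → RawState → ℕ
  mismatch xs (t , k , A) (t′ , k′ , A′) =
    distance xs A A′ ℕ.+ ((t ℕ.∸ t′) ℕ.+ (t′ ℕ.∸ t)) ℕ.+ ((k ℕ.∸ k′) ℕ.+ (k′ ℕ.∸ k))

  find : List Entry → List Applicant → RawState → Carrier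
  find []                     xs s = fromℕ 0
  find (((s′ , i) , x) ∷ tab) xs s = if does (mismatch xs s′ s ℕ.≤? 0) then x else find tab xs s

  tabulatedGain : List Entry → List Applicant → RawState → Carrier → Carrier → Mask → Carrier
  tabulatedGain tab xs (t , k , _) p v A =
    p * (v + find tab xs (suc t , k ℕ.∸ 1 , A)) + (fromℕ 1 - p) * find tab xs (suc t , k , A)

  option : ℕ → List Entry → List Applicant → RawState → List (ℕ × Carrier)
  option zero    tab xs s           = []
  option (suc J) tab xs s@(t , k , A) = let rest = option J tab xs s in
    uncons (best J xs A) rest λ (_ , i , p , v , A′) _ →
      let q = tabulatedGain tab xs s p v A′
          own = (i , q) ∷ []
      in uncons rest own λ c _ → if does (proj₂ c ≤? q) then own else rest

  enter : RawState → List (ℕ × Carrier) → List Entry → List Entry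
  enter s@(_ , k , _) opt tab = if does (k ℕ.≤? 0) then tab else uncons opt tab λ c _ → ((s , proj₁ c) , proj₂ c) ∷ tab

  row : ℕ → ℕ → List Entry → List Applicant → RawState → List Entry → List Entry
  row a J tab xs s@(t , k , A) acc = let s′ = t , k ℕ.∸ a , A in enter s′ (option J tab xs s′) (previous a)
    where
    previous : ℕ → List Entry
    previous zero    = acc
    previous (suc a) = row a J tab xs s acc

  rows : List Mask → ℕ → ℕ → List Entry → List Applicant → ℕ → ℕ → List Entry
  rows []       a J tab xs t k = tab
  rows (A ∷ As) a J tab xs t k = row a J tab xs (t , k , A) (rows As a J tab xs t k)

  table : ℕ → ℕ → List Mask → ℕ → ℕ → List Applicant → ℕ → List Entry
  table zero    t As a J xs k = []
  table (suc c) t As a J xs k = rows As a J (table c (suc t) As a J xs k) xs t k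

  strip : List Entry → List (RawState × ℕ)
  strip []        = []
  strip (e ∷ tab) = proj₁ e ∷ strip tab

  finish : ℕ → ℕ → List Applicant → ℕ → List (RawState × ℕ)
  finish h J xs k = strip (table h 1 (masks J h xs) h J xs k)

  pool : ℕ → Carrier → List Carrier → List Carrier → List Applicant
  pool m s vs ps = applicants (powers m (fromℕ 1) s) vs ps

  earliest : ℕ → ℕ → ℕ
  earliest t n = if does (t ℕ.≤? n) then t else n

  functions : All Function Φ
  functions
    = (λ (ε , j) → searchFrom ε j)
    ∷ (λ (f , d , t) → log f d t)
    ∷ (λ (a , b) → a ℕ.* b)
    ∷ (λ (ε , t) → grid ε t)
    ∷ (λ (m , q , s) → powers m q s)
    ∷ (λ (qs , c , p , v) → classify qs c p v)
    ∷ (λ (qs , vs , ps) → applicants qs vs ps)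
    ∷ (λ (j , A , xs) → best j xs A)
    ∷ (λ (c , j , xs , A , As) → chain c j xs A As)
    ∷ (λ (c , j , xs , As) → chains c j xs As)
    ∷ full
    ∷ (λ (J , c , xs) → masks J c xs)
    ∷ (λ (xs , A , B) → distance xs A B)
    ∷ (λ (tab , xs , s) → find tab xs s)
    ∷ (λ (J , tab , xs , s) → option J tab xs s)
    ∷ (λ (a , (J , tab , xs , s) , acc) → row a J tab xs s acc)
    ∷ (λ (As , a , J , tab , xs , t , k) → rows As a J tab xs t k)
    ∷ (λ (c , t , As , a , J , xs , k) → table c t As a J xs k)
    ∷ strip
    ∷ (λ (h , J , xs , k) → finish h J xs k)
    ∷ (λ ((m , s) , ε , n , vs , ps , k , t) → finish (earliest t n) (suc m) (pool m s vs ps) k)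
    ∷ []

  gridᶜ : Carrier → ℕ → ℕ
  gridᶜ ε t = suc (if does (t ℕ.≤? 1) then 0 else (if does (fromℕ 1 ≤? ε) then 0 else
    (let N = searchFrom ε 1 in suc (N ℕ.∸ 1) ℕ.+ (suc t ℕ.+ (suc (N ℕ.+ N) ℕ.+ 0)))))

  chainᶜ : ℕ → ℕ → ℕ
  chainᶜ c l = suc (c ℕ.* (2 ℕ.+ l))

  chainsᶜ : ℕ → ℕ → ℕ → ℕ
  chainsᶜ h c l = suc (h ℕ.* suc (chainᶜ c l))

  masksᶜ : ℕ → ℕ → List Applicant → ℕ
  masksᶜ zero    c xs = 2 ℕ.+ length xs
  masksᶜ (suc J) c xs = suc (masksᶜ J c xs ℕ.+ chainsᶜ (length (masks J c xs)) c (length xs))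

  findᶜ : ℕ → ℕ → ℕ
  findᶜ h l = suc (h ℕ.* (2 ℕ.+ l))

  optionᶜ : ℕ → ℕ → ℕ → ℕ
  optionᶜ J h l = suc (J ℕ.* (2 ℕ.+ (l ℕ.+ (findᶜ h l ℕ.+ findᶜ h l))))

  rowᶜ : ℕ → ℕ → ℕ → ℕ → ℕ
  rowᶜ a J h l = suc a ℕ.* suc (optionᶜ J h l)

  rowsᶜ : ℕ → ℕ → ℕ → ℕ → ℕ → ℕ
  rowsᶜ g a J h l = suc (g ℕ.* suc (rowᶜ a J h l))

  tableᶜ : ℕ → ℕ → List Mask → ℕ → ℕ → List Applicant → ℕ → ℕ
  tableᶜ zero    t As a J xs k = 1
  tableᶜ (suc c) t As a J xs k = suc (tableᶜ c (suc t) As a J xs k ℕ.+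
    rowsᶜ (length As) a J (length (table c (suc t) As a J xs k)) (length xs))

  finishᶜ : ℕ → ℕ → List Applicant → ℕ → ℕ
  finishᶜ h J xs k = suc (masksᶜ J h xs ℕ.+ (tableᶜ h 1 (masks J h xs) h J xs k ℕ.+
    suc (length (table h 1 (masks J h xs) h J xs k))))

  solveᶜ : ℕ → Carrier → ℕ → List Carrier → List Carrier → ℕ → ℕ → ℕ
  solveᶜ m s n vs ps k t = suc (suc m ℕ.+ (suc (length vs ℕ.* (2 ℕ.+ length (powers m (fromℕ 1) s))) ℕ.+
    finishᶜ (earliest t n) (suc m) (pool m s vs ps) k))

  -- The lengths of the actual lists enter these counts; they are estimated in terms of n and T only
  -- at the end.
  bounds : All Bound Φ
  bounds
    = (λ (ε , j) → suc (searchFrom ε j ℕ.∸ j))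
    ∷ (λ (f , d , t) → suc f)
    ∷ (λ (a , b) → suc a)
    ∷ (λ (ε , t) → gridᶜ ε t)
    ∷ (λ (m , q , s) → suc m)
    ∷ (λ (qs , c , p , v) → suc (length qs))
    ∷ (λ (qs , vs , ps) → suc (length vs ℕ.* (2 ℕ.+ length qs)))
    ∷ (λ (j , A , xs) → suc (length xs))
    ∷ (λ (c , j , xs , A , As) → chainᶜ c (length xs))
    ∷ (λ (c , j , xs , As) → chainsᶜ (length As) c (length xs))
    ∷ (λ xs → suc (length xs))
    ∷ (λ (J , c , xs) → masksᶜ J c xs)
    ∷ (λ (xs , A , B) → suc (length xs))
    ∷ (λ (tab , xs , s) → findᶜ (length tab) (length xs))
    ∷ (λ (J , tab , xs , s) → optionᶜ J (length tab) (length xs))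
    ∷ (λ (a , (J , tab , xs , s) , acc) → rowᶜ a J (length tab) (length xs))
    ∷ (λ (As , a , J , tab , xs , t , k) → rowsᶜ (length As) a J (length tab) (length xs))
    ∷ (λ (c , t , As , a , J , xs , k) → tableᶜ c t As a J xs k)
    ∷ (λ tab → suc (length tab))
    ∷ (λ (h , J , xs , k) → finishᶜ h J xs k)
    ∷ (λ ((m , s) , ε , n , vs , ps , k , t) → solveᶜ m s n vs ps k t)
    ∷ []

  abstract
    -- At least the size of every body, as checked by `fits`; abstract so that products with it stay
    -- folded.
    maxNodes : ℕ
    maxNodes = 200

    fits : ∀ {m} {_ : True (m ℕ.≤ᵇ 200)} → m ℕ.≤ maxNodes
    fits {m} {m≤200} = ℕ.≤ᵇ⇒≤ m 200 m≤200

  open Semantics bodies functions bounds maxNodes public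

  either : ∀ (b : Bool) {X Y : Set} → X → Y → if b then X else Y
  either true  x y = x
  either false x y = y

  onList : ∀ {X : Set} (l : List X) {Y : Set} {F : X → List X → Set} → Y → (∀ x xs → F x xs) → uncons l Y F
  onList []       y f = y
  onList (x ∷ xs) y f = f x xs

  if≤ : ∀ (b : Bool) {x y m : ℕ} → x ℕ.≤ m → y ℕ.≤ m → (if b then x else y) ℕ.≤ m
  if≤ true  x≤m y≤m = x≤m
  if≤ false x≤m y≤m = y≤m

  uncons≤ : ∀ {X : Set} (l : List X) {y m : ℕ} {f : X → List X → ℕ} → y ℕ.≤ m → (∀ x xs → f x xs ℕ.≤ m) → uncons l y f ℕ.≤ m
  uncons≤ []       y≤m f≤m = y≤m
  uncons≤ (x ∷ xs) y≤m f≤m = f≤m x xs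

  +0≤ : ∀ {m} → m ℕ.+ 0 ℕ.≤ m
  +0≤ {m} = ℕ.≤-reflexive (ℕ.+-identityʳ m)

  log-evaluates : ∀ f d t → Evaluates logᶠ (f , d , t)
  log-evaluates zero    d t = evaluates logᶠ (0 , d , t) fits tt refl 0 refl ℕ.≤-refl
  log-evaluates (suc f) d t = evaluates logᶠ (suc f , d , t) fits
    (either b {Evaluates logᶠ (f , d ℕ.+ d , t) × ⊤} {⊤} (log-evaluates f (d ℕ.+ d) t , tt) tt)
    refl (if b then suc f ℕ.+ 0 else 0) refl (s≤s (if≤ b +0≤ z≤n))
    where
    b : Bool
    b = does (d ℕ.+ d ℕ.≤? t)

  times-evaluates : ∀ a b → Evaluates timesᶠ (a , b)
  times-evaluates zero    b = evaluates timesᶠ (0 , b) fits tt refl 0 refl ℕ.≤-refl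
  times-evaluates (suc a) b = evaluates timesᶠ (suc a , b) fits (times-evaluates a b , tt)
    refl (suc a ℕ.+ 0) refl (s≤s +0≤)

  powers-evaluates : ∀ m q s → Evaluates powersᶠ (m , q , s)
  powers-evaluates zero    q s = evaluates powersᶠ (0 , q , s) fits tt refl 0 refl ℕ.≤-refl
  powers-evaluates (suc m) q s = evaluates powersᶠ (suc m , q , s) fits (powers-evaluates m (q * s) s , tt)
    refl (suc m ℕ.+ 0) refl (s≤s +0≤)

  classify-evaluates : ∀ qs c p v → Evaluates classifyᶠ (qs , c , p , v)
  classify-evaluates []       c p v = evaluates classifyᶠ ([] , c , p , v) fits tt refl 0 refl ℕ.≤-refl
  classify-evaluates (q ∷ qs) c p v = evaluates classifyᶠ (q ∷ qs , c , p , v) fits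
    (either b {⊤} {Evaluates classifyᶠ (qs , suc c , p , v) × ⊤} tt (classify-evaluates qs (suc c) p v , tt))
    refl (if b then 0 else suc (length qs) ℕ.+ 0) refl (s≤s (if≤ b z≤n +0≤))
    where
    b : Bool
    b = does (q ≤? p)

  search-≥ : ∀ f ε j → j ℕ.≤ search f ε j
  search-≥ zero    ε j = ℕ.≤-refl
  search-≥ (suc f) ε j with fromℕ 1 ≤? ε * fromℕ j
  ... | yes _ = ℕ.≤-refl
  ... | no  _ = ℕ.≤-trans (ℕ.n≤1+n j) (search-≥ f ε (suc j))

  module _ (ε : Carrier) (0<ε : 0# < ε) where
    private
      bound : ℕ
      bound = proj₁ (archimedean (ε ⁻¹))

    enough : ∀ {j} → bound ℕ.≤ j → fromℕ 1 ≤ ε * fromℕ j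
    enough {j} bound≤j = subst (_≤ ε * fromℕ j) (trans (*-inverseʳ ε (0<⇒≢0 0<ε)) (sym fromℕ-1))
      (*-monoʳ-≤ ε (<⇒≤ 0<ε) (≤-trans (proj₂ (archimedean (ε ⁻¹))) (fromℕ-mono bound≤j)))

    -- The recursion of the program without fuel. Where the fuel is used up, `enough` makes the test
    -- true and both sides are `j`.
    search-step : ∀ j → searchFrom ε j ≡ (if does (fromℕ 1 ≤? ε * fromℕ j) then j else searchFrom ε (suc j))
    search-step j with bound ℕ.∸ j in eq
    search-step j | zero with fromℕ 1 ≤? ε * fromℕ j
    ... | yes _ = refl
    ... | no ¬e = ⊥-elim (¬e (enough {j} (ℕ.m∸n≡0⇒m≤n eq)))
    search-step j | suc f = cong (λ f → if does (fromℕ 1 ≤? ε * fromℕ j) then j else search f ε (suc j)) (sym f≡)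
      where
      f≡ : bound ℕ.∸ suc j ≡ f
      f≡ = trans (sym (ℕ.pred[m∸n]≡m∸[1+n] bound j)) (cong ℕ.pred eq)

    -- The fuel serves as the measure on which the general recursion of `searchᵇ` is shown to
    -- terminate.
    search-evaluates′ : ∀ f j → f ≡ bound ℕ.∸ j → Evaluates searchᶠ (ε , j)
    search-evaluates′ f j f≡ = evaluates searchᶠ (ε , j) fits (calls′ f f≡) (sym (search-step j))
      (if does (fromℕ 1 ≤? ε * fromℕ j) then 0 else suc (searchFrom ε (suc j) ℕ.∸ suc j) ℕ.+ 0) refl count
      where
      calls′ : ∀ f → f ≡ bound ℕ.∸ j → if does (fromℕ 1 ≤? ε * fromℕ j) then ⊤ else (Evaluates searchᶠ (ε , suc j) × ⊤)
      calls′ f f≡ with fromℕ 1 ≤? ε * fromℕ j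
      calls′ f       f≡ | yes _ = tt
      calls′ zero    f≡ | no ¬e = ⊥-elim (¬e (enough {j} (ℕ.m∸n≡0⇒m≤n (sym f≡))))
      calls′ (suc f) f≡ | no  _ = search-evaluates′ f (suc j) (trans (cong ℕ.pred f≡) (ℕ.pred[m∸n]≡m∸[1+n] bound j)) , tt
      count : suc (if does (fromℕ 1 ≤? ε * fromℕ j) then 0 else suc (searchFrom ε (suc j) ℕ.∸ suc j) ℕ.+ 0) ℕ.≤ suc (searchFrom ε j ℕ.∸ j)
      count rewrite search-step j with fromℕ 1 ≤? ε * fromℕ j
      ... | yes _ = s≤s z≤n
      ... | no  _ = s≤s (ℕ.≤-trans +0≤ (ℕ.≤-reflexive (sym (ℕ.+-∸-assoc 1 (search-≥ (bound ℕ.∸ suc j) ε (suc j))))))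

    search-evaluates : ∀ j → Evaluates searchᶠ (ε , j)
    search-evaluates j = search-evaluates′ _ j refl

    grid-evaluates : ∀ t → Evaluates gridᶠ (ε , t)
    grid-evaluates t = evaluates gridᶠ (ε , t) fits
      (either (does (t ℕ.≤? 1)) {⊤} {if does (fromℕ 1 ≤? ε) then ⊤ else Refined} tt
        (either (does (fromℕ 1 ≤? ε)) {⊤} {Refined} tt
          (search-evaluates 1 , log-evaluates t 1 t , times-evaluates (N ℕ.+ N) (log t 1 t ℕ.+ (2 ℕ.+ N)) , tt)))
      refl (ℕ.pred (gridᶜ ε t)) refl ℕ.≤-refl
      where
      N : ℕ
      N = searchFrom ε 1
      Refined : Set
      Refined = Evaluates searchᶠ (ε , 1) × Evaluates logᶠ (t , 1 , t) ×
                Evaluates timesᶠ (N ℕ.+ N , log t 1 t ℕ.+ (2 ℕ.+ N)) × ⊤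

  applicants-evaluates : ∀ qs vs ps → Evaluates applicantsᶠ (qs , vs , ps)
  applicants-evaluates qs []       ps       = evaluates applicantsᶠ (qs , [] , ps) fits tt refl 0 refl ℕ.≤-refl
  applicants-evaluates qs (v ∷ vs) []       = evaluates applicantsᶠ (qs , v ∷ vs , []) fits tt refl 0 refl (s≤s z≤n)
  applicants-evaluates qs (v ∷ vs) (p ∷ ps) = evaluates applicantsᶠ (qs , v ∷ vs , p ∷ ps) fits
    (classify-evaluates qs 0 p v , applicants-evaluates qs vs ps , tt) refl
    (suc (length qs) ℕ.+ (suc (length vs ℕ.* (2 ℕ.+ length qs)) ℕ.+ 0)) refl
    (s≤s (ℕ.≤-reflexive (eq (length qs) (length vs ℕ.* (2 ℕ.+ length qs)))))
    where
    eq : ∀ a b → suc a ℕ.+ (suc b ℕ.+ 0) ≡ 2 ℕ.+ a ℕ.+ b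
    eq = solve-∀

  best-evaluates : ∀ j xs A → Evaluates bestᶠ (j , A , xs)
  best-evaluates j []       A       = evaluates bestᶠ (j , A , []) fits tt refl 0 refl ℕ.≤-refl
  best-evaluates j (x ∷ xs) []      = evaluates bestᶠ (j , [] , x ∷ xs) fits tt refl 0 refl (s≤s z≤n)
  best-evaluates j (x ∷ xs) (a ∷ A) = evaluates bestᶠ (j , a ∷ A , x ∷ xs) fits
    (best-evaluates j xs A , noCalls bestᵗ refl ρ tt) refl
    (suc (length xs) ℕ.+ calls bestᵗ ρ 0) refl
    (s≤s (ℕ.≤-trans (ℕ.+-monoʳ-≤ (suc (length xs)) (ℕ.≤-reflexive (noCalls-count bestᵗ refl ρ 0))) +0≤))
    where
    ρ : All ⟦_⟧ (list CandidateTy ∷ bool ∷ MaskTy ∷ ApplicantTy ∷ list ApplicantTy ∷ (nat ⊗ MaskTy ⊗ list ApplicantTy) ∷ [])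
    ρ = best j xs A ∷ a ∷ A ∷ x ∷ xs ∷ (j , a ∷ A , x ∷ xs) ∷ []

-- Evaluation of the dynamic program.

module ProgramRuns (𝔽 : ArchimedeanField) where
  open OrderedField 𝔽 using (Carrier; fromℕ; 0#; _<_)
  open import Data.Nat.Base using (_+_; _*_; _∸_; _≤_)
  open Execution 𝔽
  open Evaluation 𝔽
  open ProgramSemantics 𝔽

  chain-evaluates : ∀ c j xs A As → Evaluates chainᶠ (c , j , xs , A , As)
  chain-evaluates zero    j xs A As = evaluates chainᶠ (0 , j , xs , A , As) fits tt refl 0 refl ℕ.≤-refl
  chain-evaluates (suc c) j xs A As = evaluates chainᶠ (suc c , j , xs , A , As) fits
    (best-evaluates j xs A , onList (best j xs A) {Rest} {λ _ _ → Rest} rest (λ _ _ → rest)) refl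
    (suc (length xs) + uncons (best j xs A) (R + 0) (λ _ _ → R + 0)) refl count
    where
    R : ℕ
    R = chainᶜ c (length xs)
    Rest : Set
    Rest = Evaluates chainᶠ (c , j , xs , remove j xs A , As) × ⊤
    rest : Rest
    rest = chain-evaluates c j xs (remove j xs A) As , tt
    eq : ∀ a b → suc a + suc b ≡ 2 + a + b
    eq = solve-∀
    count : suc (suc (length xs) + uncons (best j xs A) (R + 0) (λ _ _ → R + 0)) ≤ chainᶜ (suc c) (length xs)
    count = s≤s (ℕ.≤-trans (ℕ.+-monoʳ-≤ (suc (length xs)) (uncons≤ (best j xs A) +0≤ (λ _ _ → +0≤)))
      (ℕ.≤-reflexive (eq (length xs) (c * (2 + length xs)))))

  chains-evaluates : ∀ c j xs As → Evaluates chainsᶠ (c , j , xs , As)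
  chains-evaluates c j xs []       = evaluates chainsᶠ (c , j , xs , []) fits tt refl 0 refl ℕ.≤-refl
  chains-evaluates c j xs (A ∷ As) = evaluates chainsᶠ (c , j , xs , A ∷ As) fits
    (chains-evaluates c j xs As , chain-evaluates c j xs A (chains c j xs As) , tt) refl
    (chainsᶜ (length As) c (length xs) + (chainᶜ c (length xs) + 0)) refl
    (s≤s (ℕ.≤-reflexive (eq (length As * suc (chainᶜ c (length xs))) (chainᶜ c (length xs)))))
    where
    eq : ∀ a b → suc a + (b + 0) ≡ suc b + a
    eq = solve-∀

  full-evaluates : ∀ xs → Evaluates fullᶠ xs
  full-evaluates []       = evaluates fullᶠ [] fits tt refl 0 refl ℕ.≤-refl
  full-evaluates (x ∷ xs) = evaluates fullᶠ (x ∷ xs) fits (full-evaluates xs , tt) refl (suc (length xs) + 0) refl (s≤s +0≤)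

  masks-evaluates : ∀ J c xs → Evaluates masksᶠ (J , c , xs)
  masks-evaluates zero    c xs = evaluates masksᶠ (0 , c , xs) fits (full-evaluates xs , tt) refl
    (suc (length xs) + 0) refl (s≤s +0≤)
  masks-evaluates (suc J) c xs = evaluates masksᶠ (suc J , c , xs) fits
    (masks-evaluates J c xs , chains-evaluates c J xs (masks J c xs) , tt) refl
    (masksᶜ J c xs + (chainsᶜ (length (masks J c xs)) c (length xs) + 0)) refl
    (s≤s (ℕ.+-monoʳ-≤ (masksᶜ J c xs) +0≤))

  distance-evaluates : ∀ xs A B → Evaluates distanceᶠ (xs , A , B)
  distance-evaluates []       A       B       = evaluates distanceᶠ ([] , A , B) fits tt refl 0 refl ℕ.≤-refl
  distance-evaluates (x ∷ xs) []      B       = evaluates distanceᶠ (x ∷ xs , [] , B) fits tt refl 0 refl (s≤s z≤n)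
  distance-evaluates (x ∷ xs) (a ∷ A) []      = evaluates distanceᶠ (x ∷ xs , a ∷ A , []) fits tt refl 0 refl (s≤s z≤n)
  distance-evaluates (x ∷ xs) (a ∷ A) (b ∷ B) = evaluates distanceᶠ (x ∷ xs , a ∷ A , b ∷ B) fits
    (distance-evaluates xs A B ,
      either a {if b then ⊤ else ⊤} {if b then ⊤ else ⊤} (either b {⊤} {⊤} tt tt) (either b {⊤} {⊤} tt tt)) refl
    (suc (length xs) + (if a then (if b then 0 else 0) else (if b then 0 else 0))) refl
    (s≤s (ℕ.≤-trans (ℕ.+-monoʳ-≤ (suc (length xs)) (if≤ a (if≤ b ℕ.≤-refl ℕ.≤-refl) (if≤ b ℕ.≤-refl ℕ.≤-refl))) +0≤))

  find-evaluates : ∀ tab xs s → Evaluates findᶠ (tab , xs , s)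
  find-evaluates []                     xs s = evaluates findᶠ ([] , xs , s) fits tt refl 0 refl ℕ.≤-refl
  find-evaluates (e@((s′ , i) , x) ∷ tab) xs s = evaluates findᶠ (e ∷ tab , xs , s) fits
    (distance-evaluates xs (proj₂ (proj₂ s′)) (proj₂ (proj₂ s)) ,
      either hit {⊤} {Evaluates findᶠ (tab , xs , s) × ⊤} tt (find-evaluates tab xs s , tt)) refl
    (suc (length xs) + (if hit then 0 else findᶜ (length tab) (length xs) + 0)) refl count
    where
    hit : Bool
    hit = does (mismatch xs s′ s ℕ.≤? 0)
    eq : ∀ a b → suc a + suc b ≡ 2 + a + b
    eq = solve-∀
    count : suc (suc (length xs) + (if hit then 0 else findᶜ (length tab) (length xs) + 0)) ≤ findᶜ (suc (length tab)) (length xs)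
    count = s≤s (ℕ.≤-trans (ℕ.+-monoʳ-≤ (suc (length xs)) (if≤ hit z≤n +0≤))
      (ℕ.≤-reflexive (eq (length xs) (length tab * (2 + length xs)))))

  option-evaluates : ∀ J tab xs s → Evaluates optionᶠ (J , tab , xs , s)
  option-evaluates zero    tab xs s = evaluates optionᶠ (0 , tab , xs , s) fits tt refl 0 refl ℕ.≤-refl
  option-evaluates (suc J) tab xs s@(t , k , A) = evaluates optionᶠ (suc J , tab , xs , s) fits
    (option-evaluates J tab xs s , best-evaluates J xs A , onList (best J xs A) {⊤} tt λ (y , i , p , v , A′) cs →
      find-evaluates tab xs (suc t , k ∸ 1 , A′) , find-evaluates tab xs (suc t , k , A′) ,
      noCalls optionᵗ refl (env (y , i , p , v , A′) cs) tt) refl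
    (O + (suc (length xs) + uncons (best J xs A) 0 λ c cs → f + (f + calls optionᵗ (env c cs) 0))) refl count
    where
    f O : ℕ
    f = findᶜ (length tab) (length xs)
    O = optionᶜ J (length tab) (length xs)
    env : Candidate → List Candidate →
          All ⟦_⟧ (list (nat ⊗ num) ∷ num ∷ CandidateTy ∷ list CandidateTy ∷ list (nat ⊗ num) ∷
                   (nat ⊗ list EntryTy ⊗ list ApplicantTy ⊗ RawStateTy) ∷ [])
    env c@(y , i , p , v , A′) cs = let q = tabulatedGain tab xs s p v A′ in
      ((i , q) ∷ []) ∷ q ∷ c ∷ cs ∷ option J tab xs s ∷ (suc J , tab , xs , s) ∷ []
    eq : ∀ o l f → suc o + (suc l + (f + (f + 0))) ≡ 2 + (l + (f + f)) + o
    eq = solve-∀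
    count : suc (O + (suc (length xs) + uncons (best J xs A) 0 λ c cs → f + (f + calls optionᵗ (env c cs) 0)))
            ≤ optionᶜ (suc J) (length tab) (length xs)
    count = s≤s (ℕ.≤-trans (ℕ.+-monoʳ-≤ O (ℕ.+-monoʳ-≤ (suc (length xs))
        (uncons≤ (best J xs A) z≤n λ c cs → ℕ.+-monoʳ-≤ f (ℕ.+-monoʳ-≤ f (ℕ.≤-reflexive (noCalls-count optionᵗ refl (env c cs) 0))))))
      (ℕ.≤-reflexive (eq (J * (2 + (length xs + (f + f)))) (length xs) f)))

  row-evaluates : ∀ a J tab xs s acc → Evaluates rowᶠ (a , (J , tab , xs , s) , acc)
  row-evaluates a J tab xs s@(t , k , A) acc = go a
    where
    S : ℕ → RawState
    S a = t , k ∸ a , A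
    O : ℕ
    O = optionᶜ J (length tab) (length xs)
    Tail : ℕ → Set
    Tail a = if does (k ∸ a ℕ.≤? 0) then ⊤ else (Evaluates optionᶠ (J , tab , xs , S a) × uncons (option J tab xs (S a)) ⊤ (λ _ _ → ⊤))
    tailᶜ : ℕ → ℕ
    tailᶜ a = if does (k ∸ a ℕ.≤? 0) then 0 else O + uncons (option J tab xs (S a)) 0 (λ _ _ → 0)
    tail : ∀ a → Tail a
    tail a = either (does (k ∸ a ℕ.≤? 0)) {⊤} {Evaluates optionᶠ (J , tab , xs , S a) × uncons (option J tab xs (S a)) ⊤ (λ _ _ → ⊤)}
      tt (option-evaluates J tab xs (S a) , onList (option J tab xs (S a)) {⊤} {λ _ _ → ⊤} tt (λ _ _ → tt))
    tail≤ : ∀ a → tailᶜ a ≤ O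
    tail≤ a = if≤ (does (k ∸ a ℕ.≤? 0)) z≤n (ℕ.≤-trans (ℕ.+-monoʳ-≤ O (uncons≤ (option J tab xs (S a)) ℕ.≤-refl (λ _ _ → ℕ.≤-refl))) +0≤)
    go : ∀ a → Evaluates rowᶠ (a , (J , tab , xs , s) , acc)
    go zero    = evaluates rowᶠ (0 , (J , tab , xs , s) , acc) fits (tail 0) refl
      (tailᶜ 0) refl (s≤s (ℕ.≤-trans (tail≤ 0) (ℕ.m≤m+n O 0)))
    go (suc a) = evaluates rowᶠ (suc a , (J , tab , xs , s) , acc) fits (go a , tail (suc a)) refl
      (rowᶜ a J (length tab) (length xs) + tailᶜ (suc a)) refl
      (s≤s (ℕ.≤-trans (ℕ.+-monoʳ-≤ (rowᶜ a J (length tab) (length xs)) (tail≤ (suc a)))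
        (ℕ.≤-reflexive (ℕ.+-comm (rowᶜ a J (length tab) (length xs)) O))))

  rows-evaluates : ∀ As a J tab xs t k → Evaluates rowsᶠ (As , a , J , tab , xs , t , k)
  rows-evaluates []       a J tab xs t k = evaluates rowsᶠ ([] , a , J , tab , xs , t , k) fits tt refl 0 refl ℕ.≤-refl
  rows-evaluates (A ∷ As) a J tab xs t k = evaluates rowsᶠ (A ∷ As , a , J , tab , xs , t , k) fits
    (rows-evaluates As a J tab xs t k , row-evaluates a J tab xs (t , k , A) (rows As a J tab xs t k) , tt) refl
    (suc (length As * suc R) + (R + 0)) refl
    (s≤s (ℕ.≤-reflexive (eq (length As * suc R) R)))
    where
    R : ℕ
    R = rowᶜ a J (length tab) (length xs)
    eq : ∀ x y → suc x + (y + 0) ≡ suc y + x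
    eq = solve-∀

  table-evaluates : ∀ c t As a J xs k → Evaluates tableᶠ (c , t , As , a , J , xs , k)
  table-evaluates zero    t As a J xs k = evaluates tableᶠ (0 , t , As , a , J , xs , k) fits tt refl 0 refl ℕ.≤-refl
  table-evaluates (suc c) t As a J xs k = evaluates tableᶠ (suc c , t , As , a , J , xs , k) fits
    (table-evaluates c (suc t) As a J xs k , rows-evaluates As a J (table c (suc t) As a J xs k) xs t k , tt) refl
    (tableᶜ c (suc t) As a J xs k + (rowsᶜ (length As) a J (length (table c (suc t) As a J xs k)) (length xs) + 0)) refl
    (s≤s (ℕ.+-monoʳ-≤ (tableᶜ c (suc t) As a J xs k) +0≤))

  strip-evaluates : ∀ tab → Evaluates stripᶠ tab
  strip-evaluates []        = evaluates stripᶠ [] fits tt refl 0 refl ℕ.≤-refl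
  strip-evaluates (e ∷ tab) = evaluates stripᶠ (e ∷ tab) fits (strip-evaluates tab , tt) refl (suc (length tab) + 0) refl (s≤s +0≤)

  finish-evaluates : ∀ h J xs k → Evaluates finishᶠ (h , J , xs , k)
  finish-evaluates h J xs k = evaluates finishᶠ (h , J , xs , k) fits
    (masks-evaluates J h xs , table-evaluates h 1 (masks J h xs) h J xs k , strip-evaluates tab , tt) refl
    (masksᶜ J h xs + (X + (suc (length tab) + 0))) refl
    (s≤s (ℕ.+-monoʳ-≤ (masksᶜ J h xs) (ℕ.+-monoʳ-≤ X +0≤)))
    where
    tab : List Entry
    tab = table h 1 (masks J h xs) h J xs k
    X : ℕ
    X = tableᶜ h 1 (masks J h xs) h J xs k

  solve-evaluates : ∀ m s ε n vs ps k t → Evaluates solveᶠ ((m , s) , ε , n , vs , ps , k , t)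
  solve-evaluates m s ε n vs ps k t = evaluates solveᶠ ((m , s) , ε , n , vs , ps , k , t) fits
    (powers-evaluates m (fromℕ 1) s , applicants-evaluates (powers m (fromℕ 1) s) vs ps ,
     either (does (t ℕ.≤? n)) {Finish} {Finish} final final) refl
    (suc m + (X + (if does (t ℕ.≤? n) then Y + 0 else Y + 0))) refl
    (s≤s (ℕ.+-monoʳ-≤ (suc m) (ℕ.+-monoʳ-≤ X (if≤ (does (t ℕ.≤? n)) {Y + 0} {Y + 0} +0≤ +0≤))))
    where
    X Y : ℕ
    X = suc (length vs * (2 + length (powers m (fromℕ 1) s)))
    Y = finishᶜ (earliest t n) (suc m) (pool m s vs ps) k
    Finish : Set
    Finish = Evaluates finishᶠ (earliest t n , suc m , pool m s vs ps , k) × ⊤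
    final : Finish
    final = finish-evaluates (earliest t n) (suc m) (pool m s vs ps) k , tt

  main-evaluates : ∀ ε → 0# < ε → ∀ n vs ps k t → let m , s = grid ε t in
    Σ[ c ∈ ℕ ] ((bodies , ((ε , n , vs , ps , k , t) ∷ []) ⊢ mainᵇ ⇓ finish (earliest t n) (suc m) (pool m s vs ps) k ⟨ c ⟩)
      × c ≤ maxNodes * suc (gridᶜ ε t + (solveᶜ m s n vs ps k t + 0)))
  main-evaluates ε 0<ε n vs ps k t = runs mainᵇ ((ε , n , vs , ps , k , t) ∷ []) _ fits
    (grid-evaluates ε 0<ε t , solve-evaluates (proj₁ (grid ε t)) (proj₂ (grid ε t)) ε n vs ps k t , tt) refl _ refl

-- Masks, picks and the sets of remaining applicants.

lookup-∖ : ∀ {n} (A : Subset n) {b i} → i ≢ b → lookup (A ∖ b) i ≡ lookup A i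
lookup-∖ (a ∷ A) {zero}  {zero}  i≢b = ⊥-elim (i≢b refl)
lookup-∖ (a ∷ A) {zero}  {suc i} i≢b = cong (λ B → lookup B i) (p─⊥≡p A)
lookup-∖ (a ∷ A) {suc b} {zero}  i≢b = refl
lookup-∖ (a ∷ A) {suc b} {suc i} i≢b = lookup-∖ A (λ i≡b → i≢b (cong suc i≡b))

differs : ℕ → ℕ → ℕ
differs m n = (m ℕ.∸ n) ℕ.+ (n ℕ.∸ m)

≤ᵇ0⇒≡0 : ∀ {m} → (m ℕ.≤ᵇ 0) ≡ true → m ≡ 0
≤ᵇ0⇒≡0 {zero} _ = refl

differs≡0⇒≡ : ∀ {m n} → differs m n ≡ 0 → m ≡ n
differs≡0⇒≡ {m} {n} eq = ℕ.≤-antisym (ℕ.m∸n≡0⇒m≤n (ℕ.m+n≡0⇒m≡0 (m ℕ.∸ n) eq)) (ℕ.m∸n≡0⇒m≤n (ℕ.m+n≡0⇒n≡0 (m ℕ.∸ n) eq))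

≡⇒differs≡0 : ∀ {m n} → m ≡ n → differs m n ≡ 0
≡⇒differs≡0 {m} refl = cong₂ ℕ._+_ (ℕ.n∸n≡0 m) (ℕ.n∸n≡0 m)

≡-from : ∀ {m n} → (differs m n ℕ.≤ᵇ 0) ≡ true → m ≡ n
≡-from {m} {n} eq = differs≡0⇒≡ (≤ᵇ0⇒≡0 {differs m n} eq)

≢-from : ∀ {m n} → (differs m n ℕ.≤ᵇ 0) ≡ false → m ≢ n
≢-from {m} {n} eq m≡n with () ← trans (sym eq) (cong (ℕ._≤ᵇ 0) (≡⇒differs≡0 m≡n))

module Picking (𝔽 : ArchimedeanField) where
  open OrderedField 𝔽
  open Execution 𝔽
  open Evaluation 𝔽 using (uncons)
  open ProgramSemantics 𝔽

  classOf : Applicant → ℕ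
  classOf (c , _) = c
  keyOf probOf valueOf : Applicant → Carrier
  keyOf (_ , y , _) = y
  probOf (_ , _ , p , _) = p
  valueOf (_ , _ , _ , v) = v

  prefer : ∀ {n} → Applicant → Vec Applicant n → Maybe (Fin n) → Maybe (Fin (suc n))
  prefer x xs nothing  = just zero
  prefer x xs (just i) with keyOf (lookup xs i) ≤? keyOf x
  ... | yes _ = just zero
  ... | no  _ = just (suc i)

  -- The counterpart of `best` on indices and subsets. Policy and program share it through
  -- `best≡pick`, so they agree even on ties.
  pick : ∀ {n} → Vec Applicant n → ℕ → Subset n → Maybe (Fin n)
  pick []       j []            = nothing
  pick (x ∷ xs) j (outside ∷ A) = Maybe.map suc (pick xs j A)
  pick (x ∷ xs) j (inside ∷ A)  =
    if differs (classOf x) j ℕ.≤ᵇ 0 then prefer x xs (pick xs j A) else Maybe.map suc (pick xs j A)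

  candidate : ∀ {n} → Vec Applicant n → Subset n → Fin n → Candidate
  candidate xs A i = let (_ , y , p , v) = lookup xs i in y , toℕ i , p , v , toList (A ∖ i)

  fromMaybe : {X Y : Set} → (X → Y) → Maybe X → List Y
  fromMaybe f nothing  = []
  fromMaybe f (just x) = f x ∷ []

  best≡pick : ∀ {n} j (xs : Vec Applicant n) A → best j (toList xs) (toList A) ≡ fromMaybe (candidate xs A) (pick xs j A)
  best≡pick j []       []            = refl
  best≡pick j (x ∷ xs) (outside ∷ A) rewrite best≡pick j xs A with pick xs j A
  ... | nothing = refl
  ... | just i  = refl
  best≡pick j (x ∷ xs) (inside ∷ A) rewrite best≡pick j xs A with differs (classOf x) j ℕ.≤ᵇ 0 | pick xs j A
  ... | false | nothing = refl
  ... | false | just i  = refl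
  -- Removing the first element subtracts the empty set from the tail, which has to be rewritten
  -- away.
  ... | true | nothing = cong (λ B → (keyOf x , 0 , probOf x , valueOf x , false ∷ toList B) ∷ []) (sym (p─⊥≡p A))
  ... | true | just i  with keyOf (lookup xs i) ≤? keyOf x
  ...   | yes _ = cong (λ B → (keyOf x , 0 , probOf x , valueOf x , false ∷ toList B) ∷ []) (sym (p─⊥≡p A))
  ...   | no  _ = refl

  pick-just : ∀ {n} (xs : Vec Applicant n) j A {b} → pick xs j A ≡ just b →
    b ∈ˢ A × classOf (lookup xs b) ≡ j × (∀ i → i ∈ˢ A → classOf (lookup xs i) ≡ j → keyOf (lookup xs i) ≤ keyOf (lookup xs b))
  pick-nothing : ∀ {n} (xs : Vec Applicant n) j A → pick xs j A ≡ nothing → ∀ i → i ∈ˢ A → classOf (lookup xs i) ≡ j → ⊥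
  pick-just (x ∷ xs) j (outside ∷ A) eq with pick xs j A in eq′
  pick-just (x ∷ xs) j (outside ∷ A) refl | just b with b∈A , cb , max ← pick-just xs j A eq′ =
    there b∈A , cb , λ { (suc i) (there i∈A) ci → max i i∈A ci }
  pick-just (x ∷ xs) j (inside ∷ A) eq with differs (classOf x) j ℕ.≤ᵇ 0 in x≟j | pick xs j A in eq′
  pick-just (x ∷ xs) j (inside ∷ A) refl | false | just b with b∈A , cb , max ← pick-just xs j A eq′ =
    there b∈A , cb , λ { zero _ ci → ⊥-elim (≢-from x≟j ci) ; (suc i) (there i∈A) ci → max i i∈A ci }
  pick-just (x ∷ xs) j (inside ∷ A) refl | true | nothing =
    here , ≡-from x≟j , λ { zero _ _ → ≤-refl ; (suc i) (there i∈A) ci → ⊥-elim (pick-nothing xs j A eq′ i i∈A ci) }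
  pick-just (x ∷ xs) j (inside ∷ A) eq | true | just b with keyOf (lookup xs b) ≤? keyOf x
  pick-just (x ∷ xs) j (inside ∷ A) refl | true | just b | yes b≤x with b∈A , cb , max ← pick-just xs j A eq′ =
    here , ≡-from x≟j , λ { zero _ _ → ≤-refl ; (suc i) (there i∈A) ci → ≤-trans (max i i∈A ci) b≤x }
  pick-just (x ∷ xs) j (inside ∷ A) refl | true | just b | no b≰x with b∈A , cb , max ← pick-just xs j A eq′ =
    there b∈A , cb , λ { zero _ _ → ≰⇒≥ b≰x ; (suc i) (there i∈A) ci → max i i∈A ci }
  pick-nothing (x ∷ xs) j (outside ∷ A) eq with pick xs j A in eq′
  pick-nothing (x ∷ xs) j (outside ∷ A) eq | nothing = λ { (suc i) (there i∈A) ci → pick-nothing xs j A eq′ i i∈A ci }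
  pick-nothing (x ∷ xs) j (inside ∷ A) eq with differs (classOf x) j ℕ.≤ᵇ 0 in x≟j | pick xs j A in eq′
  pick-nothing (x ∷ xs) j (inside ∷ A) eq | false | nothing = λ
    { zero _ ci → ≢-from x≟j ci ; (suc i) (there i∈A) ci → pick-nothing xs j A eq′ i i∈A ci }
  pick-nothing (x ∷ xs) j (inside ∷ A) eq | true | just b with keyOf (lookup xs b) ≤? keyOf x
  pick-nothing (x ∷ xs) j (inside ∷ A) () | true | just b | yes _
  pick-nothing (x ∷ xs) j (inside ∷ A) () | true | just b | no _

  -- A pick sees only the members of its own class. This is why removals from different classes
  -- commute.
  pick-cong : ∀ {n} (xs : Vec Applicant n) j A B → (∀ i → classOf (lookup xs i) ≡ j → lookup A i ≡ lookup B i) → pick xs j A ≡ pick xs j B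
  pick-cong []       j []      []      agree = refl
  pick-cong (x ∷ xs) j (a ∷ A) (b ∷ B) agree with pick-cong xs j A B (λ i → agree (suc i))
  pick-cong (x ∷ xs) j (outside ∷ A) (outside ∷ B) agree | eq = cong (Maybe.map suc) eq
  pick-cong (x ∷ xs) j (inside ∷ A)  (inside ∷ B)  agree | eq with differs (classOf x) j ℕ.≤ᵇ 0
  ... | true  = cong (prefer x xs) eq
  ... | false = cong (Maybe.map suc) eq
  pick-cong (x ∷ xs) j (inside ∷ A)  (outside ∷ B) agree | eq with differs (classOf x) j ℕ.≤ᵇ 0 in x≟j
  ... | true with () ← agree zero (≡-from x≟j)
  ... | false = cong (Maybe.map suc) eq
  pick-cong (x ∷ xs) j (outside ∷ A) (inside ∷ B)  agree | eq with differs (classOf x) j ℕ.≤ᵇ 0 in x≟j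
  ... | true with () ← agree zero (≡-from x≟j)
  ... | false = cong (Maybe.map suc) eq

  module _ {n} (xs : Vec Applicant n) where

    discard : ℕ → Subset n → Subset n
    discard j A with pick xs j A
    ... | nothing = A
    ... | just b  = A ∖ b

    discard-just : ∀ j A {b} → pick xs j A ≡ just b → discard j A ≡ A ∖ b
    discard-just j A eq with pick xs j A
    discard-just j A refl | just _ = refl

    remove≡discard : ∀ j A → remove j (toList xs) (toList A) ≡ toList (discard j A)
    remove≡discard j A rewrite best≡pick j xs A with pick xs j A
    ... | nothing = refl
    ... | just b  = refl

    pick-discard : ∀ {j l} A → l ≢ j → pick xs l (discard j A) ≡ pick xs l A
    pick-discard {j} {l} A l≢j with pick xs j A in eq
    ... | nothing = refl
    ... | just b  = pick-cong xs l (A ∖ b) A λ i ci≡l → lookup-∖ A λ i≡b →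
      l≢j (trans (sym ci≡l) (trans (cong (λ i → classOf (lookup xs i)) i≡b) (proj₁ (proj₂ (pick-just xs j A eq)))))

    discard-comm : ∀ {j l} A → l ≢ j → discard l (discard j A) ≡ discard j (discard l A)
    discard-comm {j} {l} A l≢j = by (pick xs j A) (pick xs l A) refl refl
      where
      discard≡ : ∀ j A m → pick xs j A ≡ m → discard j A ≡ Maybe.maybe′ (A ∖_) A m
      discard≡ j A m eq with pick xs j A
      discard≡ j A _ refl | nothing = refl
      discard≡ j A _ refl | just _  = refl
      by : ∀ x y → pick xs j A ≡ x → pick xs l A ≡ y → discard l (discard j A) ≡ discard j (discard l A)
      by x y ex ey = trans (trans (discard≡ l (discard j A) y (trans (pick-discard A l≢j) ey)) (cong (λ B → Maybe.maybe′ (B ∖_) B y) (discard≡ j A x ex)))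
        (trans (swap x y) (sym (trans (discard≡ j (discard l A) x (trans (pick-discard A (≢-sym l≢j)) ex)) (cong (λ B → Maybe.maybe′ (B ∖_) B x) (discard≡ l A y ey)))))
        where
        swap : ∀ x y → Maybe.maybe′ (Maybe.maybe′ (A ∖_) A x ∖_) (Maybe.maybe′ (A ∖_) A x) y ≡
                       Maybe.maybe′ (Maybe.maybe′ (A ∖_) A y ∖_) (Maybe.maybe′ (A ∖_) A y) x
        swap nothing  nothing  = refl
        swap nothing  (just _) = refl
        swap (just _) nothing  = refl
        swap (just b) (just d) = p─x─y≡p─y─x A b d

    discards : ℕ → ℕ → Subset n → Subset n
    discards j zero    A = A
    discards j (suc c) A = discards j c (discard j A)

    discard-discards : ∀ j c A → discard j (discards j c A) ≡ discards j (suc c) A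
    discard-discards j zero    A = refl
    discard-discards j (suc c) A = discard-discards j c (discard j A)

    discard-discards-comm : ∀ {j l} c A → l ≢ j → discard l (discards j c A) ≡ discards j c (discard l A)
    discard-discards-comm     zero    A l≢j = refl
    discard-discards-comm {j} (suc c) A l≢j = trans (discard-discards-comm c (discard j A) l≢j) (cong (discards j c) (discard-comm A l≢j))

    -- The set left after `c j` removals from each class j below the bound, performed in the order
    -- of the classes. As removals commute, every course of restricted offers leads to a set of this
    -- form.
    profile : (ℕ → ℕ) → ℕ → Subset n
    profile c zero    = ⊤ˢ
    profile c (suc J) = discards J (c J) (profile c J)

    increment : ℕ → (ℕ → ℕ) → ℕ → ℕ
    increment l c j with j ℕ.≟ l
    ... | yes _ = suc (c j)
    ... | no  _ = c j

    increment-≡ : ∀ l c → increment l c l ≡ suc (c l)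
    increment-≡ l c with l ℕ.≟ l
    ... | yes _  = refl
    ... | no l≢l = ⊥-elim (l≢l refl)

    increment-≢ : ∀ {l j} c → j ≢ l → increment l c j ≡ c j
    increment-≢ {l} {j} c j≢l with j ℕ.≟ l
    ... | yes j≡l = ⊥-elim (j≢l j≡l)
    ... | no _    = refl

    increment-≤ : ∀ l c j → increment l c j ℕ.≤ suc (c j)
    increment-≤ l c j with j ℕ.≟ l
    ... | yes _ = ℕ.≤-refl
    ... | no _  = ℕ.n≤1+n (c j)

    profile-increment-≤ : ∀ {l J} c → J ℕ.≤ l → profile (increment l c) J ≡ profile c J
    profile-increment-≤ {J = zero}  c J≤l = refl
    profile-increment-≤ {J = suc J} c J<l = cong₂ (discards J) (increment-≢ c (ℕ.<⇒≢ J<l)) (profile-increment-≤ c (ℕ.<⇒≤ J<l))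

    -- The new removal commutes past the higher classes until it joins the removals from its own
    -- class.
    discard-profile : ∀ {l J} c → l ℕ.< J → discard l (profile c J) ≡ profile (increment l c) J
    discard-profile {l} {suc J} c (s≤s l≤J) with l ℕ.≟ J
    ... | yes refl = trans (discard-discards J (c J) (profile c J))
          (cong₂ (discards J) (sym (increment-≡ J c)) (sym (profile-increment-≤ {J} {J} c ℕ.≤-refl)))
    ... | no l≢J   = trans (discard-discards-comm (c J) (profile c J) l≢J)
          (cong₂ (discards J) (sym (increment-≢ c (≢-sym l≢J))) (discard-profile c (ℕ.≤∧≢⇒< l≤J l≢J)))

    ∈-chain⁺ : ∀ c j A {As} {B} → B ∈ As → B ∈ chain c j (toList xs) A As
    ∈-chain⁺ zero    j A B∈As = there B∈As
    ∈-chain⁺ (suc c) j A B∈As = there (∈-chain⁺ c j (remove j (toList xs) A) B∈As)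

    discards∈chain : ∀ {i c} j A As → i ℕ.≤ c → toList (discards j i A) ∈ chain c j (toList xs) (toList A) As
    discards∈chain {zero}  {zero}  j A As _ = here refl
    discards∈chain {zero}  {suc c} j A As _ = here refl
    discards∈chain {suc i} {suc c} j A As (s≤s i≤c) rewrite remove≡discard j A = there (discards∈chain j (discard j A) As i≤c)

    discards∈chains : ∀ {i c} j A As → i ℕ.≤ c → toList A ∈ As → toList (discards j i A) ∈ chains c j (toList xs) As
    discards∈chains {c = c} j A (B ∷ As) i≤c (here refl)  = discards∈chain j A (chains c j (toList xs) As) i≤c
    discards∈chains {c = c} j A (B ∷ As) i≤c (there A∈As) = ∈-chain⁺ c j B (discards∈chains j A As i≤c A∈As)

    full≡⊤ : ∀ {m} (ys : Vec Applicant m) → full (toList ys) ≡ toList (⊤ˢ {m})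
    full≡⊤ []       = refl
    full≡⊤ (y ∷ ys) = cong (true ∷_) (full≡⊤ ys)

    profile∈masks : ∀ J H c → (∀ j → c j ℕ.≤ H) → toList (profile c J) ∈ masks J H (toList xs)
    profile∈masks zero    H c c≤H = here (sym (full≡⊤ xs))
    profile∈masks (suc J) H c c≤H = discards∈chains J (profile c J) (masks J H (toList xs)) (c≤H J) (profile∈masks J H c c≤H)

    IsMask : Mask → Set
    IsMask M = Σ[ A ∈ Subset n ] M ≡ toList A

    chain-masks : ∀ c j (A : Subset n) As → All IsMask As → All IsMask (chain c j (toList xs) (toList A) As)
    chain-masks zero    j A As ms = (A , refl) ∷ ms
    chain-masks (suc c) j A As ms rewrite remove≡discard j A = (A , refl) ∷ chain-masks c j (discard j A) As ms

    chains-masks : ∀ c j As → All IsMask As → All IsMask (chains c j (toList xs) As)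
    chains-masks c j []       []                 = []
    chains-masks c j (_ ∷ As) ((A , refl) ∷ ms) = chain-masks c j A (chains c j (toList xs) As) (chains-masks c j As ms)

    masks-masks : ∀ J H → All IsMask (masks J H (toList xs))
    masks-masks zero    H = (⊤ˢ , full≡⊤ xs) ∷ []
    masks-masks (suc J) H = chains-masks H J (masks J H (toList xs)) (masks-masks J H)

-- Correctness of the dynamic programming table.

module Tables (𝔽 : ArchimedeanField) (I : Hiring.Instance 𝔽)
  (xs : Vec (ProgramSemantics.Applicant 𝔽) (Hiring.Instance.n I))
  (probOf≡ : ∀ i → Picking.probOf 𝔽 (lookup xs i) ≡ lookup (Hiring.Instance.P I) i)
  (valueOf≡ : ∀ i → Picking.valueOf 𝔽 (lookup xs i) ≡ lookup (Hiring.Instance.V I) i)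
  (J : ℕ) (class< : ∀ i → Picking.classOf 𝔽 (lookup xs i) ℕ.< J) where

  open OrderedField 𝔽
  open Execution 𝔽
  open Hiring 𝔽
  open Optimum 𝔽
  open Instance I
  open State
  open Evaluation 𝔽 using (uncons)
  open ProgramSemantics 𝔽
  open Picking 𝔽
  open Policies 𝔽 I

  selection : Selection n
  selection = record
    { classes = J ; class = λ i → classOf (lookup xs i) ; key = λ i → keyOf (lookup xs i)
    ; pick = pick xs ; class< = class<
    ; pick-just = pick-just xs ; pick-nothing = pick-nothing xs }

  everyone : List Applicant
  everyone = toList xs

  candidates : List Mask
  candidates = masks J horizon everyone

  Explored′ : State n → Set
  Explored′ = Explored selection
  decide : State n → Maybe (Fin n × Carrier)
  decide = decision selection

  explored-profile : ∀ {s} → Explored′ s → Σ[ c ∈ (ℕ → ℕ) ] (available s ≡ profile xs c J × (∀ j → c j ℕ.< stage s))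
  explored-profile start = (λ _ → 0) , sym (untouched J) , λ _ → s≤s z≤n
    where
    untouched : ∀ J → profile xs (λ _ → 0) J ≡ ⊤ˢ
    untouched zero    = refl
    untouched (suc J) = untouched J
  explored-profile (offered {A = A} {j} e j<J picked _) with c , A≡ , c< ← explored-profile e =
    increment xs j c ,
    trans (sym (discard-just xs j A picked)) (trans (cong (discard xs j) A≡) (discard-profile xs c j<J)) ,
    λ l → s≤s (ℕ.≤-trans (increment-≤ xs j c l) (c< l))

  -- `a` counts acceptances. As `k` may be far larger than n and T, the table runs over `a` and not
  -- over the positions.
  explored-positions : ∀ {s} → Explored′ s → Σ[ a ∈ ℕ ] (positions s ≡ k ℕ.∸ a × a ℕ.< stage s)
  explored-positions start = 0 , refl , s≤s z≤n
  explored-positions (offered e _ _ (inj₁ refl)) with a , k≡ , a< ← explored-positions e =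
    suc a , trans (cong (ℕ._∸ 1) k≡) (trans (ℕ.∸-+-assoc k a 1) (cong (k ℕ.∸_) (ℕ.+-comm a 1))) , s≤s a<
  explored-positions (offered e _ _ (inj₂ refl)) with a , k≡ , a< ← explored-positions e = a , k≡ , ℕ.m<n⇒m<1+n a<

  explored∈candidates : ∀ {s} → Explored′ s → stage s ℕ.≤ horizon → toList (available s) ∈ candidates
  explored∈candidates e s≤h with c , A≡ , c< ← explored-profile e =
    subst (λ A → toList A ∈ candidates) (sym A≡)
      (profile∈masks xs J horizon c (λ j → ℕ.≤-trans (ℕ.<⇒≤ (c< j)) s≤h))

  distance-refl : ∀ {m} (ys : Vec Applicant m) (A : Subset m) → distance (toList ys) (toList A) (toList A) ≡ 0
  distance-refl []       []          = refl
  distance-refl (y ∷ ys) (true ∷ A)  = distance-refl ys A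
  distance-refl (y ∷ ys) (false ∷ A) = distance-refl ys A

  distance≡0 : ∀ {m} (ys : Vec Applicant m) (A B : Subset m) → distance (toList ys) (toList A) (toList B) ≡ 0 → A ≡ B
  distance≡0 []       []          []          _  = refl
  distance≡0 (y ∷ ys) (true ∷ A)  (true ∷ B)  eq = cong (true ∷_) (distance≡0 ys A B eq)
  distance≡0 (y ∷ ys) (false ∷ A) (false ∷ B) eq = cong (false ∷_) (distance≡0 ys A B eq)

  mismatch-refl : ∀ s → mismatch everyone (encodeState s) (encodeState s) ≡ 0
  mismatch-refl ⟨ t , k , A ⟩ = cong₂ ℕ._+_ (cong₂ ℕ._+_ (distance-refl xs A) (≡⇒differs≡0 {t} refl)) (≡⇒differs≡0 {k} refl)

  mismatch≡0 : ∀ s s′ → mismatch everyone (encodeState s) (encodeState s′) ≡ 0 → s ≡ s′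
  mismatch≡0 ⟨ t , k , A ⟩ ⟨ t′ , k′ , A′ ⟩ eq
    with refl ← distance≡0 xs A A′ (ℕ.m+n≡0⇒m≡0 _ (ℕ.m+n≡0⇒m≡0 _ eq))
       | refl ← differs≡0⇒≡ {t} {t′} (ℕ.m+n≡0⇒n≡0 (distance everyone (toList A) (toList A′)) (ℕ.m+n≡0⇒m≡0 _ eq))
       | refl ← differs≡0⇒≡ {k} {k′} (ℕ.m+n≡0⇒n≡0 (distance everyone (toList A) (toList A′) ℕ.+ differs t t′) eq) = refl

  -- An entry of the table agrees with the decision if its state is explored; other entries are
  -- never looked up.
  record CorrectEntry (e : Entry) : Set where
    field
      state    : State n
      encoded  : proj₁ (proj₁ e) ≡ encodeState state
      ≤horizon : stage state ℕ.≤ horizon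
      occupied : 1 ℕ.≤ positions state
      decided  : Explored′ state → Σ[ b ∈ Fin n ] (decide state ≡ just (b , proj₂ e) × proj₂ (proj₁ e) ≡ toℕ b)

  record Complete (t : ℕ) (tab : List Entry) : Set where
    field
      correct  : All CorrectEntry tab
      complete : ∀ {s b x} → Explored′ s → t ℕ.≤ stage s → stage s ℕ.≤ horizon → 1 ℕ.≤ positions s →
                 decide s ≡ just (b , x) → ((encodeState s , toℕ b) , x) ∈ tab

  -- Masks may repeat in `candidates`, and then so do states in the table. Every entry of an
  -- explored state is correct, so the first hit is as good as any.
  find-spec : ∀ {tab} → All CorrectEntry tab → ∀ s → Explored′ s →
    (Σ[ b ∈ Fin n ] Σ[ x ∈ Carrier ] (find tab everyone (encodeState s) ≡ x × decide s ≡ just (b , x) × stage s ℕ.≤ horizon × 1 ℕ.≤ positions s))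
    ⊎ (find tab everyone (encodeState s) ≡ 0# × (∀ i x → ((encodeState s , i) , x) ∈ tab → ⊥))
  find-spec [] s e = inj₂ (refl , λ _ _ ())
  find-spec {((s′ , i) , x) ∷ tab} (c ∷ cs) s e with mismatch everyone s′ (encodeState s) ℕ.≤ᵇ 0 in eq
  ... | true with refl ← mismatch≡0 (CorrectEntry.state c) s
                   (trans (cong (λ s′ → mismatch everyone s′ (encodeState s)) (sym (CorrectEntry.encoded c))) (≤ᵇ0⇒≡0 {mismatch everyone s′ (encodeState s)} eq))
             with b , dec≡ , i≡ ← CorrectEntry.decided c e =
    inj₁ (b , x , refl , dec≡ , CorrectEntry.≤horizon c , CorrectEntry.occupied c)
  find-spec {((s′ , i) , x) ∷ tab} (c ∷ cs) s e | false with find-spec cs s e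
  ... | inj₁ found      = inj₁ found
  ... | inj₂ (≡0 , none) = inj₂ (≡0 , λ where
        i x (here refl) → false≢true (trans (sym eq) (cong (ℕ._≤ᵇ 0) (mismatch-refl s)))
        i x (there ∈tab) → none i x ∈tab)
    where
    false≢true : false ≡ true → ⊥
    false≢true ()

  -- The stages left include the current one, hence `suc horizon`.
  stateValue : State n → Carrier
  stateValue s = restricted market selection (suc horizon ℕ.∸ stage s) (positions s) (available s)

  value-decided : ∀ s → stage s ℕ.≤ horizon → 1 ℕ.≤ positions s → stateValue s ≡ worth (decide s)
  value-decided ⟨ t , suc k , A ⟩ t≤h 1≤k rewrite ℕ.+-∸-assoc 1 t≤h = refl

  value-late : ∀ s → horizon ℕ.< stage s → stateValue s ≡ 0#
  value-late ⟨ t , k , A ⟩ h<t rewrite ℕ.m≤n⇒m∸n≡0 h<t = refl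

  value-full : ∀ s → positions s ℕ.≤ 0 → stateValue s ≡ 0#
  value-full ⟨ t , zero , A ⟩ _ with suc horizon ℕ.∸ t
  ... | zero  = refl
  ... | suc _ = refl

  -- The default 0 is right: an explored state is missing only past the horizon, without open
  -- positions, or without a decision, and its value is 0 in each case.
  find-value : ∀ {t tab} → Complete t tab → ∀ s → Explored′ s → t ℕ.≤ stage s → find tab everyone (encodeState s) ≡ stateValue s
  find-value {t} {tab} T s e t≤s with find-spec (Complete.correct T) s e
  ... | inj₁ (b , x , find≡ , dec≡ , s≤h , 1≤k) = trans find≡ (sym (trans (value-decided s s≤h 1≤k) (cong worth dec≡)))
  ... | inj₂ (find≡ , none) with stage s ℕ.≤? horizon | 1 ℕ.≤? positions s
  ...   | no s≰h | _      = trans find≡ (sym (value-late s (ℕ.≰⇒> s≰h)))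
  ...   | yes _  | no 1≰k = trans find≡ (sym (value-full s (ℕ.s≤s⁻¹ (ℕ.≰⇒> 1≰k))))
  ...   | yes s≤h | yes 1≤k = trans find≡ (sym (trans (value-decided s s≤h 1≤k) (undecided (decide s) refl)))
    where
    undecided : ∀ m → decide s ≡ m → worth m ≡ 0#
    undecided nothing        _    = refl
    undecided (just (b , x)) dec≡ = ⊥-elim (none (toℕ b) x (Complete.complete T e t≤s s≤h 1≤k dec≡))

  encodeChoice : Fin n × Carrier → ℕ × Carrier
  encodeChoice (b , x) = toℕ b , x

  -- The successors of every candidate are explored, chosen or not, so both lookups return true
  -- values; then `option` and `choose` proceed in step through the classes.
  option-decision : ∀ {t tab} → Complete (suc t) tab → ∀ A k → Explored′ ⟨ t , k , A ⟩ → 1 ℕ.≤ k → t ℕ.≤ horizon →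
    option J tab everyone (t , k , toList A) ≡ fromMaybe encodeChoice (decide ⟨ t , k , A ⟩)
  option-decision {t} {tab} T A (suc k) e 1≤k t≤h = go J ℕ.≤-refl
    where
    q : Fin n → Carrier
    q = proposal market selection (horizon ℕ.∸ t) k A
    successor : ∀ {s′} → Explored′ s′ → stage s′ ≡ suc t → find tab everyone (encodeState s′) ≡ stateValue s′
    successor {s′} e′ t≡ = find-value T s′ e′ (ℕ.≤-reflexive (sym t≡))
    gain≡ : ∀ j b → j ℕ.< J → pick xs j A ≡ just b →
      let (_ , _ , p , v) = lookup xs b in
      p * (v + find tab everyone (suc t , k , toList (A ∖ b))) + (fromℕ 1 - p) * find tab everyone (suc t , suc k , toList (A ∖ b)) ≡ q b
    gain≡ j b j<J picked rewrite probOf≡ b | valueOf≡ b | fromℕ-1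
      | successor (offered e j<J picked (inj₁ refl)) refl | successor (offered e j<J picked (inj₂ refl)) refl = refl
    go : ∀ j → j ℕ.≤ J → option j tab everyone (t , suc k , toList A) ≡ fromMaybe encodeChoice (choose market selection q A j)
    go zero    _   = refl
    go (suc j) j<J rewrite go j (ℕ.<⇒≤ j<J) | best≡pick j xs A with pick xs j A in picked
    ... | nothing = refl
    ... | just b  rewrite gain≡ j b j<J picked with choose market selection q A j
    ...   | nothing      = refl
    ...   | just (i , x) with x ≤? q b
    ...     | yes _ = refl
    ...     | no  _ = refl

  enter-∈ : ∀ {e} s opt {tab} → e ∈ enter s opt tab → e ∈ tab ⊎
    (1 ℕ.≤ proj₁ (proj₂ s) × Σ[ c ∈ ℕ × Carrier ] Σ[ cs ∈ _ ] (opt ≡ c ∷ cs × e ≡ ((s , proj₁ c) , proj₂ c)))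
  enter-∈ (t , zero  , A) opt      e∈          = inj₁ e∈
  enter-∈ (t , suc k , A) []       e∈          = inj₁ e∈
  enter-∈ (t , suc k , A) (c ∷ cs) (here refl) = inj₂ (s≤s z≤n , c , cs , refl , refl)
  enter-∈ (t , suc k , A) (c ∷ cs) (there e∈)  = inj₁ e∈

  enter-keeps : ∀ {e} s opt {tab} → e ∈ tab → e ∈ enter s opt tab
  enter-keeps (t , zero  , A) opt      e∈ = e∈
  enter-keeps (t , suc k , A) []       e∈ = e∈
  enter-keeps (t , suc k , A) (c ∷ cs) e∈ = there e∈

  enter-adds : ∀ s {c cs tab} → 1 ℕ.≤ proj₁ (proj₂ s) → ((s , proj₁ c) , proj₂ c) ∈ enter s (c ∷ cs) tab
  enter-adds (t , suc k , A) _ = here refl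

  module _ {t tab} (T : Complete (suc t) tab) (1≤t : 1 ℕ.≤ t) (t≤h : t ℕ.≤ horizon) where

    row-correct : ∀ a A {acc} → All CorrectEntry acc → All CorrectEntry (row a J tab everyone (t , k , toList A) acc)
    row-correct a A {acc} correct = All.tabulate (go a)
      where
      new : ∀ {e} a → 1 ℕ.≤ k ℕ.∸ a × Σ[ c ∈ ℕ × Carrier ] Σ[ cs ∈ _ ]
            (option J tab everyone (t , k ℕ.∸ a , toList A) ≡ c ∷ cs × e ≡ (((t , k ℕ.∸ a , toList A) , proj₁ c) , proj₂ c)) → CorrectEntry e
      new a (1≤k , c , cs , opt≡ , refl) = record
        { state = ⟨ t , k ℕ.∸ a , A ⟩ ; encoded = refl ; ≤horizon = t≤h ; occupied = 1≤k
        ; decided = λ e → decided (decide ⟨ t , k ℕ.∸ a , A ⟩) refl (trans (sym opt≡) (option-decision T A (k ℕ.∸ a) e 1≤k t≤h)) }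
        where
        decided : ∀ m → decide ⟨ t , k ℕ.∸ a , A ⟩ ≡ m → c ∷ cs ≡ fromMaybe encodeChoice m →
                  Σ[ b ∈ Fin n ] (decide ⟨ t , k ℕ.∸ a , A ⟩ ≡ just (b , proj₂ c) × proj₁ c ≡ toℕ b)
        decided (just (b , x)) dec≡ refl = b , dec≡ , refl
      go : ∀ a {e} → e ∈ row a J tab everyone (t , k , toList A) acc → CorrectEntry e
      go zero    e∈ with enter-∈ (t , k , toList A) (option J tab everyone (t , k , toList A)) e∈
      ... | inj₁ e∈acc = All.lookup correct e∈acc
      ... | inj₂ added = new 0 added
      go (suc a) e∈ with enter-∈ (t , k ℕ.∸ suc a , toList A) (option J tab everyone (t , k ℕ.∸ suc a , toList A)) e∈
      ... | inj₁ e∈row = go a e∈row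
      ... | inj₂ added = new (suc a) added

    row-keeps : ∀ a {M acc e} → e ∈ acc → e ∈ row a J tab everyone (t , k , M) acc
    row-keeps zero    {M} e∈ = enter-keeps (t , k , M) (option J tab everyone (t , k , M)) e∈
    row-keeps (suc a) {M} e∈ = enter-keeps (t , k ℕ.∸ suc a , M) (option J tab everyone (t , k ℕ.∸ suc a , M)) (row-keeps a e∈)

    row-adds : ∀ {a a′} A {b x acc} → a ℕ.≤ a′ → Explored′ ⟨ t , k ℕ.∸ a , A ⟩ → 1 ℕ.≤ k ℕ.∸ a →
      decide ⟨ t , k ℕ.∸ a , A ⟩ ≡ just (b , x) →
      (((t , k ℕ.∸ a , toList A) , toℕ b) , x) ∈ row a′ J tab everyone (t , k , toList A) acc
    row-adds {a} {a′} A {b} {x} {acc} a≤a′ e 1≤k dec≡ = go a′ a≤a′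
      where
      opt≡ : option J tab everyone (t , k ℕ.∸ a , toList A) ≡ (toℕ b , x) ∷ []
      opt≡ = trans (option-decision T A (k ℕ.∸ a) e 1≤k t≤h) (cong (fromMaybe encodeChoice) dec≡)
      now : ∀ {acc} → (((t , k ℕ.∸ a , toList A) , toℕ b) , x) ∈ enter (t , k ℕ.∸ a , toList A) (option J tab everyone (t , k ℕ.∸ a , toList A)) acc
      now {acc} rewrite opt≡ = enter-adds (t , k ℕ.∸ a , toList A) {toℕ b , x} {[]} {acc} 1≤k
      go : ∀ a′ → a ℕ.≤ a′ → (((t , k ℕ.∸ a , toList A) , toℕ b) , x) ∈ row a′ J tab everyone (t , k , toList A) acc
      go zero     z≤n = now
      go (suc a′) a≤a′ with a ℕ.≟ suc a′
      ... | yes refl = now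
      ... | no a≢    = enter-keeps (t , k ℕ.∸ suc a′ , toList A) (option J tab everyone (t , k ℕ.∸ suc a′ , toList A)) (go a′ (ℕ.≤-pred (ℕ.≤∧≢⇒< a≤a′ a≢)))

    rows-correct : ∀ {As} → All (IsMask xs) As → All CorrectEntry (rows As horizon J tab everyone t k)
    rows-correct []                 = Complete.correct T
    rows-correct ((A , refl) ∷ As) = row-correct horizon A (rows-correct As)

    rows-keeps : ∀ As {e} → e ∈ tab → e ∈ rows As horizon J tab everyone t k
    rows-keeps []       e∈ = e∈
    rows-keeps (A ∷ As) e∈ = row-keeps horizon (rows-keeps As e∈)

    rows-adds : ∀ {As a A b x} → toList A ∈ As → a ℕ.≤ horizon → Explored′ ⟨ t , k ℕ.∸ a , A ⟩ → 1 ℕ.≤ k ℕ.∸ a →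
      decide ⟨ t , k ℕ.∸ a , A ⟩ ≡ just (b , x) → (((t , k ℕ.∸ a , toList A) , toℕ b) , x) ∈ rows As horizon J tab everyone t k
    rows-adds {A = A} (here refl) a≤h e 1≤k dec≡ = row-adds A a≤h e 1≤k dec≡
    rows-adds (there A∈)  a≤h e 1≤k dec≡ = row-keeps horizon (rows-adds A∈ a≤h e 1≤k dec≡)

    rows-complete : Complete t (rows candidates horizon J tab everyone t k)
    rows-complete = record { correct = rows-correct (masks-masks xs J horizon) ; complete = complete }
      where
      complete : ∀ {s b x} → Explored′ s → t ℕ.≤ stage s → stage s ℕ.≤ horizon → 1 ℕ.≤ positions s →
                 decide s ≡ just (b , x) → ((encodeState s , toℕ b) , x) ∈ rows candidates horizon J tab everyone t k
      complete {s@(⟨ t′ , k′ , A ⟩)} {b} {x} e t≤s s≤h 1≤k dec≡ with t ℕ.≟ t′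
      ... | no t≢t′ = rows-keeps candidates (Complete.complete T e (ℕ.≤∧≢⇒< t≤s t≢t′) s≤h 1≤k dec≡)
      ... | yes refl with a , k≡ , a< ← explored-positions e with refl ← k≡ =
        rows-adds (explored∈candidates e s≤h) (ℕ.≤-trans (ℕ.<⇒≤ a<) s≤h) e 1≤k dec≡

  table-complete : ∀ c t → 1 ℕ.≤ t → c ℕ.+ t ≡ suc horizon → Complete t (table c t candidates horizon J everyone k)
  table-complete zero    t 1≤t t≡ = record
    { correct = [] ; complete = λ _ t≤s s≤h → ⊥-elim (ℕ.<-irrefl t≡ (s≤s (ℕ.≤-trans t≤s s≤h))) }
  table-complete (suc c) t 1≤t c+t≡ = rows-complete (table-complete c (suc t) (s≤s z≤n) (trans (ℕ.+-suc c t) c+t≡)) 1≤t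
    (ℕ.≤-trans (ℕ.m≤n+m t c) (ℕ.≤-reflexive (ℕ.suc-injective c+t≡)))

  finalTable : List Entry
  finalTable = table horizon 1 candidates horizon J everyone k

  finalTable-complete : Complete 1 finalTable
  finalTable-complete = table-complete horizon 1 ℕ.≤-refl (ℕ.+-comm horizon 1)

  strip⁺ : ∀ {tab e} → e ∈ tab → proj₁ e ∈ strip tab
  strip⁺ (here refl) = here refl
  strip⁺ (there e∈)  = there (strip⁺ e∈)

  strip⁻ : ∀ {tab y} → y ∈ strip tab → Σ[ x ∈ Carrier ] (y , x) ∈ tab
  strip⁻ {e ∷ tab} (here refl) = proj₂ e , here refl
  strip⁻ {e ∷ tab} (there y∈) with x , e∈ ← strip⁻ y∈ = x , there e∈

  encodeState-injective : ∀ s s′ → encodeState s ≡ encodeState s′ → s ≡ s′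
  encodeState-injective s s′ eq = mismatch≡0 s s′ (trans (cong (mismatch everyone (encodeState s)) (sym eq)) (mismatch-refl s))

  finalTable-describes : Describes I (strip finalTable) (restrictedPolicy selection)
  finalTable-describes = describes selection (strip finalTable)
    (λ e nt@(_ , 1≤k , _) dec≡ → strip⁺ (Complete.complete finalTable-complete e
      (Explored⇒1≤stage selection e) (Explored⇒stage≤horizon selection e nt) 1≤k dec≡))
    sound
    where
    sound : ∀ {s j} → Explored′ s → NonTerminal I s → (encodeState s , j) ∈ strip finalTable →
            Σ[ c ∈ Fin n × Carrier ] (decide s ≡ just c × j ≡ toℕ (proj₁ c))
    sound {s} e nt j∈ with x , e∈ ← strip⁻ j∈ with c ← All.lookup (Complete.correct finalTable-complete) e∈
      with refl ← encodeState-injective s (CorrectEntry.state c) (CorrectEntry.encoded c) with b , dec≡ , j≡ ← CorrectEntry.decided c e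
      = (b , x) , dec≡ , j≡

-- Thresholds, classes and the rounded market.

module Grid (𝔽 : ArchimedeanField) where
  open OrderedField 𝔽
  open Execution 𝔽
  open Optimum 𝔽
  open ProgramSemantics 𝔽 hiding (value)
  open Picking 𝔽
  open CommutativeExp (CommutativeRing.commutativeSemiring commutativeRing) using (^-distrib-*)

  -- `q` is the last threshold passed, initially 1, and `c` the next class. The upper bound of a
  -- regular class is multiplied by `s`, the form that rounding down needs. Negligible applicants
  -- are ordered by `p * v`, which is proportional to their rounded value.
  data Classified (s q : Carrier) (m c : ℕ) (p v : Carrier) : Applicant → Set where
    regular    : ∀ j → j ℕ.< m → q * s ^ suc j ≤ p → s * p ≤ q * s ^ suc j → Classified s q m c p v (c ℕ.+ j , v , p , v)
    negligible : p ≤ q * s ^ m → Classified s q m c p v (c ℕ.+ m , p * v , p , v)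

  classify-spec : ∀ {s} → 0# ≤ s → ∀ m q c {p} v → p ≤ q → Classified s q m c p v (classify (powers m q s) c p v)
  classify-spec {s} 0≤s zero q c {p} v p≤q =
    subst (λ c′ → Classified s q 0 c p v (c′ , p * v , p , v)) (ℕ.+-identityʳ c) (negligible (≤-trans p≤q (≤-reflexive (sym (*-identityʳ q)))))
  classify-spec {s} 0≤s (suc m) q c {p} v p≤q with q * s ≤? p
  ... | yes qs≤p = subst (λ c′ → Classified s q (suc m) c p v (c′ , v , p , v)) (ℕ.+-identityʳ c)
          (regular 0 (s≤s z≤n) (≤-trans (≤-reflexive (cong (q *_) (*-identityʳ s))) qs≤p)
            (≤-trans (*-monoʳ-≤ s 0≤s p≤q) (≤-reflexive (trans (*-comm s q) (cong (q *_) (sym (*-identityʳ s)))))))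
  ... | no  qs≰p = lift (classify-spec 0≤s m (q * s) (suc c) v (≰⇒≥ qs≰p))
    where
    lift : ∀ {x} → Classified s (q * s) m (suc c) p v x → Classified s q (suc m) c p v x
    lift (regular j j<m lower upper) = subst (λ c′ → Classified s q (suc m) c p v (c′ , v , p , v)) (ℕ.+-suc c j)
      (regular (suc j) (s≤s j<m) (≤-trans (≤-reflexive (sym (*-assoc q s _))) lower) (≤-trans upper (≤-reflexive (*-assoc q s _))))
    lift (negligible p≤) = subst (λ c′ → Classified s q (suc m) c p v (c′ , p * v , p , v)) (ℕ.+-suc c m)
      (negligible (≤-trans p≤ (≤-reflexive (*-assoc q s _))))

  applicants-toList : ∀ qs {n} (V P : Vec Carrier n) →
    applicants qs (toList V) (toList P) ≡ toList (Vec.zipWith (λ v p → classify qs 0 p v) V P)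
  applicants-toList qs []      []      = refl
  applicants-toList qs (v ∷ V) (p ∷ P) = cong (classify qs 0 p v ∷_) (applicants-toList qs V P)

  module RoundedMarket (I : Hiring.Instance 𝔽) (m : ℕ) (s : Carrier) (0<s : 0# < s) (s≤1 : s ≤ 1#) where
    open Policies 𝔽 I using (market)
    open Hiring.Instance I

    thresholds : List Carrier
    thresholds = powers m (fromℕ 1) s

    gradedPool : Vec Applicant n
    gradedPool = Vec.zipWith (λ v p → classify thresholds 0 p v) V P

    τ : Carrier
    τ = s ^ m
    0<τ : 0# < τ
    0<τ = ^-positive 0<s m

    classified : ∀ i → Classified s 1# m 0 (lookup P i) (lookup V i) (lookup gradedPool i)
    classified i = subst₂ (λ q x → Classified s q m 0 (lookup P i) (lookup V i) x) fromℕ-1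
      (sym (lookup-zipWith (λ v p → classify thresholds 0 p v) i V P))
      (classify-spec (<⇒≤ 0<s) m (fromℕ 1) 0 (lookup V i) (≤-trans (P≤1 i) (≤-reflexive (sym fromℕ-1))))

    probOf≡ : ∀ i → probOf (lookup gradedPool i) ≡ lookup P i
    probOf≡ i with lookup gradedPool i | classified i
    ... | _ | regular _ _ _ _ = refl
    ... | _ | negligible _    = refl

    valueOf≡ : ∀ i → valueOf (lookup gradedPool i) ≡ lookup V i
    valueOf≡ i with lookup gradedPool i | classified i
    ... | _ | regular _ _ _ _ = refl
    ... | _ | negligible _    = refl

    class< : ∀ i → classOf (lookup gradedPool i) ℕ.< suc m
    class< i with lookup gradedPool i | classified i
    ... | _ | regular _ j<m _ _ = s≤s (ℕ.<⇒≤ j<m)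
    ... | _ | negligible _      = ℕ.≤-refl

    -- Class c below m has lower threshold s^(c + 1), and the minimum sends class m to `τ`. For m =
    -- 0 everybody is in that class and is rounded up to 1.
    roundedProb : ℕ → Carrier
    roundedProb c = s ^ (suc c ℕ.⊓ m)

    roundedValue : ℕ → Carrier → Carrier
    roundedValue c y with c ℕ.<? m
    ... | yes _ = y
    ... | no  _ = y * τ ⁻¹

    0≤key : ∀ i → 0# ≤ keyOf (lookup gradedPool i)
    0≤key i with lookup gradedPool i | classified i
    ... | _ | regular _ _ _ _ = V≥0 i
    ... | _ | negligible _    = *-nonNegative (P≥0 i) (V≥0 i)

    0≤roundedValue : ∀ c {y} → 0# ≤ y → 0# ≤ roundedValue c y
    0≤roundedValue c 0≤y with c ℕ.<? m
    ... | yes _ = 0≤y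
    ... | no  _ = *-nonNegative 0≤y (0≤x⁻¹ 0<τ)

    roundedValue-mono : ∀ c {y z} → y ≤ z → roundedValue c y ≤ roundedValue c z
    roundedValue-mono c y≤z with c ℕ.<? m
    ... | yes _ = y≤z
    ... | no  _ = *-monoˡ-≤ (τ ⁻¹) (0≤x⁻¹ 0<τ) y≤z

    roundedMarket : Market n
    roundedMarket = record
      { prob    = λ i → roundedProb (classOf (lookup gradedPool i))
      ; value   = λ i → roundedValue (classOf (lookup gradedPool i)) (keyOf (lookup gradedPool i))
      ; 0≤prob  = λ i → <⇒≤ (^-positive 0<s (suc (classOf (lookup gradedPool i)) ℕ.⊓ m))
      ; prob≤1  = λ i → ^-≤1 (<⇒≤ 0<s) s≤1 (suc (classOf (lookup gradedPool i)) ℕ.⊓ m)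
      ; 0≤value = λ i → 0≤roundedValue _ (0≤key i) }

    rounding : Rounding market roundedMarket (1# - s) τ
    rounding = record
      { 0≤δ = 0≤y-x s≤1 ; 0≤τ = <⇒≤ 0<τ ; τ≤1 = ^-≤1 (<⇒≤ 0<s) s≤1 m
      ; rounded = go }
      where
      go : ∀ i → Rounded (1# - s) τ (lookup P i) (lookup V i) (roundedProb (classOf (lookup gradedPool i)))
                   (roundedValue (classOf (lookup gradedPool i)) (keyOf (lookup gradedPool i)))
      go i with lookup gradedPool i | classified i
      ... | _ | regular j j<m lower upper with j ℕ.<? m
      ...   | no j≮m = ⊥-elim (j≮m j<m)
      ...   | yes _ rewrite ℕ.m≤n⇒m⊓n≡m j<m = down (^-positive 0<s (suc j))
              (≤-trans (≤-reflexive (sym (*-identityˡ _))) lower)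
              (≤-trans (≤-reflexive (solve 2 (λ s p → (one :- (one :- s)) :* p := s :* p) refl s (lookup P i)))
                (≤-trans upper (≤-reflexive (*-identityˡ _))))
              refl
      go i | _ | negligible p≤ with m ℕ.<? m
      ...   | yes m<m = ⊥-elim (ℕ.<-irrefl refl m<m)
      ...   | no _ rewrite ℕ.m≥n⇒m⊓n≡n (ℕ.n≤1+n m) = up (≤-trans p≤ (≤-reflexive (*-identityˡ _))) refl
              (trans (solve 3 (λ t x y → t :* (x :* y) := x :* (t :* y)) refl τ (lookup P i * lookup V i) (τ ⁻¹))
                (trans (cong (lookup P i * lookup V i *_) (*-inverseʳ τ (0<⇒≢0 0<τ))) (*-identityʳ _)))

  log-≤ : ∀ f d t → d ℕ.≤ t → d ℕ.* 2 ℕ.^ log f d t ℕ.≤ t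
  log-≤ zero    d t d≤t = ℕ.≤-trans (ℕ.≤-reflexive (ℕ.*-identityʳ d)) d≤t
  log-≤ (suc f) d t d≤t with d ℕ.+ d ℕ.≤ᵇ t in eq
  ... | false = ℕ.≤-trans (ℕ.≤-reflexive (ℕ.*-identityʳ d)) d≤t
  ... | true  = ℕ.≤-trans (ℕ.≤-reflexive (double d (2 ℕ.^ log f (d ℕ.+ d) t)))
                  (log-≤ f (d ℕ.+ d) t (ℕ.≤ᵇ⇒≤ (d ℕ.+ d) t (subst True (sym eq) tt)))
    where
    double : ∀ d x → d ℕ.* (x ℕ.+ (x ℕ.+ 0)) ≡ (d ℕ.+ d) ℕ.* x
    double = solve-∀

  -- The fuel suffices because doubling raises `d` by at least one.
  log-< : ∀ f d t → 1 ℕ.≤ d → t ℕ.≤ f ℕ.+ d → t ℕ.< d ℕ.* 2 ℕ.^ suc (log f d t)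
  log-< zero    d t 1≤d t≤d = ℕ.≤-trans (s≤s t≤d) (ℕ.≤-trans (ℕ.+-monoˡ-≤ d 1≤d) (ℕ.≤-reflexive (twice d)))
    where
    twice : ∀ d → d ℕ.+ d ≡ d ℕ.* 2
    twice = solve-∀
  log-< (suc f) d t 1≤d t≤ with d ℕ.+ d ℕ.≤ᵇ t in eq
  ... | false = ℕ.≤-trans (ℕ.≰⇒> λ d+d≤t → subst True eq (ℕ.≤⇒≤ᵇ d+d≤t)) (ℕ.≤-reflexive (twice d))
    where
    twice : ∀ d → d ℕ.+ d ≡ d ℕ.* 2
    twice = solve-∀
  ... | true  = ℕ.≤-trans (log-< f (d ℕ.+ d) t (ℕ.≤-trans 1≤d (ℕ.m≤m+n d d))
                    (ℕ.≤-trans t≤ (ℕ.≤-trans (ℕ.≤-reflexive (sym (ℕ.+-suc f d))) (ℕ.+-monoʳ-≤ f (ℕ.+-monoˡ-≤ d 1≤d)))))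
                  (ℕ.≤-reflexive (double d (2 ℕ.^ suc (log f (d ℕ.+ d) t))))
    where
    double : ∀ d x → (d ℕ.+ d) ℕ.* x ≡ d ℕ.* (x ℕ.+ (x ℕ.+ 0))
    double = solve-∀

  -- The second bound expresses minimality. It keeps N within 2/ε and thereby the number of
  -- thresholds small.
  search-spec : ∀ ε → 0# < ε → ∀ f j → f ≡ proj₁ (archimedean (ε ⁻¹)) ℕ.∸ j → ε * fromℕ (j ℕ.∸ 1) ≤ 1# →
    1# ≤ ε * fromℕ (search f ε j) × ε * fromℕ (search f ε j ℕ.∸ 1) ≤ 1#
  search-spec ε 0<ε zero    j f≡ low = subst (_≤ ε * fromℕ j) fromℕ-1 (enough ε 0<ε {j} (ℕ.m∸n≡0⇒m≤n (sym f≡))) , low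
  search-spec ε 0<ε (suc f) j f≡ low with fromℕ 1 ≤? ε * fromℕ j
  ... | yes 1≤εj = subst (_≤ ε * fromℕ j) fromℕ-1 1≤εj , low
  ... | no  1≰εj = search-spec ε 0<ε f (suc j) (trans (cong ℕ.pred f≡) (ℕ.pred[m∸n]≡m∸[1+n] _ j))
                     (subst (ε * fromℕ j ≤_) fromℕ-1 (≰⇒≥ 1≰εj))

  -- (M / (M + 1))ᴹ ≤ 1/2 by Bernoulli's inequality for (1 + 1/M)ᴹ.
  halving : ∀ M → let s = fromℕ (suc M) * fromℕ (suc (suc M)) ⁻¹ in s ^ suc M * (1# + 1#) ≤ 1#
  halving M = ≤-trans (*-monoʳ-≤ (s ^ suc M) (<⇒≤ (^-positive 0<s (suc M)))
      (≤-trans (≤-reflexive (cong (1# +_) (sym (*-inverseʳ x (0<⇒≢0 0<x))))) (bernoulli (0≤x⁻¹ 0<x) (suc M))))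
    (≤-reflexive (trans (sym (^-distrib-* s (1# + x ⁻¹) (suc M))) (trans (^-congˡ (suc M) su≡1) (1^ (suc M)))))
    where
    x y s : Carrier
    x = fromℕ (suc M)
    y = fromℕ (suc (suc M))
    s = x * y ⁻¹
    0<x : 0# < x
    0<x = 0<fromℕ M
    0<y : 0# < y
    0<y = 0<fromℕ (suc M)
    0<s : 0# < s
    0<s = *-positive 0<x (0≤x⁻¹ 0<y , λ 0≡ → 0≢1 (trans (sym (zeroʳ y)) (trans (cong (y *_) 0≡) (*-inverseʳ y (0<⇒≢0 0<y)))))
    su≡1 : s * (1# + x ⁻¹) ≡ 1#
    su≡1 = trans (solve 3 (λ x x⁻¹ y⁻¹ → (x :* y⁻¹) :* (one :+ x⁻¹) := (x :+ x :* x⁻¹) :* y⁻¹) refl x (x ⁻¹) (y ⁻¹))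
      (trans (cong (λ z → (x + z) * y ⁻¹) (*-inverseʳ x (0<⇒≢0 0<x)))
      (trans (cong (_* y ⁻¹) (+-comm x 1#)) (*-inverseʳ y (0<⇒≢0 0<y))))
    1^ : ∀ m → 1# ^ m ≡ 1#
    1^ zero    = refl
    1^ (suc m) = trans (*-identityˡ _) (1^ m)

  powers-of-half : ∀ {y} → 0# ≤ y → y * (1# + 1#) ≤ 1# → ∀ x → y ^ x * fromℕ (2 ℕ.^ x) ≤ 1#
  powers-of-half 0≤y y2≤1 zero = ≤-reflexive (trans (*-identityˡ _) fromℕ-1)
  powers-of-half {y} 0≤y y2≤1 (suc x) = ≤-trans
    (≤-reflexive (trans (cong (y * y ^ x *_) (×1-homo-* 2 (2 ℕ.^ x)))
      (trans (cong (λ z → y * y ^ x * (z * fromℕ (2 ℕ.^ x))) (cong (1# +_) fromℕ-1))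
        (solve 4 (λ a b c d → a :* b :* (c :* d) := (a :* c) :* (b :* d)) refl y (y ^ x) (1# + 1#) (fromℕ (2 ℕ.^ x))))))
    (≤-trans (*-mono-≤ (*-nonNegative (0≤^ x) (0≤fromℕ (2 ℕ.^ x))) 0≤1 y2≤1 (powers-of-half 0≤y y2≤1 x)) (≤-reflexive (*-identityˡ 1#)))
    where
    0≤^ : ∀ x → 0# ≤ y ^ x
    0≤^ zero    = 0≤1
    0≤^ (suc x) = *-nonNegative 0≤y (0≤^ x)

-- Choice of the number and ratio of the thresholds.

m≤2^m : ∀ m → m ≤ℕ 2 ^ℕ m
m≤2^m zero    = z≤n
m≤2^m (suc m) = ℕ.≤-trans (ℕ.+-mono-≤ (ℕ.m^n>0 2 m) (m≤2^m m)) (ℕ.+-monoʳ-≤ (2 ^ℕ m) (ℕ.≤-reflexive (sym (ℕ.+-identityʳ _))))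

-- m and the number of calls spent on computing the grid: both are trivial if only one class is used.
GridSize : ℕ → ℕ → ℕ → Set
GridSize t m cost = m ≡ 0 × cost ≡ 1 ⊎ 2 ≤ℕ t × 1 ≤ℕ m × cost ≤ℕ 3 ℕ.+ (m ℕ.+ t)

module Parameters (𝔽 : ArchimedeanField) (ε : ArchimedeanField.Carrier 𝔽)
  (0<ε : ArchimedeanField._<_ 𝔽 (ArchimedeanField.0# 𝔽) ε) where
  open OrderedField 𝔽
  open Grid 𝔽
  open ProgramSemantics 𝔽 hiding (value)

  *-cancel-≤ : ∀ {x y z} → 0# < x → x * y ≤ x * z → y ≤ z
  *-cancel-≤ {x} {y} {z} 0<x xy≤xz = ≤-by (z - y)
    (*-cancel-≤0 0<x (subst (0# ≤_) (solve 3 (λ x y z → x :* z :- x :* y := x :* (z :- y)) refl x y z) (0≤y-x xy≤xz)))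
    (solve 2 (λ y z → y :+ (z :- y) := z) refl y z)

  0<2 : 0# < 1# + 1#
  0<2 = subst (0# <_) (cong (1# +_) fromℕ-1) (0<fromℕ 1)

  record Adequate (t m : ℕ) (s : Carrier) (cost : ℕ) : Set where
    field
      0<s      : 0# < s
      s≤1      : s ≤ 1#
      accurate : 1# ≤ ε ⊎ (∀ r → r ℕ.≤ t → (1# - s) + fromℕ (r ℕ.∸ 1) * s ^ m ≤ ε)
      -- The constant is 8 · 4, from m ≤ 8 N² log T and N ≤ 2/ε.
      exponent : fromℕ m ≤ fromℕ 32 * (ε ⁻¹) ^ 2 * fromℕ ⌊log₂ t ⌋
      size     : GridSize t m cost

  0≤exponent : ∀ l → 0# ≤ fromℕ 32 * (ε ⁻¹) ^ 2 * fromℕ l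
  0≤exponent l = *-nonNegative (*-nonNegative (0≤fromℕ 32) (*-nonNegative (0≤x⁻¹ 0<ε) (*-nonNegative (0≤x⁻¹ 0<ε) 0≤1))) (0≤fromℕ l)

  trivial : ∀ t → 1# ≤ ε ⊎ t ℕ.≤ 1 → Adequate t 0 (fromℕ 1) 1
  trivial t reason = record
    { 0<s = 0<fromℕ 0 ; s≤1 = ≤-reflexive fromℕ-1
    ; accurate = accurate reason
    ; exponent = 0≤exponent ⌊log₂ t ⌋
    ; size = inj₁ (refl , refl) }
    where
    accurate : 1# ≤ ε ⊎ t ℕ.≤ 1 → 1# ≤ ε ⊎ (∀ r → r ℕ.≤ t → (1# - fromℕ 1) + fromℕ (r ℕ.∸ 1) * 1# ≤ ε)
    accurate (inj₁ 1≤ε) = inj₁ 1≤ε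
    -- With at most one stage `r ∸ 1` is 0, so the last threshold, here 1, is multiplied by 0.
    accurate (inj₂ t≤1) = inj₂ λ r r≤t → ≤-trans (≤-reflexive (trans
      (cong₂ (λ x r → (1# - x) + fromℕ r * 1#) fromℕ-1 (ℕ.m≤n⇒m∸n≡0 (ℕ.≤-trans r≤t t≤1)))
      (trans (cong (_+ 0# * 1#) (-‿inverseʳ 1#)) (trans (+-identityˡ _) (zeroˡ 1#))))) (<⇒≤ 0<ε)

  module _ (t : ℕ) (2≤t : 2 ℕ.≤ t) (ε≤1 : ε ≤ 1#) (N′ : ℕ)
    (1≤εN : 1# ≤ ε * fromℕ (suc N′)) (εN′≤1 : ε * fromℕ N′ ≤ 1#) where
    private
      N M L x : ℕ
      N = suc N′
      M = N ℕ.+ N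
      L = log t 1 t
      x = L ℕ.+ (2 ℕ.+ N)
      N̂ M̂ y s τ : Carrier
      N̂ = fromℕ N
      M̂ = fromℕ M
      y = fromℕ (suc M)
      s = M̂ * y ⁻¹
      τ = s ^ (M ℕ.* x)
      0<y : 0# < y
      0<y = 0<fromℕ M
      0<N̂ : 0# < N̂
      0<N̂ = 0<fromℕ N′
      y⁻¹>0 : 0# < y ⁻¹
      y⁻¹>0 = 0≤x⁻¹ 0<y , λ 0≡ → 0≢1 (trans (sym (zeroʳ y)) (trans (cong (y *_) 0≡) (*-inverseʳ y (0<⇒≢0 0<y))))
      0<s : 0# < s
      0<s = *-positive (0<fromℕ (N′ ℕ.+ N)) y⁻¹>0
      y[1-s]≡1 : y * (1# - s) ≡ 1#
      y[1-s]≡1 = trans (solve 3 (λ y m y⁻¹ → y :* (one :- m :* y⁻¹) := y :- m :* (y :* y⁻¹)) refl y M̂ (y ⁻¹))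
        (trans (cong (λ z → y - M̂ * z) (*-inverseʳ y (0<⇒≢0 0<y))) (solve 1 (λ m → one :+ m :- m :* one := one) refl M̂))
      0≤1-s : 0# ≤ 1# - s
      0≤1-s = *-cancel-≤0 0<y (subst (0# ≤_) (sym y[1-s]≡1) 0≤1)
      s≤1 : s ≤ 1#
      s≤1 = ≤-by (1# - s) 0≤1-s (solve 1 (λ s → s :+ (one :- s) := one) refl s)

      1≤N̂ε : 1# ≤ N̂ * ε
      1≤N̂ε = subst (1# ≤_) (*-comm ε N̂) 1≤εN

      -- Multiply by N: since 1 - s = 1 / (2N + 1), the left side becomes 2N / (2N + 1) ≤ 1 ≤ N ε.
      2[1-s]≤ε : (1# + 1#) * (1# - s) ≤ ε
      2[1-s]≤ε = *-cancel-≤ 0<N̂ (≤-trans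
        (≤-trans (≤-reflexive (trans (solve 2 (λ n z → n :* ((one :+ one) :* z) := (n :+ n) :* z) refl N̂ (1# - s))
                   (cong (_* (1# - s)) (sym (×-homo-+ 1# N N)))))
          (≤-trans (*-monoˡ-≤ (1# - s) 0≤1-s (≤-by 1# 0≤1 (+-comm M̂ 1#))) (≤-reflexive y[1-s]≡1)))
        1≤N̂ε)

      -- This dictates `x`: t < 2^(L + 1) by `log-<`, and N ≤ 2^N. A logarithm of N would do as
      -- well, but would only improve the power of `ε ⁻¹`.
      2tN≤2^x : 2 ℕ.* t ℕ.* N ℕ.≤ 2 ℕ.^ x
      2tN≤2^x = ℕ.≤-trans (ℕ.*-mono-≤ (ℕ.*-monoʳ-≤ 2 (ℕ.<⇒≤ (log-< t 1 t ℕ.≤-refl (ℕ.m≤m+n t 1)))) (m≤2^m N))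
        (ℕ.≤-reflexive (trans (eq (2 ℕ.^ L) (2 ℕ.^ N)) (sym (ℕ.^-distribˡ-+-* 2 L (2 ℕ.+ N)))))
        where
        eq : ∀ a b → 2 ℕ.* (1 ℕ.* (2 ℕ.* a)) ℕ.* b ≡ a ℕ.* (2 ℕ.* (2 ℕ.* b))
        eq = solve-∀

      2tτ≤ε : (1# + 1#) * (fromℕ t * τ) ≤ ε
      2tτ≤ε = *-cancel-≤ 0<N̂ (≤-trans
        (≤-reflexive (trans (solve 4 (λ n t τ c → n :* (c :* (t :* τ)) := τ :* (c :* t :* n)) refl N̂ (fromℕ t) τ (1# + 1#))
          (cong (τ *_) (sym (trans (×1-homo-* (2 ℕ.* t) N) (cong (_* N̂) (trans (×1-homo-* 2 t) (cong (_* fromℕ t) (cong (1# +_) fromℕ-1)))))))))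
        (≤-trans (*-monoʳ-≤ τ (<⇒≤ (^-positive 0<s (M ℕ.* x))) (fromℕ-mono 2tN≤2^x))
          (≤-trans (≤-reflexive (cong (_* fromℕ (2 ℕ.^ x)) (sym (^-assocʳ s M x))))
            (≤-trans (powers-of-half (<⇒≤ (^-positive 0<s M)) (halving (N′ ℕ.+ N)) x) 1≤N̂ε))))

      accurate : ∀ r → r ℕ.≤ t → (1# - s) + fromℕ (r ℕ.∸ 1) * τ ≤ ε
      accurate r r≤t = *-cancel-≤ 0<2 (≤-trans
        (≤-reflexive (distribˡ (1# + 1#) (1# - s) _))
        (≤-trans (+-mono-≤ 2[1-s]≤ε (≤-trans (*-monoʳ-≤ (1# + 1#) (<⇒≤ 0<2)
            (*-monoˡ-≤ τ (<⇒≤ (^-positive 0<s (M ℕ.* x))) (fromℕ-mono (ℕ.≤-trans (ℕ.m∸n≤m r 1) r≤t)))) 2tτ≤ε))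
          (≤-reflexive (solve 1 (λ e → e :+ e := (one :+ one) :* e) refl ε))))

      ε⁻¹ : Carrier
      ε⁻¹ = ε ⁻¹

      -- By minimality of N, ε N = ε + ε (N - 1) ≤ 1 + 1.
      N̂≤2ε⁻¹ : N̂ ≤ (1# + 1#) * ε⁻¹
      N̂≤2ε⁻¹ = *-cancel-≤ 0<ε (≤-trans
        (≤-trans (≤-reflexive (solve 2 (λ e n → e :* (one :+ n) := e :+ e :* n) refl ε (fromℕ N′))) (+-mono-≤ ε≤1 εN′≤1))
        (≤-reflexive (sym (trans (solve 2 (λ e e⁻¹ → e :* ((one :+ one) :* e⁻¹) := (one :+ one) :* (e :* e⁻¹)) refl ε ε⁻¹)
          (trans (cong ((1# + 1#) *_) (*-inverseʳ ε (0<⇒≢0 0<ε))) (*-identityʳ _))))))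

      l : ℕ
      l = ⌊log₂ t ⌋

      1≤l : 1 ℕ.≤ l
      1≤l = ⌊log₂⌋-mono-≤ 2≤t

      L≤l : L ℕ.≤ l
      L≤l = ℕ.≤-trans (ℕ.≤-reflexive (sym (⌊log₂[2^n]⌋≡n L)))
        (⌊log₂⌋-mono-≤ (ℕ.≤-trans (ℕ.≤-reflexive (sym (ℕ.*-identityˡ _))) (log-≤ t 1 t (ℕ.≤-trans (s≤s z≤n) 2≤t))))

      -- The summands L, 2 and N of `x` are at most N l, 2 N l and N l. This uses l ≥ 1, hence T ≥
      -- 2.
      Mx≤8NNl : M ℕ.* x ℕ.≤ 8 ℕ.* (N ℕ.* N ℕ.* l)
      Mx≤8NNl = ℕ.≤-trans (ℕ.*-monoʳ-≤ M (ℕ.≤-trans (ℕ.+-mono-≤ L≤l (ℕ.+-mono-≤ {2} {2 ℕ.* (N ℕ.* l)} {N} {N ℕ.* l}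
          (ℕ.*-monoʳ-≤ 2 (ℕ.*-mono-≤ {1} {N} {1} {l} (s≤s z≤n) 1≤l)) (N≤Nl)))
          (ℕ.+-monoˡ-≤ (2 ℕ.* (N ℕ.* l) ℕ.+ N ℕ.* l) (ℕ.≤-trans (ℕ.≤-reflexive (sym (ℕ.*-identityˡ l))) (ℕ.*-monoˡ-≤ l {1} {N} (s≤s z≤n))))))
        (ℕ.≤-reflexive (eq N l))
        where
        N≤Nl : N ℕ.≤ N ℕ.* l
        N≤Nl = ℕ.≤-trans (ℕ.≤-reflexive (sym (ℕ.*-identityʳ N))) (ℕ.*-monoʳ-≤ N 1≤l)
        eq : ∀ N l → (N ℕ.+ N) ℕ.* (N ℕ.* l ℕ.+ (2 ℕ.* (N ℕ.* l) ℕ.+ N ℕ.* l)) ≡ 8 ℕ.* (N ℕ.* N ℕ.* l)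
        eq = solve-∀

      exponent : fromℕ (M ℕ.* x) ≤ fromℕ 32 * ε⁻¹ ^ 2 * fromℕ l
      exponent = ≤-trans (fromℕ-mono Mx≤8NNl) (≤-trans
        (≤-reflexive (trans (×1-homo-* 8 (N ℕ.* N ℕ.* l)) (cong (fromℕ 8 *_) (trans (×1-homo-* (N ℕ.* N) l) (cong (_* fromℕ l) (×1-homo-* N N))))))
        (≤-trans (*-monoʳ-≤ (fromℕ 8) (0≤fromℕ 8) (*-monoˡ-≤ (fromℕ l) (0≤fromℕ l)
            (*-mono-≤ (<⇒≤ 0<N̂) (*-nonNegative (<⇒≤ 0<2) (0≤x⁻¹ 0<ε)) N̂≤2ε⁻¹ N̂≤2ε⁻¹)))
          (≤-reflexive (trans (solve 4 (λ k e l c → k :* (c :* e :* (c :* e) :* l) := k :* (c :* c) :* (e :* (e :* one)) :* l)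
              refl (fromℕ 8) ε⁻¹ (fromℕ l) (1# + 1#))
            (cong (λ z → z * ε⁻¹ ^ 2 * fromℕ l) (trans (cong (fromℕ 8 *_) four) (sym (×1-homo-* 8 4))))))))
        where
        four : (1# + 1#) * (1# + 1#) ≡ fromℕ 4
        four = trans (cong (λ z → (1# + z) * (1# + z)) (sym fromℕ-1)) (sym (×1-homo-* 2 2))

    refined : Adequate t (M ℕ.* x) s (suc (suc (N ℕ.∸ 1) ℕ.+ (suc t ℕ.+ (suc M ℕ.+ 0))))
    refined = record { 0<s = 0<s ; s≤1 = s≤1 ; accurate = inj₂ accurate ; exponent = exponent
      ; size = inj₂ (2≤t , ℕ.≤-trans (s≤s z≤n) 3N≤Mx , ℕ.≤-trans (ℕ.≤-reflexive (eq N t)) (ℕ.+-monoʳ-≤ 3 (ℕ.+-monoˡ-≤ t 3N≤Mx))) }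
      where
      3N≤Mx : 3 ℕ.* N ℕ.≤ M ℕ.* x
      3N≤Mx = ℕ.≤-trans (ℕ.≤-trans (ℕ.m≤m+n (3 ℕ.* N) N) (ℕ.≤-reflexive (eq′ N))) (ℕ.*-monoʳ-≤ M {2} {x} (ℕ.≤-trans (s≤s (s≤s z≤n)) (ℕ.m≤n+m (2 ℕ.+ N) L)))
        where
        eq′ : ∀ N → 3 ℕ.* N ℕ.+ N ≡ (N ℕ.+ N) ℕ.* 2
        eq′ = solve-∀
      eq : ∀ N t → suc (N ℕ.+ (suc t ℕ.+ (suc (N ℕ.+ N) ℕ.+ 0))) ≡ 3 ℕ.+ (3 ℕ.* N ℕ.+ t)
      eq = solve-∀

  grid-adequate : ∀ t → 1 ℕ.≤ t → Adequate t (proj₁ (grid ε t)) (proj₂ (grid ε t)) (gridᶜ ε t)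
  grid-adequate t 1≤t with t ℕ.≤ᵇ 1 in eq
  ... | true  = trivial t (inj₂ (ℕ.≤ᵇ⇒≤ t 1 (subst True (sym eq) tt)))
  ... | false with fromℕ 1 ≤? ε
  ...   | yes 1≤ε = trivial t (inj₁ (subst (_≤ ε) fromℕ-1 1≤ε))
  ...   | no  1≰ε with searchFrom ε 1 | search-≥ (proj₁ (archimedean (ε ⁻¹)) ℕ.∸ 1) ε 1
        | search-spec ε 0<ε (proj₁ (archimedean (ε ⁻¹)) ℕ.∸ 1) 1 refl (≤-trans (≤-reflexive (zeroʳ ε)) 0≤1)
  ...     | suc N′ | _ | 1≤εN , εN′≤1 = refined t (ℕ.≰⇒> λ t≤1 → subst True eq (ℕ.≤⇒≤ᵇ t≤1)) (subst (ε ≤_) fromℕ-1 (≰⇒≥ 1≰ε)) N′ 1≤εN εN′≤1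

-- Estimating lengths and call counts.

module PowerBounds (Z : ℕ) (2≤Z : 2 ≤ℕ Z) where
  open import Data.Nat.Base using (_+_; _*_; _^_; _≤_)

  -- A crude calculus in which all quantities are compared with powers of one number. Products add
  -- exponents, and a sum costs one more factor because 2 ≤ Z.
  record AtMost (p x : ℕ) : Set where
    constructor atMost
    field
      bound : x ≤ Z ^ p
  open AtMost public

  private
    instance
      nonZero : ℕ.NonZero Z
      nonZero = ℕ.>-nonZero (ℕ.≤-trans (s≤s z≤n) 2≤Z)

  below : ∀ {p x y} → x ≤ y → AtMost p y → AtMost p x
  below x≤y (atMost y≤) = atMost (ℕ.≤-trans x≤y y≤)

  raise : ∀ {p x} q → AtMost p x → AtMost (q + p) x
  raise {p} q (atMost x≤) = atMost (ℕ.≤-trans x≤ (ℕ.^-monoʳ-≤ Z (ℕ.m≤n+m p q)))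

  base : ∀ {x} → x ≤ Z → AtMost 1 x
  base x≤Z = atMost (ℕ.≤-trans x≤Z (ℕ.≤-reflexive (sym (ℕ.*-identityʳ Z))))

  infixl 6 _⊞_
  infixl 7 _⊠_
  _⊞_ : ∀ {p x y} → AtMost p x → AtMost p y → AtMost (suc p) (x + y)
  _⊞_ {p} (atMost x≤) (atMost y≤) = atMost (ℕ.≤-trans (ℕ.+-mono-≤ x≤ y≤)
    (ℕ.≤-trans (ℕ.≤-reflexive (twice (Z ^ p))) (ℕ.*-monoˡ-≤ (Z ^ p) 2≤Z)))
    where
    twice : ∀ z → z + z ≡ 2 * z
    twice = solve-∀

  _⊠_ : ∀ {p q x y} → AtMost p x → AtMost q y → AtMost (p + q) (x * y)
  _⊠_ {p} {q} (atMost x≤) (atMost y≤) = atMost (ℕ.≤-trans (ℕ.*-mono-≤ x≤ y≤) (ℕ.≤-reflexive (sym (ℕ.^-distribˡ-+-* Z p q))))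

  next : ∀ {p x} → AtMost p x → AtMost (suc p) (suc x)
  next {p} x≤ = atMost {p} {1} (ℕ.m^n>0 Z p) ⊞ x≤

module Cost (𝔽 : ArchimedeanField) where
  open OrderedField 𝔽 using (Carrier)
  open import Data.Nat.Base using (_+_; _*_; _^_; _∸_; _≤_; _<_)
  open Execution 𝔽
  open ProgramSemantics 𝔽

  length-chain : ∀ c j xs A As → length (chain c j xs A As) ≡ suc c + length As
  length-chain zero    j xs A As = refl
  length-chain (suc c) j xs A As = cong suc (length-chain c j xs (remove j xs A) As)

  length-chains : ∀ c j xs As → length (chains c j xs As) ≡ suc c * length As
  length-chains c j xs []       = sym (ℕ.*-zeroʳ (suc c))
  length-chains c j xs (A ∷ As) = trans (length-chain c j xs A (chains c j xs As))
    (trans (cong (suc c ℕ.+_) (length-chains c j xs As)) (sym (ℕ.*-suc (suc c) (length As))))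

  length-masks : ∀ J c xs → length (masks J c xs) ≡ suc c ^ J
  length-masks zero    c xs = refl
  length-masks (suc J) c xs = trans (length-chains c J xs (masks J c xs)) (cong (suc c ℕ.*_) (length-masks J c xs))

  length-enter : ∀ s opt tab → length (enter s opt tab) ≤ suc (length tab)
  length-enter (t , zero  , A) opt      tab = ℕ.n≤1+n _
  length-enter (t , suc k , A) []       tab = ℕ.n≤1+n _
  length-enter (t , suc k , A) (c ∷ cs) tab = ℕ.≤-refl

  length-row : ∀ a J tab xs s acc → length (row a J tab xs s acc) ≤ suc a + length acc
  length-row zero    J tab xs (t , k , A) acc = length-enter (t , k , A) (option J tab xs (t , k , A)) acc
  length-row (suc a) J tab xs (t , k , A) acc =
    ℕ.≤-trans (length-enter (t , k ∸ suc a , A) (option J tab xs (t , k ∸ suc a , A)) (row a J tab xs (t , k , A) acc)) (s≤s (length-row a J tab xs (t , k , A) acc))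

  length-rows : ∀ As a J tab xs t k → length (rows As a J tab xs t k) ≤ length As * suc a + length tab
  length-rows []       a J tab xs t k = ℕ.≤-refl
  length-rows (A ∷ As) a J tab xs t k = ℕ.≤-trans (length-row a J tab xs (t , k , A) (rows As a J tab xs t k))
    (ℕ.≤-trans (ℕ.+-monoʳ-≤ (suc a) (length-rows As a J tab xs t k)) (ℕ.≤-reflexive (sym (ℕ.+-assoc (suc a) _ _))))

  length-table : ∀ c t As a J xs k → length (table c t As a J xs k) ≤ c * (length As * suc a)
  length-table zero    t As a J xs k = z≤n
  length-table (suc c) t As a J xs k = ℕ.≤-trans (length-rows As a J (table c (suc t) As a J xs k) xs t k)
    (ℕ.+-monoʳ-≤ (length As * suc a) (length-table c (suc t) As a J xs k))

  length-powers : ∀ m q s → length (powers m q s) ≡ m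
  length-powers zero    q s = refl
  length-powers (suc m) q s = cong suc (length-powers m _ s)

  chainsᶜ-mono : ∀ {h h′} c l → h ≤ h′ → chainsᶜ h c l ≤ chainsᶜ h′ c l
  chainsᶜ-mono c l h≤h′ = s≤s (ℕ.*-monoˡ-≤ (suc (chainᶜ c l)) h≤h′)

  -- `J′` holds the lengths of the lists of masks at their final bound, which turns the recursion
  -- into a multiple of one term; `c′` plays this part in `tableᶜ-≤`.
  masksᶜ-≤ : ∀ {J J′} c xs → J ≤ J′ → masksᶜ J c xs ≤ (2 + length xs) + J * suc (chainsᶜ (suc c ^ J′) c (length xs))
  masksᶜ-≤ {zero}       c xs _    = ℕ.≤-reflexive (sym (ℕ.+-identityʳ _))
  masksᶜ-≤ {suc J} {J′} c xs J<J′ = ℕ.≤-trans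
    (s≤s (ℕ.+-mono-≤ (masksᶜ-≤ {J} {J′} c xs (ℕ.<⇒≤ J<J′))
      (chainsᶜ-mono c (length xs) (ℕ.≤-trans (ℕ.≤-reflexive (length-masks J c xs)) (ℕ.^-monoʳ-≤ (suc c) (ℕ.<⇒≤ J<J′))))))
    (ℕ.≤-reflexive (eq (2 + length xs) (J * suc X) X))
    where
    X : ℕ
    X = chainsᶜ (suc c ^ J′) c (length xs)
    eq : ∀ a b x → suc (a + b + x) ≡ a + (suc x + b)
    eq = solve-∀

  findᶜ-mono : ∀ {h h′} l → h ≤ h′ → findᶜ h l ≤ findᶜ h′ l
  findᶜ-mono l h≤h′ = s≤s (ℕ.*-monoˡ-≤ (2 + l) h≤h′)

  rowsᶜ-mono : ∀ {h h′} g a J l → h ≤ h′ → rowsᶜ g a J h l ≤ rowsᶜ g a J h′ l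
  rowsᶜ-mono g a J l h≤h′ = s≤s (ℕ.*-monoʳ-≤ g (s≤s (ℕ.*-monoʳ-≤ (suc a) (s≤s (s≤s (ℕ.*-monoʳ-≤ J
    (ℕ.+-monoʳ-≤ 2 (ℕ.+-monoʳ-≤ l (ℕ.+-mono-≤ (findᶜ-mono l h≤h′) (findᶜ-mono l h≤h′))))))))))

  tableᶜ-≤ : ∀ {c c′} t As a J xs k → c ≤ c′ →
    tableᶜ c t As a J xs k ≤ 1 + c * suc (rowsᶜ (length As) a J (c′ * (length As * suc a)) (length xs))
  tableᶜ-≤ {zero}       t As a J xs k _    = ℕ.≤-refl
  tableᶜ-≤ {suc c} {c′} t As a J xs k c<c′ = ℕ.≤-trans
    (s≤s (ℕ.+-mono-≤ (tableᶜ-≤ {c} {c′} (suc t) As a J xs k (ℕ.<⇒≤ c<c′))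
      (rowsᶜ-mono (length As) a J (length xs) (ℕ.≤-trans (length-table c (suc t) As a J xs k) (ℕ.*-monoˡ-≤ (length As * suc a) (ℕ.<⇒≤ c<c′))))))
    (ℕ.≤-reflexive (eq (c * suc X) X))
    where
    X : ℕ
    X = rowsᶜ (length As) a J (c′ * (length As * suc a)) (length xs)
    eq : ∀ b x → suc (1 + b + x) ≡ 1 + (suc x + b)
    eq = solve-∀

  module Totals (Z : ℕ) (2≤Z : 2 ≤ Z) (gridCalls m vs h k : ℕ) (thresholds : List Carrier) (xs : List Applicant)
    (gridCalls≤ : gridCalls ≤ 3 + (Z + Z)) (thresholds≤ : length thresholds ≤ Z) (vs≤ : vs ≤ Z) (xs≤ : length xs ≤ Z)
    (h<Z : h < Z) (m+1<Z : suc m < Z) (count≤ : suc h ^ suc m ≤ Z) where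
    open PowerBounds Z 2≤Z

    private
      J g H l : ℕ
      J = suc m
      g = length (masks J h xs)
      l = length xs
      H = h * (g * suc h)
      As : List Mask
      As = masks J h xs

      pl : AtMost 1 l
      pl = base xs≤
      p2+l : AtMost 3 (2 + l)
      p2+l = next (next pl)
      ph : AtMost 1 h
      ph = base (ℕ.<⇒≤ h<Z)
      psh : AtMost 1 (suc h)
      psh = base h<Z
      pJ : AtMost 1 J
      pJ = base (ℕ.<⇒≤ m+1<Z)
      pcount : AtMost 1 (suc h ^ J)
      pcount = base count≤
      pg : AtMost 1 g
      pg = base (ℕ.≤-trans (ℕ.≤-reflexive (length-masks J h xs)) count≤)
      pH : AtMost 3 H
      pH = ph ⊠ (pg ⊠ psh)
      pchains : AtMost 8 (chainsᶜ (suc h ^ J) h l)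
      pchains = next (pcount ⊠ next (next (ph ⊠ p2+l)))
      pmasks : AtMost 11 (masksᶜ J h xs)
      pmasks = below (masksᶜ-≤ {J} {J} h xs ℕ.≤-refl) (raise 7 p2+l ⊞ pJ ⊠ next pchains)
      pfind : AtMost 7 (findᶜ H l)
      pfind = next (pH ⊠ p2+l)
      poption : AtMost 13 (optionᶜ J H l)
      poption = next (pJ ⊠ next (next (raise 7 pl ⊞ (pfind ⊞ pfind))))
      prows : AtMost 18 (rowsᶜ g h J H l)
      prows = next (pg ⊠ next (psh ⊠ next poption))
      ptable : AtMost 21 (tableᶜ h 1 As h J xs k)
      ptable = below (tableᶜ-≤ {h} {h} 1 As h J xs k ℕ.≤-refl) (next (ph ⊠ next prows))
      plength : AtMost 3 (length (table h 1 As h J xs k))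
      plength = below (length-table h 1 As h J xs k) pH
      papplicants : AtMost 5 (suc (vs * (2 + length thresholds)))
      papplicants = next (base vs≤ ⊠ next (next (base thresholds≤)))
      pgrid : AtMost 5 gridCalls
      pgrid = below gridCalls≤ (next (next (next (base ℕ.≤-refl ⊞ base ℕ.≤-refl))))

    -- `raise` pads exponents until the summands match; 30 is what then comes out.
    calls-≤ : suc (gridCalls + (suc (suc m + (suc (vs * (2 + length thresholds)) + finishᶜ h J xs k)) + 0)) ≤ Z ^ 30
    calls-≤ = bound (next (raise 23 pgrid ⊞ (next (raise 24 pJ ⊞ (raise 19 papplicants ⊞ next (raise 11 pmasks ⊞ (ptable ⊞ raise 17 (next plength)))))
      ⊞ atMost {27} {0} z≤n)))

    tableSize-≤ : suc (length (table h 1 As h J xs k) * (8 + (l + l))) ≤ Z ^ 30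
    tableSize-≤ = bound (raise 22 (next (plength ⊠ (8≤ ⊞ raise 1 (pl ⊞ pl)))))
      where
      8≤ : AtMost 3 8
      8≤ = atMost (ℕ.^-monoˡ-≤ 3 2≤Z)

-- The total in terms of n and T.

^-distribʳ-* : ∀ p m n → (m *ℕ n) ^ℕ p ≡ m ^ℕ p *ℕ n ^ℕ p
^-distribʳ-* zero    m n = refl
^-distribʳ-* (suc p) m n = trans (cong (m *ℕ n *ℕ_) (^-distribʳ-* p m n)) (interchange m n (m ^ℕ p) (n ^ℕ p))
  where
  interchange : ∀ a b c d → a *ℕ b *ℕ (c *ℕ d) ≡ a *ℕ c *ℕ (b *ℕ d)
  interchange = solve-∀

module Magnitude (n t m cost : ℕ) (1≤t : 1 ≤ℕ t) (size : GridSize t m cost) where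
  open import Data.Nat.Base using (_+_; _*_; _^_; _≤_; _<_)
  private
    instance
      nonZero : ℕ.NonZero t
      nonZero = ℕ.>-nonZero 1≤t

  -- One number bounding n, m and the count of masks at once. Its exponent of T is a multiple of m
  -- and so vanishes with m, as the claim requires at T = 1.
  power Z : ℕ
  power = t ^ (2 * m)
  Z = 2 * (1 ⊔ n) * power

  1≤power : 1 ≤ power
  1≤power = ℕ.m^n>0 t (2 * m)

  2n≤Z : ∀ {x} → x ≤ 2 * (1 ⊔ n) → x ≤ Z
  2n≤Z x≤ = ℕ.≤-trans (ℕ.≤-trans x≤ (ℕ.≤-reflexive (sym (ℕ.*-identityʳ _)))) (ℕ.*-monoʳ-≤ (2 * (1 ⊔ n)) 1≤power)

  2power≤Z : ∀ {x} → x ≤ 2 * power → x ≤ Z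
  2power≤Z x≤ = ℕ.≤-trans x≤ (ℕ.*-monoˡ-≤ power (ℕ.*-monoʳ-≤ 2 (ℕ.m≤m⊔n 1 n)))

  2≤Z : 2 ≤ Z
  2≤Z = 2n≤Z (ℕ.*-monoʳ-≤ 2 (ℕ.m≤m⊔n 1 n))

  n≤Z : n ≤ Z
  n≤Z = 2n≤Z (ℕ.≤-trans (ℕ.m≤n⊔m 1 n) (ℕ.m≤m+n (1 ⊔ n) _))

  suc≤2n : ∀ {h} → h ≤ n → suc h ≤ 2 * (1 ⊔ n)
  suc≤2n {h} h≤n = ℕ.≤-trans (ℕ.+-mono-≤ (ℕ.m≤m⊔n 1 n) (ℕ.≤-trans h≤n (ℕ.m≤n⊔m 1 n)))
    (ℕ.+-monoʳ-≤ (1 ⊔ n) (ℕ.≤-reflexive (sym (ℕ.+-identityʳ _))))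

  m≤power : m ≡ 0 ⊎ 2 ≤ t → m ≤ power
  m≤power (inj₁ refl) = z≤n
  m≤power (inj₂ 2≤t)  = ℕ.≤-trans (m≤2^m m) (ℕ.≤-trans (ℕ.^-monoˡ-≤ m 2≤t) (ℕ.^-monoʳ-≤ t (ℕ.m≤m+n m _)))

  small : m ≡ 0 ⊎ 2 ≤ t
  small = Sum.map proj₁ proj₁ size

  m≤Z : m ≤ Z
  m≤Z = 2power≤Z (ℕ.≤-trans (m≤power small) (ℕ.m≤m+n power _))

  m+1<Z : suc m < Z
  m+1<Z = Sum.[_,_]′ (λ (m≡0 , _) → subst (λ m → suc m < Z) (sym m≡0) 2≤Z) positive size
    where
    positive : 2 ≤ t × 1 ≤ m × cost ≤ 3 + (m + t) → suc m < Z
    positive (2≤t , 1≤m , _) = 2power≤Z (ℕ.≤-trans (ℕ.+-mono-≤ {2} {power} {m} {power}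
          (ℕ.≤-trans 2≤t (ℕ.≤-trans (ℕ.≤-reflexive (sym (ℕ.*-identityʳ t))) (ℕ.^-monoʳ-≤ t (ℕ.≤-trans 1≤m (ℕ.m≤m+n m _)))))
          (m≤power (inj₂ 2≤t)))
        (ℕ.+-monoʳ-≤ power (ℕ.≤-reflexive (sym (ℕ.+-identityʳ power)))))

  cost≤ : cost ≤ 3 + (Z + Z)
  cost≤ = Sum.[_,_]′ (λ (_ , cost≡1) → subst (_≤ 3 + (Z + Z)) (sym cost≡1) (s≤s z≤n)) positive size
    where
    positive : 2 ≤ t × 1 ≤ m × cost ≤ 3 + (m + t) → cost ≤ 3 + (Z + Z)
    positive (2≤t , 1≤m , cost≤) = ℕ.≤-trans cost≤ (ℕ.+-monoʳ-≤ 3 (ℕ.+-mono-≤ m≤Z (2power≤Z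
          (ℕ.≤-trans (ℕ.≤-trans (ℕ.≤-reflexive (sym (ℕ.*-identityʳ t))) (ℕ.^-monoʳ-≤ t (ℕ.≤-trans 1≤m (ℕ.m≤m+n m _)))) (ℕ.m≤m+n power _)))))

  -- One factor `suc h` is paid by n. Unless m = 0, T is at least 2, and each of the other m factors
  -- is at most 2T ≤ T².
  count≤ : ∀ {h} → h ≤ n → h ≤ t → suc h ^ suc m ≤ Z
  count≤ {h} h≤n h≤t = ℕ.*-mono-≤ (suc≤2n h≤n) (rest size)
    where
    rest : GridSize t m cost → suc h ^ m ≤ power
    rest (inj₁ (refl , _))      = ℕ.≤-refl
    rest (inj₂ (2≤t , _ , _)) = ℕ.≤-trans (ℕ.^-monoˡ-≤ m (ℕ.≤-trans (ℕ.+-mono-≤ 1≤t h≤t) (ℕ.≤-trans (ℕ.≤-reflexive (eq t)) (ℕ.*-monoˡ-≤ t 2≤t))))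
        (ℕ.≤-reflexive (trans (cong (λ x → (t * x) ^ m) (sym (ℕ.*-identityʳ t))) (ℕ.^-*-assoc t 2 m)))
      where
      eq : ∀ t → t + t ≡ 2 * t
      eq = solve-∀

  Z^≡ : ∀ S p → S * Z ^ p ≡ S * 2 ^ p * (1 ⊔ n) ^ p * t ^ (2 * m * p)
  Z^≡ S p = trans (cong (S *_) (trans (^-distribʳ-* p (2 * (1 ⊔ n)) power)
      (cong₂ _*_ (^-distribʳ-* p 2 (1 ⊔ n)) (ℕ.^-*-assoc t (2 * m) p))))
    (eq S (2 ^ p) ((1 ⊔ n) ^ p) (t ^ (2 * m * p)))
    where
    eq : ∀ a b c d → a * (b * c * d) ≡ a * b * c * d
    eq = solve-∀

-- Assembling the algorithm, its policy and the bounds.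

module Main (𝔽 : ArchimedeanField) (ε : ArchimedeanField.Carrier 𝔽)
  (0<ε : ArchimedeanField._<_ 𝔽 (ArchimedeanField.0# 𝔽) ε) (I : Hiring.Instance 𝔽) where
  open OrderedField 𝔽
  open Execution 𝔽
  open Hiring 𝔽
  open Instance I
  open Optimum 𝔽
  open Policies 𝔽 I
  open ProgramSemantics 𝔽 hiding (value)

  m cost : ℕ
  m = proj₁ (grid ε T)
  cost = gridᶜ ε T
  s : Carrier
  s = proj₂ (grid ε T)
  adequate : Parameters.Adequate 𝔽 ε 0<ε T m s cost
  adequate = Parameters.grid-adequate 𝔽 ε 0<ε T T≥1
  open Parameters.Adequate adequate using (0<s; s≤1; accurate; exponent) renaming (size to grid-size)
  open Grid.RoundedMarket 𝔽 I m s 0<s s≤1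
  open Grid 𝔽 using (applicants-toList)
  open Tables 𝔽 I gradedPool probOf≡ valueOf≡ (suc m) class<
  open Magnitude n T m cost T≥1 grid-size

  h : ℕ
  h = earliest T n

  h≡horizon : h ≡ horizon
  h≡horizon with T ℕ.≤ᵇ n in eq
  ... | true  = sym (ℕ.m≤n⇒m⊓n≡m (ℕ.≤ᵇ⇒≤ T n (subst True (sym eq) tt)))
  ... | false = sym (ℕ.m≥n⇒m⊓n≡n (ℕ.<⇒≤ (ℕ.≰⇒> λ T≤n → subst True eq (ℕ.≤⇒≤ᵇ T≤n))))

  applicantPool : List Applicant
  applicantPool = pool m s (toList V) (toList P)

  rawTable : List Entry
  rawTable = table h 1 (masks (suc m) h applicantPool) h (suc m) applicantPool k

  output : ⟦ TableTy ⟧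
  output = strip rawTable

  table≡ : rawTable ≡ finalTable
  table≡ = cong₂ (λ h xs → table h 1 (masks (suc m) h xs) h (suc m) xs k) h≡horizon (applicants-toList thresholds V P)

  length-pool : length applicantPool ≡ n
  length-pool = trans (cong length (applicants-toList thresholds V P)) (length-toList gradedPool)

  h≤n : h ≤ℕ n
  h≤n = ℕ.≤-trans (ℕ.≤-reflexive h≡horizon) (ℕ.m⊓n≤n T n)

  h≤T : h ≤ℕ T
  h≤T = ℕ.≤-trans (ℕ.≤-reflexive h≡horizon) (ℕ.m⊓n≤m T n)

  -- The exponent of T in `Z` to the power 30.
  e : ℕ
  e = 2 *ℕ m *ℕ 30

  e-bound : fromℕ e ≤ fromℕ (60 *ℕ 32) * (ε ⁻¹) ^ 2 * fromℕ ⌊log₂ T ⌋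
  e-bound = ≤-trans (≤-reflexive (trans (cong fromℕ (eq m)) (×1-homo-* 60 m)))
    (≤-trans (*-monoʳ-≤ (fromℕ 60) (0≤fromℕ 60) exponent)
      (≤-reflexive (trans (solve 4 (λ a b c d → a :* (b :* c :* d) := a :* b :* c :* d) refl (fromℕ 60) (fromℕ 32) ((ε ⁻¹) ^ 2) (fromℕ ⌊log₂ T ⌋))
        (cong (λ x → x * (ε ⁻¹) ^ 2 * fromℕ ⌊log₂ T ⌋) (sym (×1-homo-* 60 32))))))
    where
    eq : ∀ m → 2 *ℕ m *ℕ 30 ≡ 60 *ℕ m
    eq = solve-∀

  C : ℕ
  C = maxNodes *ℕ 2 ^ℕ 30

  open Cost.Totals 𝔽 Z 2≤Z cost m (length (toList V)) h k thresholds applicantPool cost≤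
    (ℕ.≤-trans (ℕ.≤-reflexive (Cost.length-powers 𝔽 m (fromℕ 1) s)) m≤Z)
    (ℕ.≤-trans (ℕ.≤-reflexive (length-toList V)) n≤Z)
    (ℕ.≤-trans (ℕ.≤-reflexive length-pool) n≤Z)
    (2n≤Z (suc≤2n h≤n)) m+1<Z (count≤ h≤n h≤T)
    using (calls-≤; tableSize-≤)

  run : Σ[ steps ∈ ℕ ] ((bodies , (encodeInput ε I ∷ []) ⊢ mainᵇ ⇓ output ⟨ steps ⟩) × steps ≤ℕ C *ℕ (1 ⊔ n) ^ℕ 30 *ℕ T ^ℕ e)
  run = Prod.map₂ (Prod.map₂ bound) (ProgramRuns.main-evaluates 𝔽 ε 0<ε n (toList V) (toList P) k T)
    where
    bound : ∀ {steps} → steps ≤ℕ maxNodes *ℕ suc (cost ℕ.+ (solveᶜ m s n (toList V) (toList P) k T ℕ.+ 0)) →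
            steps ≤ℕ C *ℕ (1 ⊔ n) ^ℕ 30 *ℕ T ^ℕ e
    bound steps≤ = ℕ.≤-trans steps≤ (ℕ.≤-trans (ℕ.*-monoʳ-≤ maxNodes calls-≤) (ℕ.≤-reflexive (Z^≡ maxNodes 30)))

  size-mask : ∀ {n} (A : Vec Bool n) → size MaskTy (toList A) ≡ 1 ℕ.+ (n ℕ.+ n)
  size-mask []              = refl
  size-mask {suc n} (a ∷ A) = cong (λ x → suc (suc x)) (trans (size-mask A) (sym (ℕ.+-suc n n)))

  -- A state has size 5 + 2n, pairing it with its choice adds 2, and the list cell adds 1.
  size-strip : ∀ {tab} → All CorrectEntry tab → size TableTy (strip tab) ≡ suc (length tab *ℕ (8 ℕ.+ (n ℕ.+ n)))
  size-strip [] = refl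
  size-strip {((s′ , i) , x) ∷ tab} (c ∷ cs) = trans
    (cong₂ (λ y z → suc (y ℕ.+ z)) (trans (cong (λ s′ → size (StateTy ⊗ nat) (s′ , i)) (CorrectEntry.encoded c))
      (cong (λ x → suc (suc (1 ℕ.+ suc (1 ℕ.+ x)) ℕ.+ 1)) (size-mask (State.available (CorrectEntry.state c))))) (size-strip cs))
    (eq n (length tab *ℕ (8 ℕ.+ (n ℕ.+ n))))
    where
    eq : ∀ a y → 7 ℕ.+ (a ℕ.+ a ℕ.+ 1 ℕ.+ (1 ℕ.+ y)) ≡ 9 ℕ.+ (a ℕ.+ a ℕ.+ y)
    eq = solve-∀

  size-output : size TableTy output ≤ℕ C *ℕ (1 ⊔ n) ^ℕ 30 *ℕ T ^ℕ e
  size-output = ℕ.≤-trans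
    (ℕ.≤-trans (ℕ.≤-reflexive (trans (cong (λ tab → size TableTy (strip tab)) table≡)
        (trans (size-strip (Complete.correct finalTable-complete))
          (cong₂ (λ tab l → suc (length tab *ℕ (8 ℕ.+ (l ℕ.+ l)))) (sym table≡) (sym length-pool)))))
      tableSize-≤)
    (ℕ.≤-trans (ℕ.≤-trans (ℕ.≤-reflexive (sym (ℕ.*-identityˡ _))) (ℕ.*-monoˡ-≤ (Z ^ℕ 30) (fits {1}))) (ℕ.≤-reflexive (Z^≡ maxNodes 30)))

  policy : Policy I
  policy = restrictedPolicy selection

  output-describes : Describes I output policy
  output-describes = subst (λ tab → Describes I (strip tab) policy) (sym table≡) finalTable-describes

  compatible : Compatible roundedMarket selection
  compatible = record
    { prob-class = λ same → cong roundedProb same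
    ; value-key  = λ {i} {b} same y≤ → ≤-trans (roundedValue-mono _ y≤) (≤-reflexive (cong (λ c → roundedValue c _) (sym same))) }

  near-optimal : (1# - ε) * reward I optimalPolicy ≤ reward I policy
  near-optimal with accurate
  -- For ε ≥ 1 the required reward is not positive.
  ... | inj₁ 1≤ε = ≤-trans
        (≤-by ((ε - 1#) * reward I optimalPolicy) (*-nonNegative (0≤y-x 1≤ε) (0≤reward optimalPolicy T (initial I)))
          (solve 2 (λ e r → (one :- e) :* r :+ (e :- one) :* r := one :- one) refl ε (reward I optimalPolicy)))
        (≤-trans (≤-reflexive (-‿inverseʳ 1#)) (0≤reward policy T (initial I)))
  ... | inj₂ close = restrictedPolicy-near-optimal selection ε rounding compatible (bound horizon (ℕ.m⊓n≤m T n))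
    where
    bound : ∀ r → r ≤ℕ T → 1# - ε ≤ guarantee (1# - s) τ r
    -- As T ≥ 1, the horizon is 0 only for n = 0.
    bound zero    r≤T = ≤-by (ε - ((1# - s) + fromℕ 0 * τ)) (0≤y-x (close 0 r≤T))
      (trans (cong (λ z → 1# - ε + (ε - ((1# - s) + z))) (zeroˡ τ))
        (trans (cong (λ z → 1# - ε + (ε - z)) (+-identityʳ _)) (solve 2 (λ e s → one :- e :+ (e :- (one :- s)) := one :- (one :- s)) refl ε s)))
    bound (suc r) r≤T = ≤-by (ε - ((1# - s) + fromℕ r * τ)) (0≤y-x (close (suc r) r≤T))
      (solve 4 (λ e s r t → one :- e :+ (e :- ((one :- s) :+ r :* t)) := one :- (one :- s) :- r :* t) refl ε s (fromℕ r) τ)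

theorem3p1 : (𝔽 : ArchimedeanField) →
    let open ArchimedeanField 𝔽
        open Execution 𝔽
        open Hiring 𝔽
        open Instance
    in
    Σ[ 𝒜 ∈ Algorithm InputTy TableTy ]
    ∃[ C ] ∃[ a ] ∃[ K ] ∃[ d ]
    ∀ (ε : Carrier) → 0# < ε → (I : Instance) →
    Σ[ D ∈ ⟦ TableTy ⟧ ] Σ[ steps ∈ ℕ ] Σ[ e ∈ ℕ ]
      (𝒜 on encodeInput ε I outputs D inSteps steps)
      × fromℕ e ≤ fromℕ K * (ε ⁻¹) ^ d * fromℕ ⌊log₂ T I ⌋
      × steps ≤ℕ C *ℕ (1 ⊔ n I) ^ℕ a *ℕ T I ^ℕ e
      × size TableTy D ≤ℕ C *ℕ (1 ⊔ n I) ^ℕ a *ℕ T I ^ℕ e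
      × (Σ[ ℋ ∈ Policy I ] Σ[ ℋ* ∈ Policy I ]
           Describes I D ℋ
           × Optimal I ℋ*
           × (1# - ε) * reward I ℋ* ≤ reward I ℋ)
theorem3p1 𝔽 = record { signature = Φ ; bodies = bodies ; main = mainᵇ } ,
  ProgramSemantics.maxNodes 𝔽 *ℕ 2 ^ℕ 30 , 30 , 60 *ℕ 32 , 2 , λ ε 0<ε I →
  let open Main 𝔽 ε 0<ε I
      open Policies 𝔽 I using (optimalPolicy; optimalPolicy-optimal)
  in
  output , proj₁ run , e , proj₁ (proj₂ run) , e-bound , proj₂ (proj₂ run) , size-output ,
  policy , optimalPolicy , output-describes , optimalPolicy-optimal , near-optimal
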